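{- For every integer $k\ge 2$ there is a constant $C=C(k)>0$, and for every integer $k\geq 2$ and every real $0<\epsilon<1$ there is $N_0=N_0(k,\epsilon)$, such that the following holds. Suppose that $G$ is a finite abelian group of order at least $N_0$, and that $A\subseteq G$ is $k$-stable. Then there exists a Bohr set $B\subseteq G$ of width at least $\epsilon^{C}$ and rank at most $\epsilon^{ -C}$ such that for any $g\in G$, either $|(A-g)\cap B|\leq \epsilon |B|$ or $|B\setminus (A-g)|\leq \epsilon|B|$.
   Context: Stability: for a group $G$ (written additively), $A\subseteq G$ and an integer $k\geq 2$, the set $A$ has the $k$-order property if there exist $a_1,\dots,a_k,b_1,\dots,b_k\in G$ such that $a_i+b_j\in A$ if and only if $i\leq j$. The set $A$ is $k$-stable if it does not have the $k$-order property. Bohr sets: for a finite abelian group $G$, let $\widehat{G}$ be the group of characters of $G$ (homomorphisms from $G$ to $\{z\in\mathbb{C}:|z|=1\}$). For $K\subseteq\widehat{G}$ and $\rho\in[0,1]$, the Bohr set with frequency set $K$ and width $\rho$ is $B(K,\rho)=\{x\in G: |\gamma(x)-1|\leq\rho \text{ for all }\gamma\in K\}$; $|K|$ is called its rank. (Width and rank refer to the chosen presentation $(K,\rho)$; in particular $B(\emptyset,\rho)=G$.) Notation: $A-g=\{a-g:a\in A\}$. -}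

module Defs where

open import Level using (Level; 0ℓ; _⊔_) renaming (suc to lsuc)
open import Algebra.Bundles using (AbelianGroup)
open import Algebra.Bundles.Raw using (RawMonoid)
open import Algebra.Morphism.Structures using (module MonoidMorphisms)
import Algebra.Properties.Group as GroupProperties
open import Data.Empty using (⊥-elim)
open import Data.Fin as Fin using (Fin)
open import Data.Integer as ℤ using (+_)
import Data.Integer.Properties as ℤ
open import Data.List using (List; length; filter; map; allFin)
open import Data.List.Relation.Unary.All using (All)
open import Data.List.Relation.Unary.AllPairs using (AllPairs)
open import Data.Nat as ℕ using (ℕ; zero; suc)
import Data.Nat.Properties as ℕ
open import Data.Product using (Σ-syntax; ∃-syntax; _×_; _,_)
open import Data.Rational as ℚ using (ℚ; mkℚ; 0ℚ; 1ℚ; ½; 1/_; NonZero)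
open import Data.Rational.Literals using (fromℤ)
import Data.Rational.Properties as ℚ
open import Data.Rational.Solver using (module +-*-Solver)
import Data.Rational.Unnormalised as ℚᵘ
import Data.Rational.Unnormalised.Properties as ℚᵘ
open import Data.Sum using (_⊎_; inj₁; inj₂)
open import Function.Bundles using (Inverse; _⇔_)
open import Relation.Binary.Definitions using (_Respects_)
open import Relation.Binary.PropositionalEquality as ≡
  using (_≡_; refl; sym; trans; cong; cong₂; subst; subst₂)
open import Relation.Nullary using (¬_; yes; no)
open import Relation.Nullary.Decidable using (map′; ¬?; _×-dec_)
open import Relation.Unary using (Pred; Decidable)

fromℕ : ℕ → ℚ
fromℕ n = fromℤ (+ n)

fromℕ-suc : ∀ n → fromℕ (suc n) ≡ fromℕ n ℚ.+ 1ℚ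
fromℕ-suc n = ℚ.toℚᵘ-injective (ℚᵘ.≃-trans (ℚᵘ.*≡* eq)
                (ℚᵘ.≃-sym (ℚ.toℚᵘ-homo-+ (fromℕ n) 1ℚ)))
  where
  eq : + suc n ℤ.* (+ 1 ℤ.* + 1) ≡ ((+ n ℤ.* + 1) ℤ.+ (+ 1 ℤ.* + 1)) ℤ.* + 1
  eq = trans (ℤ.*-identityʳ (+ suc n))
      (sym (trans (ℤ.*-identityʳ _)
      (trans (cong (ℤ._+ + 1) (ℤ.*-identityʳ (+ n)))
             (cong +_ (ℕ.+-comm n 1)))))

fromℕ-* : ∀ m n → fromℕ (m ℕ.* n) ≡ fromℕ m ℚ.* fromℕ n
fromℕ-* m n = ℚ.toℚᵘ-injective (ℚᵘ.≃-trans (ℚᵘ.*≡* eq)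
                (ℚᵘ.≃-sym (ℚ.toℚᵘ-homo-* (fromℕ m) (fromℕ n))))
  where
  eq : + (m ℕ.* n) ℤ.* (+ 1 ℤ.* + 1) ≡ (+ m ℤ.* + n) ℤ.* + 1
  eq = cong (ℤ._* + 1) (ℤ.pos-* m n)

fromℕ-mono : ∀ {m n} → m ℕ.≤ n → fromℕ m ℚ.≤ fromℕ n
fromℕ-mono m≤n = ℚ.*≤* (ℤ.*-monoʳ-≤-nonNeg (+ 1) (ℤ.+≤+ m≤n))

p≤∣numerator∣ : ∀ p → p ℚ.≤ fromℕ ℤ.∣ ℚ.numerator p ∣
p≤∣numerator∣ (mkℚ (+ a) d c) = ℚ.*≤*
  (ℤ.*-monoˡ-≤-nonNeg (+ a) (ℤ.+≤+ (ℕ.s≤s ℕ.z≤n)))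
p≤∣numerator∣ p@(mkℚ (ℤ.-[1+ a ]) d c) =
  ℚ.≤-trans {j = 0ℚ} (ℚ.<⇒≤ (ℚ.negative⁻¹ p)) (fromℕ-mono ℕ.z≤n)

step : ℕ → ℚ
step n = 1/ fromℕ (suc n)

0<step : ∀ n → 0ℚ ℚ.< step n
0<step n = ℚ.positive⁻¹ (step n) ⦃ ℚ.1/pos⇒pos (fromℕ (suc n)) ⦄

step-small : ∀ e → 0ℚ ℚ.< e → ∃[ N ] (∀ n → N ℕ.≤ n → step n ℚ.≤ e)
step-small e 0<e with e | ℚ.positive 0<e
... | mkℚ (+ suc a) d c | _ = d , λ n d≤n → ℚ.*≤* (ℤ.+≤+ (
  ℕ.≤-trans (ℕ.≤-reflexive (ℕ.*-identityˡ (suc d)))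
  (ℕ.≤-trans (ℕ.s≤s d≤n) (ℕ.m≤n*m (suc n) (suc a)))))

½-split : ∀ e → e ℚ.* ½ ℚ.+ e ℚ.* ½ ≡ e
½-split e = trans (sym (ℚ.*-distribˡ-+ e ½ ½)) (ℚ.*-identityʳ e)

0<* : ∀ {p q} → 0ℚ ℚ.< p → 0ℚ ℚ.< q → 0ℚ ℚ.< p ℚ.* q
0<* {p} {q} 0<p 0<q =
  ℚ.positive⁻¹ _ ⦃ ℚ.pos*pos⇒pos p ⦃ ℚ.positive 0<p ⦄ q ⦃ ℚ.positive 0<q ⦄ ⦄

0<½* : ∀ {e} → 0ℚ ℚ.< e → 0ℚ ℚ.< e ℚ.* ½
0<½* 0<e = 0<* 0<e (ℚ.positive⁻¹ ½)

p≤∣p∣ : ∀ p → p ℚ.≤ ℚ.∣ p ∣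
p≤∣p∣ p with ℚ.≤-total 0ℚ p
... | inj₁ 0≤p = ℚ.≤-reflexive (sym (ℚ.0≤p⇒∣p∣≡p 0≤p))
... | inj₂ p≤0 = ℚ.≤-trans p≤0 (ℚ.0≤∣p∣ p)

near⇒≤ : ∀ {a b e} → ℚ.∣ a ℚ.- b ∣ ℚ.≤ e → a ℚ.≤ b ℚ.+ e
near⇒≤ {a} {b} {e} h = subst (ℚ._≤ b ℚ.+ e) eq
  (ℚ.+-monoʳ-≤ b (ℚ.≤-trans (p≤∣p∣ (a ℚ.- b)) h))
  where
  open +-*-Solver
  eq : b ℚ.+ (a ℚ.- b) ≡ a
  eq = solve 2 (λ a b → b :+ (a :- b) := a) refl a b

≤⇒near : ∀ {a b e} → a ℚ.≤ b ℚ.+ e → b ℚ.≤ a ℚ.+ e → ℚ.∣ a ℚ.- b ∣ ℚ.≤ e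
≤⇒near {a} {b} {e} h₁ h₂ with ℚ.∣p∣≡p∨∣p∣≡-p (a ℚ.- b)
... | inj₁ eq = subst₂ ℚ._≤_ (sym eq) lem (ℚ.+-monoˡ-≤ (ℚ.- b) h₁)
  where
  open +-*-Solver
  lem : (b ℚ.+ e) ℚ.- b ≡ e
  lem = solve 2 (λ b e → (b :+ e) :- b := e) refl b e
... | inj₂ eq = subst₂ ℚ._≤_ (trans lem′ (sym eq)) lem (ℚ.+-monoˡ-≤ (ℚ.- a) h₂)
  where
  open +-*-Solver
  lem : (a ℚ.+ e) ℚ.- a ≡ e
  lem = solve 2 (λ b e → (b :+ e) :- b := e) refl a e
  lem′ : b ℚ.- a ≡ ℚ.- (a ℚ.- b)
  lem′ = solve 2 (λ a b → b :- a := :- (a :- b)) refl a b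

0≤-mono-* : ∀ {a b c d} → 0ℚ ℚ.≤ a → 0ℚ ℚ.≤ d → a ℚ.≤ b → c ℚ.≤ d → a ℚ.* c ℚ.≤ b ℚ.* d
0≤-mono-* {a} {b} {c} {d} 0≤a 0≤d a≤b c≤d = ℚ.≤-trans
  (ℚ.*-monoˡ-≤-nonNeg a ⦃ ℚ.nonNegative 0≤a ⦄ c≤d)
  (ℚ.*-monoʳ-≤-nonNeg d ⦃ ℚ.nonNegative 0≤d ⦄ a≤b)

square-cancel-≤ : ∀ {a b} → 0ℚ ℚ.< b → a ℚ.* a ℚ.≤ b ℚ.* b → a ℚ.≤ b
square-cancel-≤ {a} {b} 0<b h = ℚ.≮⇒≥ λ b<a → ℚ.<-irrefl refl (ℚ.<-≤-trans
  (ℚ.<-trans (ℚ.*-monoʳ-<-pos b ⦃ ℚ.positive 0<b ⦄ b<a)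
             (ℚ.*-monoˡ-<-pos a ⦃ ℚ.positive (ℚ.<-trans 0<b b<a) ⦄ b<a)) h)

record ℝ : Set where
  constructor mkℝ
  field
    seq    : ℕ → ℚ
    cauchy : ∀ e → 0ℚ ℚ.< e →
             ∃[ N ] (∀ m n → N ℕ.≤ m → N ℕ.≤ n → ℚ.∣ seq m ℚ.- seq n ∣ ℚ.≤ e)

open ℝ public

infix  4 _≃_ _≤_ _<_
infixl 6 _+_
infixl 7 _*_
infixr 8 _^_
infix  8 -_

_≃_ : ℝ → ℝ → Set
x ≃ y = ∀ e → 0ℚ ℚ.< e → ∃[ N ] (∀ n → N ℕ.≤ n → ℚ.∣ seq x n ℚ.- seq y n ∣ ℚ.≤ e)

_≤_ : ℝ → ℝ → Set
x ≤ y = ∀ e → 0ℚ ℚ.< e → ∃[ N ] (∀ n → N ℕ.≤ n → seq x n ℚ.≤ seq y n ℚ.+ e)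

_<_ : ℝ → ℝ → Set
x < y = ∃[ e ] 0ℚ ℚ.< e × ∃[ N ] (∀ n → N ℕ.≤ n → seq x n ℚ.+ e ℚ.≤ seq y n)

fromℚ : ℚ → ℝ
fromℚ q = mkℝ (λ _ → q) λ e 0<e → 0 , λ _ _ _ _ →
  subst (λ p → ℚ.∣ p ∣ ℚ.≤ e) (sym (ℚ.+-inverseʳ q)) (ℚ.<⇒≤ 0<e)

0ℝ 1ℝ : ℝ
0ℝ = fromℚ 0ℚ
1ℝ = fromℚ 1ℚ

ℕ→ℝ : ℕ → ℝ
ℕ→ℝ n = fromℚ (fromℕ n)

_+_ : ℝ → ℝ → ℝ
x + y = mkℝ (λ n → seq x n ℚ.+ seq y n) λ e 0<e →
  let (M , hx) = cauchy x (e ℚ.* ½) (0<½* 0<e)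
      (N , hy) = cauchy y (e ℚ.* ½) (0<½* 0<e)
  in M ℕ.⊔ N , λ m n m≥ n≥ → subst₂ ℚ._≤_
       (cong ℚ.∣_∣ (lem (seq x m) (seq x n) (seq y m) (seq y n))) (½-split e)
       (ℚ.≤-trans
         (ℚ.∣p+q∣≤∣p∣+∣q∣ (seq x m ℚ.- seq x n) (seq y m ℚ.- seq y n))
         (ℚ.+-mono-≤
           (hx m n (ℕ.m⊔n≤o⇒m≤o M N m≥) (ℕ.m⊔n≤o⇒m≤o M N n≥))
           (hy m n (ℕ.m⊔n≤o⇒n≤o M N m≥) (ℕ.m⊔n≤o⇒n≤o M N n≥))))
  where
  open +-*-Solver
  lem : ∀ a b c d → (a ℚ.- b) ℚ.+ (c ℚ.- d) ≡ (a ℚ.+ c) ℚ.- (b ℚ.+ d)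
  lem = solve 4 (λ a b c d → (a :- b) :+ (c :- d) := (a :+ c) :- (b :+ d)) refl

-_ : ℝ → ℝ
- x = mkℝ (λ n → ℚ.- seq x n) λ e 0<e →
  let (N , h) = cauchy x e 0<e
  in N , λ m n m≥ n≥ → subst (ℚ._≤ e)
       (trans (sym (ℚ.∣-p∣≡∣p∣ (seq x m ℚ.- seq x n)))
              (cong ℚ.∣_∣ (ℚ.neg-distrib-+ (seq x m) (ℚ.- seq x n))))
       (h m n m≥ n≥)

eventually-bounded : ∀ x → ∃[ B ] 0ℚ ℚ.< B × ∃[ N ] (∀ n → N ℕ.≤ n → ℚ.∣ seq x n ∣ ℚ.≤ B)
eventually-bounded x =
  let (N , h) = cauchy x 1ℚ (ℚ.positive⁻¹ 1ℚ)
  in  1ℚ ℚ.+ ℚ.∣ seq x N ∣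
    , ℚ.+-mono-<-≤ (ℚ.positive⁻¹ 1ℚ) (ℚ.0≤∣p∣ (seq x N))
    , N
    , λ n n≥ → subst (ℚ._≤ 1ℚ ℚ.+ ℚ.∣ seq x N ∣)
        (cong ℚ.∣_∣ (lem (seq x n) (seq x N)))
        (ℚ.≤-trans (ℚ.∣p+q∣≤∣p∣+∣q∣ (seq x n ℚ.- seq x N) (seq x N))
                   (ℚ.+-monoˡ-≤ ℚ.∣ seq x N ∣ (h n N n≥ ℕ.≤-refl)))
  where
  open +-*-Solver
  lem : ∀ a b → (a ℚ.- b) ℚ.+ b ≡ a
  lem = solve 2 (λ a b → (a :- b) :+ b := a) refl

_*_ : ℝ → ℝ → ℝ
x * y = mkℝ (λ n → seq x n ℚ.* seq y n) λ e 0<e →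
  let (B , 0<B , L , bx) = eventually-bounded x
      (C , 0<C , M , by) = eventually-bounded y
      0<S      = ℚ.+-mono-< 0<C 0<B
      instance
        S-pos  = ℚ.positive 0<S
        S-nz   = ℚ.pos⇒nonZero (C ℚ.+ B)
      d        = e ℚ.* 1/ (C ℚ.+ B)
      0<d      = 0<* 0<e (ℚ.positive⁻¹ _ ⦃ ℚ.1/pos⇒pos (C ℚ.+ B) ⦄)
      (P , hx) = cauchy x d 0<d
      (Q , hy) = cauchy y d 0<d
      K        = (L ℕ.⊔ M) ℕ.⊔ (P ℕ.⊔ Q)
      ≥L : ∀ {n} → K ℕ.≤ n → L ℕ.≤ n
      ≥L k     = ℕ.m⊔n≤o⇒m≤o L M (ℕ.m⊔n≤o⇒m≤o _ (P ℕ.⊔ Q) k)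
      ≥M : ∀ {n} → K ℕ.≤ n → M ℕ.≤ n
      ≥M k     = ℕ.m⊔n≤o⇒n≤o L M (ℕ.m⊔n≤o⇒m≤o _ (P ℕ.⊔ Q) k)
      ≥P : ∀ {n} → K ℕ.≤ n → P ℕ.≤ n
      ≥P k     = ℕ.m⊔n≤o⇒m≤o P Q (ℕ.m⊔n≤o⇒n≤o (L ℕ.⊔ M) _ k)
      ≥Q : ∀ {n} → K ℕ.≤ n → Q ℕ.≤ n
      ≥Q k     = ℕ.m⊔n≤o⇒n≤o P Q (ℕ.m⊔n≤o⇒n≤o (L ℕ.⊔ M) _ k)
  in K , λ m n m≥ n≥ →
    subst (λ p → ℚ.∣ p ∣ ℚ.≤ e) (lem (seq x m) (seq x n) (seq y m) (seq y n))
      (ℚ.≤-trans (ℚ.∣p+q∣≤∣p∣+∣q∣ ((seq x m ℚ.- seq x n) ℚ.* seq y m)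
                                  (seq x n ℚ.* (seq y m ℚ.- seq y n)))
      (subst₂ ℚ._≤_
        (sym (cong₂ ℚ._+_ (ℚ.∣p*q∣≡∣p∣*∣q∣ (seq x m ℚ.- seq x n) (seq y m))
                          (ℚ.∣p*q∣≡∣p∣*∣q∣ (seq x n) (seq y m ℚ.- seq y n))))
        (total e B C)
        (ℚ.+-mono-≤
          (0≤-mono-* (ℚ.0≤∣p∣ (seq x m ℚ.- seq x n)) (ℚ.<⇒≤ 0<C)
            (hx m n (≥P m≥) (≥P n≥)) (by m (≥M m≥)))
          (0≤-mono-* (ℚ.0≤∣p∣ (seq x n)) (ℚ.<⇒≤ 0<d)
            (bx n (≥L n≥)) (hy m n (≥Q m≥) (≥Q n≥))))))
  where
  open +-*-Solver
  lem : ∀ a b c d → (a ℚ.- b) ℚ.* c ℚ.+ b ℚ.* (c ℚ.- d) ≡ a ℚ.* c ℚ.- b ℚ.* d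
  lem = solve 4 (λ a b c d → (a :- b) :* c :+ b :* (c :- d) := a :* c :- b :* d) refl

  total : ∀ e B C .⦃ _ : NonZero (C ℚ.+ B) ⦄ →
          (e ℚ.* 1/ (C ℚ.+ B)) ℚ.* C ℚ.+ B ℚ.* (e ℚ.* 1/ (C ℚ.+ B)) ≡ e
  total e B C = trans
    (solve 4 (λ e i B C → (e :* i) :* C :+ B :* (e :* i) := e :* (i :* (C :+ B)))
      refl e (1/ (C ℚ.+ B)) B C)
    (trans (cong (e ℚ.*_) (ℚ.*-inverseˡ (C ℚ.+ B))) (ℚ.*-identityʳ e))

_^_ : ℝ → ℕ → ℝ
x ^ zero  = 1ℝ
x ^ suc n = x * x ^ n

-- If 0 < x is witnessed by the rational e, then seq x n ⊔ e is eventually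
-- equal to seq x n and is bounded away from zero for all n.
inverse : (x : ℝ) → 0ℝ < x → ℝ
inverse x (e , 0<e , N , e≤x) = mkℝ
  (λ n → (1/ (seq x n ℚ.⊔ e)) ⦃ nz n ⦄)
  λ d 0<d →
    let (M , h) = cauchy x (d ℚ.* (e ℚ.* e)) (0<* 0<d (0<* 0<e 0<e))
    in  N ℕ.⊔ M , λ m n m≥ n≥ →
          let m≥N = ℕ.m⊔n≤o⇒m≤o N M m≥ ; m≥M = ℕ.m⊔n≤o⇒n≤o N M m≥
              n≥N = ℕ.m⊔n≤o⇒m≤o N M n≥ ; n≥M = ℕ.m⊔n≤o⇒n≤o N M n≥
          in ≤⇒near (bound d 0<d m n m≥N n≥N (near⇒≤ (h n m n≥M m≥M)))
                    (bound d 0<d n m n≥N m≥N (near⇒≤ (h m n m≥M n≥M)))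
  where
  y : ℕ → ℚ
  y n = seq x n ℚ.⊔ e

  e≤y : ∀ n → e ℚ.≤ y n
  e≤y n = ℚ.p≤q⊔p (seq x n) e

  0<y : ∀ n → 0ℚ ℚ.< y n
  0<y n = ℚ.<-≤-trans 0<e (e≤y n)

  nz : ∀ n → NonZero (y n)
  nz n = ℚ.>-nonZero (0<y n)

  y≡x : ∀ n → N ℕ.≤ n → y n ≡ seq x n
  y≡x n n≥N = ℚ.p≥q⇒p⊔q≡p (subst (ℚ._≤ seq x n) (ℚ.+-identityˡ e) (e≤x n n≥N))

  cross : ∀ a b d → 0ℚ ℚ.≤ d → e ℚ.≤ a → e ℚ.≤ b → (0<a : 0ℚ ℚ.< a) (0<b : 0ℚ ℚ.< b) →
          b ℚ.≤ a ℚ.+ d ℚ.* (e ℚ.* e) →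
          (1/ a) ⦃ ℚ.>-nonZero 0<a ⦄ ℚ.≤ (1/ b) ⦃ ℚ.>-nonZero 0<b ⦄ ℚ.+ d
  cross a b d 0≤d e≤a e≤b 0<a 0<b h =
    ℚ.*-cancelʳ-≤-pos (a ℚ.* b) ⦃ ℚ.positive (0<* 0<a 0<b) ⦄
      (subst₂ ℚ._≤_ (sym lhs) (sym rhs)
        (ℚ.≤-trans h (ℚ.+-monoʳ-≤ a
          (ℚ.*-monoˡ-≤-nonNeg d ⦃ ℚ.nonNegative 0≤d ⦄
            (0≤-mono-* (ℚ.<⇒≤ 0<e) (ℚ.<⇒≤ 0<b) e≤a e≤b)))))
    where
    open +-*-Solver
    instance
      a-nz = ℚ.>-nonZero 0<a
      b-nz = ℚ.>-nonZero 0<b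
    lhs : 1/ a ℚ.* (a ℚ.* b) ≡ b
    lhs = trans (sym (ℚ.*-assoc (1/ a) a b))
                (trans (cong (ℚ._* b) (ℚ.*-inverseˡ a)) (ℚ.*-identityˡ b))
    rhs : (1/ b ℚ.+ d) ℚ.* (a ℚ.* b) ≡ a ℚ.+ d ℚ.* (a ℚ.* b)
    rhs = trans
      (solve 4 (λ i a b d → (i :+ d) :* (a :* b) := a :* (i :* b) :+ d :* (a :* b))
        refl (1/ b) a b d)
      (cong (ℚ._+ d ℚ.* (a ℚ.* b))
        (trans (cong (a ℚ.*_) (ℚ.*-inverseˡ b)) (ℚ.*-identityʳ a)))

  bound : ∀ d → 0ℚ ℚ.< d → ∀ m n → N ℕ.≤ m → N ℕ.≤ n →
          seq x n ℚ.≤ seq x m ℚ.+ d ℚ.* (e ℚ.* e) →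
          (1/ (y m)) ⦃ nz m ⦄ ℚ.≤ (1/ (y n)) ⦃ nz n ⦄ ℚ.+ d
  bound d 0<d m n m≥N n≥N h = cross (y m) (y n) d (ℚ.<⇒≤ 0<d)
    (e≤y m) (e≤y n) (0<y m) (0<y n)
    (subst₂ (λ p q → p ℚ.≤ q ℚ.+ d ℚ.* (e ℚ.* e))
      (sym (y≡x n n≥N)) (sym (y≡x m m≥N)) h)

-- The largest multiple s = j * d with j ≤ k and s² ≤ q (zero if there is none).
rootBelow : (q d : ℚ) → ℕ → ℚ
rootBelow q d zero = 0ℚ
rootBelow q d (suc k) with (fromℕ (suc k) ℚ.* d) ℚ.* (fromℕ (suc k) ℚ.* d) ℚ.≤? q
... | yes _ = fromℕ (suc k) ℚ.* d
... | no  _ = rootBelow q d k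

sqrtApprox : ℕ → ℚ → ℚ
sqrtApprox n q = rootBelow q (step n) (ℤ.∣ ℚ.numerator q ∣ ℕ.* suc n)

rootBelow-nonneg : ∀ q d k → 0ℚ ℚ.≤ d → 0ℚ ℚ.≤ rootBelow q d k
rootBelow-nonneg q d zero    0≤d = ℚ.≤-refl
rootBelow-nonneg q d (suc k) 0≤d
  with (fromℕ (suc k) ℚ.* d) ℚ.* (fromℕ (suc k) ℚ.* d) ℚ.≤? q
... | yes _ = subst (ℚ._≤ fromℕ (suc k) ℚ.* d) (ℚ.*-zeroˡ d)
                (ℚ.*-monoʳ-≤-nonNeg d ⦃ ℚ.nonNegative 0≤d ⦄ (fromℕ-mono ℕ.z≤n))
... | no  _ = rootBelow-nonneg q d k 0≤d

rootBelow-lower : ∀ q d k →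
  rootBelow q d k ≡ 0ℚ ⊎ rootBelow q d k ℚ.* rootBelow q d k ℚ.≤ q
rootBelow-lower q d zero = inj₁ refl
rootBelow-lower q d (suc k)
  with (fromℕ (suc k) ℚ.* d) ℚ.* (fromℕ (suc k) ℚ.* d) ℚ.≤? q
... | yes h = inj₂ h
... | no  _ = rootBelow-lower q d k

rootBelow-upper : ∀ q d k → 0ℚ ℚ.≤ d →
  q ℚ.≤ (fromℕ (suc k) ℚ.* d) ℚ.* (fromℕ (suc k) ℚ.* d) →
  q ℚ.≤ (rootBelow q d k ℚ.+ d) ℚ.* (rootBelow q d k ℚ.+ d)
rootBelow-upper q d zero 0≤d h = subst (λ t → q ℚ.≤ t ℚ.* t)
  (trans (ℚ.*-identityˡ d) (sym (ℚ.+-identityˡ d))) h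
rootBelow-upper q d (suc k) 0≤d h
  with (fromℕ (suc k) ℚ.* d) ℚ.* (fromℕ (suc k) ℚ.* d) ℚ.≤? q
... | yes _ = subst (λ t → q ℚ.≤ t ℚ.* t) eq h
  where
  open +-*-Solver
  eq : fromℕ (suc (suc k)) ℚ.* d ≡ fromℕ (suc k) ℚ.* d ℚ.+ d
  eq = trans (cong (ℚ._* d) (fromℕ-suc (suc k)))
      (trans (ℚ.*-distribʳ-+ d (fromℕ (suc k)) 1ℚ)
             (cong (fromℕ (suc k) ℚ.* d ℚ.+_) (ℚ.*-identityˡ d)))
... | no  ≰ = rootBelow-upper q d k 0≤d (ℚ.<⇒≤ (ℚ.≰⇒> ≰))

sqrtApprox-upper : ∀ n q →
  q ℚ.≤ (sqrtApprox n q ℚ.+ step n) ℚ.* (sqrtApprox n q ℚ.+ step n)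
sqrtApprox-upper n q = rootBelow-upper q (step n) (a ℕ.* suc n) 0≤s
  (ℚ.≤-trans (p≤∣numerator∣ q)
  (ℚ.≤-trans (fromℕ-mono (a≤a*a a))
  (subst (ℚ._≤ t ℚ.* t) (sym (fromℕ-* a a))
    (0≤-mono-* (fromℕ-mono ℕ.z≤n) (ℚ.≤-trans (fromℕ-mono ℕ.z≤n) a≤t) a≤t a≤t))))
  where
  a = ℤ.∣ ℚ.numerator q ∣
  0≤s = ℚ.<⇒≤ (0<step n)
  t = fromℕ (suc (a ℕ.* suc n)) ℚ.* step n
  a≤a*a : ∀ a → a ℕ.≤ a ℕ.* a
  a≤a*a zero    = ℕ.z≤n
  a≤a*a (suc a) = ℕ.m≤m*n (suc a) (suc a)
  a≤t : fromℕ a ℚ.≤ t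
  a≤t = subst (ℚ._≤ t)
    (trans (cong (ℚ._* step n) (fromℕ-* a (suc n)))
    (trans (ℚ.*-assoc (fromℕ a) (fromℕ (suc n)) (step n))
    (trans (cong (fromℕ a ℚ.*_) (ℚ.*-inverseʳ (fromℕ (suc n)))) (ℚ.*-identityʳ (fromℕ a)))))
    (ℚ.*-monoʳ-≤-nonNeg (step n) ⦃ ℚ.nonNegative 0≤s ⦄
      (fromℕ-mono (ℕ.n≤1+n (a ℕ.* suc n))))

sqrtApprox-continuous : ∀ m n p q δ → 0ℚ ℚ.< δ → p ℚ.≤ q ℚ.+ δ ℚ.* δ →
  sqrtApprox m p ℚ.≤ sqrtApprox n q ℚ.+ (step n ℚ.+ δ)
sqrtApprox-continuous m n p q δ 0<δ h
  with rootBelow-lower p (step m) (ℤ.∣ ℚ.numerator p ∣ ℕ.* suc m)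
... | inj₁ eq = subst (ℚ._≤ t ℚ.+ (step n ℚ.+ δ)) (sym eq)
                  (ℚ.+-mono-≤ 0≤t (ℚ.<⇒≤ (ℚ.+-mono-< (0<step n) 0<δ)))
  where
  t   = sqrtApprox n q
  0≤t = rootBelow-nonneg q (step n) (ℤ.∣ ℚ.numerator q ∣ ℕ.* suc n) (ℚ.<⇒≤ (0<step n))
... | inj₂ s²≤p = square-cancel-≤
  (ℚ.+-mono-≤-< 0≤t (ℚ.+-mono-< (0<step n) 0<δ))
  (ℚ.≤-trans s²≤p (ℚ.≤-trans h
    (ℚ.≤-trans (ℚ.+-monoˡ-≤ (δ ℚ.* δ) (sqrtApprox-upper n q)) expand)))
  where
  open +-*-Solver
  t   = sqrtApprox n q
  u   = t ℚ.+ step n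
  0≤t = rootBelow-nonneg q (step n) (ℤ.∣ ℚ.numerator q ∣ ℕ.* suc n) (ℚ.<⇒≤ (0<step n))
  0≤uδ : 0ℚ ℚ.≤ u ℚ.* δ
  0≤uδ = ℚ.<⇒≤ (0<* (ℚ.+-mono-≤-< 0≤t (0<step n)) 0<δ)
  expand : u ℚ.* u ℚ.+ δ ℚ.* δ ℚ.≤
           (t ℚ.+ (step n ℚ.+ δ)) ℚ.* (t ℚ.+ (step n ℚ.+ δ))
  expand = subst₂ ℚ._≤_ (ℚ.+-identityʳ _)
    (solve 3 (λ t s δ → ((t :+ s) :* (t :+ s) :+ δ :* δ) :+ ((t :+ s) :* δ :+ (t :+ s) :* δ)
                        := (t :+ (s :+ δ)) :* (t :+ (s :+ δ))) refl t (step n) δ)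
    (ℚ.+-monoʳ-≤ (u ℚ.* u ℚ.+ δ ℚ.* δ) (ℚ.+-mono-≤ 0≤uδ 0≤uδ))

-- The square root, extended by 0 to negative arguments.
√_ : ℝ → ℝ
√ x = mkℝ (λ n → sqrtApprox n (seq x n)) λ e 0<e →
  let δ       = e ℚ.* ½
      0<δ     = 0<½* 0<e
      (M , h) = cauchy x (δ ℚ.* δ) (0<* 0<δ 0<δ)
      (N , s) = step-small δ 0<δ
      bound : ∀ m n → M ℕ.⊔ N ℕ.≤ m → M ℕ.⊔ N ℕ.≤ n →
              sqrtApprox m (seq x m) ℚ.≤ sqrtApprox n (seq x n) ℚ.+ e
      bound m n m≥ n≥ = ℚ.≤-trans
        (sqrtApprox-continuous m n (seq x m) (seq x n) δ 0<δ
          (near⇒≤ (h m n (ℕ.m⊔n≤o⇒m≤o M N m≥) (ℕ.m⊔n≤o⇒m≤o M N n≥))))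
        (ℚ.+-monoʳ-≤ (sqrtApprox n (seq x n))
          (ℚ.≤-trans (ℚ.+-monoˡ-≤ δ (s n (ℕ.m⊔n≤o⇒n≤o M N n≥)))
                     (ℚ.≤-reflexive (½-split e))))
  in M ℕ.⊔ N , λ m n m≥ n≥ → ≤⇒near (bound m n m≥ n≥) (bound n m n≥ m≥)

record ℂ : Set where
  constructor _+i_
  field
    re im : ℝ

open ℂ public

_≃ᶜ_ : ℂ → ℂ → Set
z ≃ᶜ w = re z ≃ re w × im z ≃ im w

1ℂ : ℂ
1ℂ = 1ℝ +i 0ℝ

_-ᶜ_ : ℂ → ℂ → ℂ
z -ᶜ w = (re z + - re w) +i (im z + - im w)

_*ᶜ_ : ℂ → ℂ → ℂ
z *ᶜ w = (re z * re w + - (im z * im w)) +i (re z * im w + im z * re w)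

modulus : ℂ → ℝ
modulus z = √ (re z * re z + im z * im z)

ℂ-*-rawMonoid : RawMonoid 0ℓ 0ℓ
ℂ-*-rawMonoid = record { Carrier = ℂ ; _≈_ = _≃ᶜ_ ; _∙_ = _*ᶜ_ ; ε = 1ℂ }

record FiniteAbelianGroup (c ℓ : Level) : Set (lsuc (c ⊔ ℓ)) where
  field
    abelianGroup : AbelianGroup c ℓ

  open AbelianGroup abelianGroup public

  field
    order       : ℕ
    enumeration : Inverse setoid (≡.setoid (Fin order))

  -- Each element occurs exactly once, up to _≈_.
  elements : List Carrier
  elements = map (Inverse.from enumeration) (allFin order)

module _ {c ℓ : Level} (G : FiniteAbelianGroup c ℓ) where
  open FiniteAbelianGroup G

  -- Finite sets are meant classically, so membership is decidable; this is
  -- what allows the elements of a subset to be counted.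
  record Subset (p : Level) : Set (c ⊔ ℓ ⊔ lsuc p) where
    field
      member   : Pred Carrier p
      member?  : Decidable member
      respects : member Respects _≈_

  record Character : Set (c ⊔ ℓ) where
    open MonoidMorphisms rawMonoid ℂ-*-rawMonoid using (IsMonoidHomomorphism)
    field
      ⟦_⟧                  : Carrier → ℂ
      isMonoidHomomorphism : IsMonoidHomomorphism ⟦_⟧
      unit-modulus         : ∀ x → modulus ⟦ x ⟧ ≃ 1ℝ

module _ {c ℓ : Level} {G : FiniteAbelianGroup c ℓ} where
  open FiniteAbelianGroup G
  open Subset
  open Character

  infix 4 _∈_ _≈ᵡ_
  infixl 6 _∩_ _∖_ _-ˢ_

  _∈_ : ∀ {p} → Carrier → Subset G p → Set p
  x ∈ S = member S x

  card : ∀ {p} → Subset G p → ℕ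
  card S = length (filter (member? S) elements)

  _∩_ : ∀ {p q} → Subset G p → Subset G q → Subset G (p ⊔ q)
  S ∩ T = record
    { member   = λ x → x ∈ S × x ∈ T
    ; member?  = λ x → member? S x ×-dec member? T x
    ; respects = λ x≈y (s , t) → respects S x≈y s , respects T x≈y t
    }

  _∖_ : ∀ {p q} → Subset G p → Subset G q → Subset G (p ⊔ q)
  S ∖ T = record
    { member   = λ x → x ∈ S × ¬ (x ∈ T)
    ; member?  = λ x → member? S x ×-dec ¬? (member? T x)
    ; respects = λ x≈y (s , ∉T) →
        respects S x≈y s , λ y∈T → ∉T (respects T (AbelianGroup.sym abelianGroup x≈y) y∈T)
    }

  _-ˢ_ : ∀ {p} → Subset G p → Carrier → Subset G (c ⊔ ℓ ⊔ p)
  A -ˢ g = record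
    { member   = λ x → ∃[ a ] a ∈ A × x ≈ a - g
    ; member?  = λ x → map′
        (λ h → x ∙ g , h , G.sym (//-rightDividesʳ g x))
        (λ (a , a∈A , x≈a-g) → respects A
          (G.sym (G.trans (G.∙-congʳ x≈a-g) (//-rightDividesˡ g a))) a∈A)
        (member? A (x ∙ g))
    ; respects = λ x≈y (a , a∈A , eq) → a , a∈A , G.trans (G.sym x≈y) eq
    }
    where
    module G = AbelianGroup abelianGroup
    open GroupProperties G.group using (//-rightDividesˡ; //-rightDividesʳ)

  HasOrderProperty : ∀ {p} → ℕ → Subset G p → Set (c ⊔ p)
  HasOrderProperty k A =
    Σ[ a ∈ (Fin k → Carrier) ] Σ[ b ∈ (Fin k → Carrier) ]
      (∀ i j → (a i ∙ b j) ∈ A ⇔ i Fin.≤ j)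

  Stable : ∀ {p} → ℕ → Subset G p → Set (c ⊔ p)
  Stable k A = ¬ HasOrderProperty k A

  _≈ᵡ_ : Character G → Character G → Set c
  γ ≈ᵡ χ = ∀ x → ⟦ γ ⟧ x ≃ᶜ ⟦ χ ⟧ x

  InBohr : List (Character G) → ℝ → Carrier → Set (c ⊔ ℓ)
  InBohr K ρ x = All (λ γ → modulus (⟦ γ ⟧ x -ᶜ 1ℂ) ≤ ρ) K

-- A Bohr set together with a presentation (K , ρ).  Since ≤ on ℝ is not
-- decidable, the underlying subset is carried separately and is required to
-- have exactly the members that the presentation prescribes.
record BohrSet {c ℓ : Level} (G : FiniteAbelianGroup c ℓ) : Set (lsuc 0ℓ ⊔ c ⊔ ℓ) where
  field
    frequencies : List (Character G)
    distinct    : AllPairs (λ γ χ → ¬ (γ ≈ᵡ χ)) frequencies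
    width       : ℝ
    0≤width     : 0ℝ ≤ width
    width≤1     : width ≤ 1ℝ
    subset      : Subset G 0ℓ
    ∈-subset    : ∀ x → x ∈ subset ⇔ InBohr frequencies width x

  rank : ℕ
  rank = length frequencies

{-# OPTIONS --safe #-}
module Submission where

-- Let Q = 4m with 1/m ≤ ε.  As A is stable, the relation x + b ∈ A admits no full binary tree of
-- large height (Hodges), so splitting G repeatedly, with thresholds that shrink much faster than the
-- density, ends with a set X of density at least 1/c on which every translate of A has relative
-- density at most 1/(Qc) or at least 1 - 1/(Qc), where c is polynomial in m.  Let T be the set of b
-- of the second kind and let H be the stabiliser of T.
--
-- If h ∉ H, then X and its translate by h are almost disjoint.  Counting pairs of elements of X by
-- their difference therefore shows that some coset of H contains at least half of X.  Hence H has
-- index at most 2c, and averaging the uniformity of X over this coset shows that every translate of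
-- A contains almost all or almost none of H.
--
-- Finally H is a Bohr set of width 1: if x ∉ H and x has order r modulo H, then some character
-- trivial on H maps x to e^(2πi⌊r/2⌋/r), at distance greater than 1 from 1, and one character for
-- each nontrivial coset of H suffices.  If ε ≥ 1/2, then A or its complement has density at most 1/2
-- and H = G works.

open import Algebra.Bundles using (AbelianGroup)
import Algebra.Properties.AbelianGroup as AbelianGroupProperties
import Algebra.Properties.CommutativeMonoid.Mult as MonoidMult
import Algebra.Properties.CommutativeMonoid.Sum as MonoidSum
import Algebra.Properties.CommutativeSemigroup as CommutativeSemigroupProperties
import Algebra.Properties.Group as GroupProperties
import Algebra.Properties.Semiring.Sum as SemiringSum
open import Algebra.Structures using (IsAbelianGroup)
open import Data.Bool.Base using (Bool; true; false; _∧_; not)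
import Data.Bool.Properties as Bool
open import Data.Empty using (⊥)
open import Data.Fin as Fin using (Fin; zero; suc)
open import Data.Fin.Permutation using (permutation)
import Data.Fin.Properties as Fin
import Data.Integer.Base as ℤ
open import Data.List.Base
  using (List; []; _∷_; _++_; length; lookup; map; filter; tabulate; allFin; deduplicate)
open import Data.List.Membership.Propositional.Properties using (∈-lookup; ∈-allFin)
import Data.List.Membership.Setoid.Properties as SetoidMembership
open import Data.List.Properties using (length-++; length-map; length-deduplicate; map-tabulate)
open import Data.List.Relation.Unary.All as All using (All; []; _∷_)
import Data.List.Relation.Unary.All.Properties as All
open import Data.List.Relation.Unary.AllPairs as AllPairs using (AllPairs; []; _∷_)
import Data.List.Relation.Unary.AllPairs.Properties as AllPairs
open import Data.List.Relation.Unary.Any as Any using (Any; here; there)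
import Data.List.Relation.Unary.Any.Properties as Any
import Data.List.Relation.Unary.Unique.DecSetoid.Properties as Unique
open import Data.Nat as ℕ using (ℕ; zero; suc; z≤n; s≤s)
open import Data.Nat.Divisibility as ∣ using (_∣_; divides)
import Data.Nat.DivMod as ℕ
import Data.Nat.Properties as ℕ
open import Data.Product using (Σ-syntax; ∃-syntax; _×_; _,_; proj₁; proj₂)
open import Data.Rational as ℚ using (ℚ; 0ℚ; 1ℚ; ½)
import Data.Rational.Properties as ℚ
open import Data.Rational.Solver using (module +-*-Solver)
open import Data.Sum as Sum using (_⊎_; inj₁; inj₂)
open import Data.Unit.Base using (⊤; tt)
import Defs as D
open import Function.Base using (id; _∘_)
open import Function.Bundles using (Inverse; mk⇔)
open import Level using (0ℓ; _⊔_) renaming (suc to lsuc)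
open import Relation.Binary.Bundles using (DecSetoid)
open import Relation.Binary.Definitions using (Tri; tri<; tri≈; tri>)
open import Relation.Binary.PropositionalEquality
  using (_≡_; refl; sym; trans; cong; cong₂; subst; subst₂; isEquivalence; module ≡-Reasoning)
open import Relation.Nullary using (¬_; Dec; does; yes; no; contradiction)
open import Relation.Nullary.Decidable
  using (_⊎-dec_; dec-true; does-⇔; decidable-stable; toWitness; toWitnessFalse)
open import Relation.Unary using (Pred; Decidable)

-- The thresholds must beat the density because the near disjointness of `X` and its translates is
-- summed over all n differences. If each h outside `H` contributes at most 2s/M common points,
-- where s = |X|, the total 2ns/M is guaranteed to be at most half of the s² pairs once M is at
-- least 4n/s. The density still stays polynomial in m: each split only replaces its exponent e by
-- 2e + 1, and the number of splits is bounded by the tree height.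
--
-- The bounds ε^C and ε^(-C) leave no room for constant factors. For ε close to 1 the rank must be
-- at most 1, which forces the separate treatment of large ε. As reals are Cauchy sequences, ε
-- cannot be compared with 1/2 directly, so a rational approximation decides the case.
--
-- Complex characters need roots of unity, which have to be constructed. Characters are therefore
-- first homomorphisms into ℤ/N with N a multiple of n, extended one element at a time; e^(2πi/N) is
-- then a limit of rational points of the circle.

module FiniteGroups where
  open import Data.Nat using (_+_; _*_; _^_; _∸_; _≤_; _<_; _%_; _/_)
  open import Data.Nat.Tactic.RingSolver using (solve-∀)

  open MonoidSum ℕ.+-0-commutativeMonoid public
    using (sum; sum-cong-≗; ∑-distrib-+; ∑-comm; sum-permute)
  open SemiringSum ℕ.+-*-semiring public using (*-distribˡ-sum; *-distribʳ-sum)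

  -- Binary trees and the order property.

  ladderHeight : ℕ → ℕ
  ladderHeight zero    = 0
  ladderHeight (suc k) = suc (suc (ladderHeight k) ℕ.+ ladderHeight k)

  module Ladders {X Y : Set} (R : X → Y → Bool) where

    -- The branch taken at a node is recorded by strengthening `P`, so a leaf carries every
    -- condition on its path and remains valid when inner nodes are discarded.
    data Tree (P : X → Set) (Q : Y → Set) : ℕ → Set where
      leaf : ∀ a → P a → Tree P Q 0
      node : ∀ {h} b → Q b →
             Tree (λ a → P a × R a b ≡ true) Q h →
             Tree (λ a → P a × R a b ≡ false) Q h → Tree P Q (suc h)

    weaken : ∀ {P P′ Q Q′ h} → (∀ a → P a → P′ a) → (∀ b → Q b → Q′ b) →
             Tree P Q h → Tree P′ Q′ h
    weaken f g (leaf a p)     = leaf a (f a p)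
    weaken f g (node b q l r) = node b (g b q)
      (weaken (λ a (p , e) → f a p , e) g l) (weaken (λ a (p , e) → f a p , e) g r)

    someLeaf : ∀ {P Q h} → Tree P Q h → ∃[ a ] P a
    someLeaf (leaf a p)     = a , p
    someLeaf (node b q l r) with someLeaf l
    ... | a , p , _ = a , p

    -- If the root has the first colour, then either both subtrees yield a tree of that colour and
    -- height m - 1, which the root joins, or one of them already yields a full tree of the other
    -- colour.
    ramsey : ∀ {P Q h} (C : Y → Bool) m n → h ≡ m ℕ.+ n → Tree P Q h →
             Tree P (λ b → Q b × C b ≡ true) m ⊎ Tree P (λ b → Q b × C b ≡ false) n
    ramsey C zero    n       eq t = let (a , p) = someLeaf t in inj₁ (leaf a p)
    ramsey C (suc m) zero    eq t = let (a , p) = someLeaf t in inj₂ (leaf a p)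
    ramsey C (suc m) (suc n) eq (node b q l r) with C b in Cb
    ... | true  with ramsey C m (suc n) (ℕ.suc-injective eq) l
                   | ramsey C m (suc n) (ℕ.suc-injective eq) r
    ...   | inj₁ l′ | inj₁ r′ = inj₁ (node b (q , Cb) l′ r′)
    ...   | inj₂ l′ | _       = inj₂ (weaken (λ _ → proj₁) (λ _ → id) l′)
    ...   | inj₁ _  | inj₂ r′ = inj₂ (weaken (λ _ → proj₁) (λ _ → id) r′)
    ramsey C (suc m) (suc n) eq (node b q l r) | false
               with ramsey C (suc m) n (trans (ℕ.suc-injective eq) (ℕ.+-suc m n)) l
                  | ramsey C (suc m) n (trans (ℕ.suc-injective eq) (ℕ.+-suc m n)) r
    ...   | inj₂ l′ | inj₂ r′ = inj₂ (node b (q , Cb) l′ r′)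
    ...   | inj₁ l′ | _       = inj₁ (weaken (λ _ → proj₁) (λ _ → id) l′)
    ...   | inj₂ _  | inj₁ r′ = inj₁ (weaken (λ _ → proj₁) (λ _ → id) r′)

    record Ladder (P : X → Set) (Q : Y → Set) (k : ℕ) : Set where
      field
        rungs   : List (X × Y)
        size    : length rungs ≡ k
        good    : All (λ (a , b) → P a × Q b × R a b ≡ true) rungs
        ordered : AllPairs (λ (a , b) (a′ , b′) → R a b′ ≡ true × R a′ b ≡ false) rungs

    -- A leaf a below b on the true side colours the remaining nodes by `R a`. If they are all true,
    -- a goes first, paired with the root b₁ of the new tree, and the rest lies on the false side of
    -- b₁; this costs the extra level in `ladderHeight`. If they are all false, (a , b) goes last,
    -- since every remaining leaf is related to b.
    ladder : ∀ {P Q} k → Tree P Q (ladderHeight k) → Ladder P Q k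
    ladder zero    t = record { rungs = [] ; size = refl ; good = [] ; ordered = [] }
    ladder (suc k) (node b q t _) with someLeaf t
    ... | a , p , Rab with ramsey (R a) (suc (ladderHeight k)) (ladderHeight k) refl t
    ...   | inj₁ (node b₁ (q₁ , Rab₁) _ t₁) = record
      { rungs   = (a , b₁) ∷ rungs
      ; size    = cong suc size
      ; good    = (p , q₁ , Rab₁) ∷ All.map (λ (((p , _) , _) , (q , _) , r) → p , q , r) good
      ; ordered = All.map (λ ((_ , f) , (_ , e) , _) → e , f) good ∷ ordered
      }
      where open Ladder (ladder k t₁)
    ...   | inj₂ t₁ = record
      { rungs   = rungs ++ (a , b) ∷ []
      ; size    = trans (length-++ rungs) (trans (ℕ.+-comm _ 1) (cong suc size))
      ; good    = All.++⁺ (All.map (λ ((p , _) , (q , _) , r) → p , q , r) good)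
                          ((p , q , Rab) ∷ [])
      ; ordered = AllPairs.++⁺ ordered ([] ∷ [])
                    (All.map (λ ((_ , e) , (_ , f) , _) → (e , f) ∷ []) good)
      }
      where open Ladder (ladder k t₁)

    lookup-ordered : ∀ {xs : List (X × Y)} →
      All (λ (a , b) → R a b ≡ true) xs →
      AllPairs (λ (a , b) (a′ , b′) → R a b′ ≡ true × R a′ b ≡ false) xs →
      ∀ i j →
        (i Fin.≤ j → R (proj₁ (lookup xs i)) (proj₂ (lookup xs j)) ≡ true) ×
        (¬ (i Fin.≤ j) → R (proj₁ (lookup xs i)) (proj₂ (lookup xs j)) ≡ false)
    lookup-ordered (r ∷ _) _ Fin.zero Fin.zero = (λ _ → r) , λ ≰ → contradiction ℕ.z≤n ≰
    lookup-ordered {_ ∷ xs} _ (x<xs ∷ _) Fin.zero (Fin.suc j) =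
      (λ _ → proj₁ (All.lookup x<xs (∈-lookup j))) , λ ≰ → contradiction ℕ.z≤n ≰
    lookup-ordered _ (x<xs ∷ _) (Fin.suc i) Fin.zero =
      (λ ()) , λ _ → proj₂ (All.lookup x<xs (∈-lookup i))
    lookup-ordered (_ ∷ rs) (_ ∷ o) (Fin.suc i) (Fin.suc j) =
      let (y , n) = lookup-ordered rs o i j
      in (λ le → y (ℕ.s≤s⁻¹ le)) , (λ ≰ → n (≰ ∘ ℕ.s≤s))

    orderProperty : ∀ {P Q k} → Tree P Q (ladderHeight k) →
      Σ[ a ∈ (Fin k → X) ] Σ[ b ∈ (Fin k → Y) ] ∀ i j →
        (i Fin.≤ j → R (a i) (b j) ≡ true) × (¬ (i Fin.≤ j) → R (a i) (b j) ≡ false)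
    orderProperty {k = k} t with ladder k t
    ... | record { rungs = xs ; size = refl ; good = g ; ordered = o } =
      proj₁ ∘ lookup xs , proj₂ ∘ lookup xs ,
      lookup-ordered (All.map (λ (_ , _ , r) → r) g) o

  -- Counting and sets of uniform density.

  ⟦_⟧ : Bool → ℕ
  ⟦ true  ⟧ = 1
  ⟦ false ⟧ = 0

  count : ∀ {n} → (Fin n → Bool) → ℕ
  count X = sum (⟦_⟧ ∘ X)

  sum-mono : ∀ {n} {f g : Fin n → ℕ} → (∀ i → f i ≤ g i) → sum f ≤ sum g
  sum-mono {zero}  h = z≤n
  sum-mono {suc n} h = ℕ.+-mono-≤ (h zero) (sum-mono (h ∘ suc))

  sum-const : ∀ n c → sum {n} (λ _ → c) ≡ n * c
  sum-const zero    c = refl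
  sum-const (suc n) c = cong (c +_) (sum-const n c)

  count>0⇒∃ : ∀ {n} (X : Fin n → Bool) → 0 < count X → ∃[ x ] X x ≡ true
  count>0⇒∃ {suc n} X 0<c with X zero in eq
  ... | true  = zero , eq
  ... | false = let (x , e) = count>0⇒∃ (X ∘ suc) 0<c in suc x , e

  -- A set of density Q^(-e) that fails uniformity at Q^(e+1) splits into parts of relative density
  -- above Q^(-(e+1)), so the exponents add up to e + (e + 1) at each level.
  exponent : ℕ → ℕ → ℕ
  exponent zero    e = e
  exponent (suc d) e = exponent d (e + suc e)

  e≤exponent : ∀ d e → e ≤ exponent d e
  e≤exponent zero    e = ℕ.≤-refl
  e≤exponent (suc d) e = ℕ.≤-trans (ℕ.m≤m+n e (suc e)) (e≤exponent d (e + suc e))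

  module Density {m n : ℕ} (R : Fin m → Fin n → Bool) where
    open Ladders R

    hit miss : (Fin m → Bool) → Fin n → ℕ
    hit  X b = count (λ x → X x ∧ R x b)
    miss X b = count (λ x → X x ∧ not (R x b))

    Uniform : ℕ → (Fin m → Bool) → Set
    Uniform M X = ∀ b → M * hit X b ≤ count X ⊎ M * miss X b ≤ count X

    -- The uniformity threshold exceeds the reciprocal density Q^e by a full factor Q; this surplus
    -- pays for summing over the whole group.
    record UniformSet (Q N E : ℕ) : Set where
      field
        X       : Fin m → Bool
        e       : ℕ
        e≤E     : e ≤ E
        dense   : N ≤ Q ^ e * count X
        uniform : Uniform (Q ^ suc e) X

    -- A point b that violates uniformity leaves both parts of `X` dense enough for the induction.
    -- Either one of them contains a uniform set, or both carry trees, and b joins these at a new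
    -- root.
    uniformSet : ∀ Q N → 0 < N → ∀ d e X {P} → (∀ x → X x ≡ true → P x) →
      N ≤ Q ^ e * count X →
      UniformSet Q N (exponent d e) ⊎ Tree P (λ _ → ⊤) d
    uniformSet Q N 0<N zero e X X⇒P dense =
      let (x , Xx) = count>0⇒∃ X (ℕ.n≢0⇒n>0 λ z → ℕ.<-irrefl refl (ℕ.<-≤-trans 0<N
                       (subst (N ≤_) (trans (cong (Q ^ e *_) z) (ℕ.*-zeroʳ (Q ^ e))) dense)))
      in inj₂ (leaf x (X⇒P x Xx))
    uniformSet Q N 0<N (suc d) e X {P} X⇒P dense
      with Fin.all? (λ b → (Q ^ suc e * hit X b ℕ.≤? count X) ⊎-dec (Q ^ suc e * miss X b ℕ.≤? count X))
    ... | yes u = inj₁ (record { X = X ; e = e ; e≤E = e≤exponent (suc d) e ; dense = dense ; uniform = u })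
    ... | no ¬u with Fin.¬∀⟶∃¬ _ _ (λ b → (Q ^ suc e * hit X b ℕ.≤? count X) ⊎-dec (Q ^ suc e * miss X b ℕ.≤? count X)) ¬u
    ...   | b , ¬ub = go
      where
      enough : ∀ h → ¬ (Q ^ suc e * h ≤ count X) → N ≤ Q ^ (e + suc e) * h
      enough h ≰ = ℕ.≤-trans dense (ℕ.≤-trans
        (ℕ.*-monoʳ-≤ (Q ^ e) (ℕ.<⇒≤ (ℕ.≰⇒> ≰)))
        (ℕ.≤-reflexive (trans (sym (ℕ.*-assoc (Q ^ e) (Q ^ suc e) h))
          (cong (_* h) (sym (ℕ.^-distribˡ-+-* Q e (suc e)))))))

      ∧-true : ∀ a c → a ∧ c ≡ true → a ≡ true × c ≡ true
      ∧-true true true refl = refl , refl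

      not-true : ∀ a → not a ≡ true → a ≡ false
      not-true false refl = refl

      go : UniformSet Q N (exponent (suc d) e) ⊎ Tree P (λ _ → ⊤) (suc d)
      go with uniformSet Q N 0<N d (e + suc e) (λ x → X x ∧ R x b)
                {λ x → P x × R x b ≡ true}
                (λ x t → let (p , r) = ∧-true (X x) _ t in X⇒P x p , r)
                (enough _ (¬ub ∘ inj₁))
            | uniformSet Q N 0<N d (e + suc e) (λ x → X x ∧ not (R x b))
                {λ x → P x × R x b ≡ false}
                (λ x t → let (p , r) = ∧-true (X x) _ t in X⇒P x p , not-true (R x b) r)
                (enough _ (¬ub ∘ inj₂))
      ... | inj₁ u | _      = inj₁ u
      ... | inj₂ _ | inj₁ u = inj₁ u
      ... | inj₂ l | inj₂ r = inj₂ (node b tt l r)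

  ⟦⟧-∧ : ∀ a b → ⟦ a ∧ b ⟧ ≡ ⟦ a ⟧ * ⟦ b ⟧
  ⟦⟧-∧ true  b = sym (ℕ.+-identityʳ ⟦ b ⟧)
  ⟦⟧-∧ false b = refl

  ⟦⟧-guard : ∀ b {x y} → (b ≡ true → x ≤ y) → ⟦ b ⟧ * x ≤ ⟦ b ⟧ * y
  ⟦⟧-guard true  h = ℕ.+-monoˡ-≤ 0 (h refl)
  ⟦⟧-guard false h = z≤n

  ⟦⟧≤1 : ∀ b → ⟦ b ⟧ ≤ 1
  ⟦⟧≤1 true  = s≤s z≤n
  ⟦⟧≤1 false = z≤n

  fromDoes : ∀ {p} {P : Set p} (P? : Dec P) → does P? ≡ true → P
  fromDoes (yes p) refl = p

  fromDoes¬ : ∀ {p} {P : Set p} (P? : Dec P) → does P? ≡ false → ¬ P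
  fromDoes¬ (no ¬p) refl = ¬p

  count-not : ∀ {n} (f : Fin n → Bool) → count f + count (not ∘ f) ≡ n
  count-not {n} f = trans (sym (∑-distrib-+ (⟦_⟧ ∘ f) (⟦_⟧ ∘ not ∘ f)))
    (trans (sum-cong-≗ λ i → split (f i)) (trans (sum-const n 1) (ℕ.*-identityʳ n)))
    where
    split : ∀ b → ⟦ b ⟧ + ⟦ not b ⟧ ≡ 1
    split true  = refl
    split false = refl

  smallerHalf : ∀ a b {n} → a + b ≡ n → 2 * a ≤ n ⊎ 2 * b ≤ n
  smallerHalf a b refl with ℕ.≤-total a b
  ... | inj₁ a≤b = inj₁ (ℕ.+-monoʳ-≤ a (ℕ.≤-trans (ℕ.≤-reflexive (ℕ.+-identityʳ a)) a≤b))
  ... | inj₂ b≤a = inj₂ (ℕ.+-mono-≤ b≤a (ℕ.≤-reflexive (ℕ.+-identityʳ b)))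

  -- The constants 2 and 4 are traded for powers of m, since the final rank bound is a pure power.
  index≤power : ∀ m e → 2 ≤ m → 2 * (4 * m) ^ e ≤ m ^ suc (3 * e)
  index≤power m e 2≤m = ℕ.*-mono-≤ 2≤m
    (ℕ.≤-trans (ℕ.^-monoˡ-≤ e 4m≤m³) (ℕ.≤-reflexive (ℕ.^-*-assoc m 3 e)))
    where
    4m≤m³ : 4 * m ≤ m ^ 3
    4m≤m³ = ℕ.≤-trans (ℕ.*-monoˡ-≤ m (ℕ.*-mono-≤ 2≤m 2≤m)) (ℕ.≤-reflexive (ring m))
      where
      ring : ∀ m → m * m * m ≡ m * (m * (m * 1))
      ring = solve-∀

  -- The stabiliser and its heavy coset.

  module FinGroup {n : ℕ} {_∙_ : Fin n → Fin n → Fin n} {ε : Fin n} {_⁻¹ : Fin n → Fin n}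
    (isAbelianGroup : IsAbelianGroup _≡_ _∙_ ε _⁻¹) where

    abelianGroup : AbelianGroup _ _
    abelianGroup = record { isAbelianGroup = isAbelianGroup }

    open AbelianGroup abelianGroup public
      using (comm; assoc; identityˡ; identityʳ; inverseʳ)
    open AbelianGroupProperties abelianGroup public
      using (//-rightDividesˡ; //-rightDividesʳ)
    open CommutativeSemigroupProperties (AbelianGroup.commutativeSemigroup abelianGroup) public
      using (interchange)

    sum-translateʳ : ∀ (f : Fin n → ℕ) a → sum (λ x → f (x ∙ a)) ≡ sum f
    sum-translateʳ f a = sym (sum-permute f (permutation (_∙ a) (_∙ (a ⁻¹))
      (//-rightDividesˡ a) (//-rightDividesʳ a)))

    sum-translateˡ : ∀ (f : Fin n → ℕ) a → sum (λ x → f (a ∙ x)) ≡ sum f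
    sum-translateˡ f a = trans (sum-cong-≗ λ x → cong f (comm a x)) (sum-translateʳ f a)

    record IsSubgroup (H : Fin n → Bool) : Set where
      field
        ε∈   : H ε ≡ true
        ∙∈   : ∀ {g h} → H g ≡ true → H h ≡ true → H (g ∙ h) ≡ true
        ⁻¹∈  : ∀ {g} → H g ≡ true → H (g ⁻¹) ≡ true

      ∙-cancelʳ∈ : ∀ {g h} → H h ≡ true → H (g ∙ h) ≡ true → H g ≡ true
      ∙-cancelʳ∈ {g} {h} Hh Hgh =
        subst (λ x → H x ≡ true) (//-rightDividesʳ h g) (∙∈ Hgh (⁻¹∈ Hh))

      translate : ∀ g h → H h ≡ true → H (g ∙ h) ≡ H g
      translate g h Hh with H (g ∙ h) in Hgh | H g in Hg
      ... | true  | true  = refl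
      ... | false | false = refl
      ... | true  | false = trans (sym (∙-cancelʳ∈ Hh Hgh)) Hg
      ... | false | true  = trans (sym Hgh) (∙∈ Hg Hh)

    module Stabiliser (A X : Fin n → Bool) (M : ℕ)
      (uniform : Density.Uniform (λ x b → A (x ∙ b)) M X) where

      open Density (λ x b → A (x ∙ b))

      T : Fin n → Bool
      T b = does (M * miss X b ℕ.≤? count X)

      T-true : ∀ b → T b ≡ true → M * miss X b ≤ count X
      T-true b = fromDoes (M * miss X b ℕ.≤? count X)

      T-false : ∀ b → T b ≡ false → M * hit X b ≤ count X
      T-false b Tb = Sum.fromInj₁
        (λ h → contradiction h (fromDoes¬ (M * miss X b ℕ.≤? count X) Tb)) (uniform b)

      fixes? : ∀ h → Dec (∀ b → T (b ∙ h) ≡ T b)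
      fixes? h = Fin.all? (λ b → T (b ∙ h) Bool.≟ T b)

      H : Fin n → Bool
      H h = does (fixes? h)

      H⇒ : ∀ {h} → H h ≡ true → ∀ b → T (b ∙ h) ≡ T b
      H⇒ {h} = fromDoes (fixes? h)

      isSubgroup : IsSubgroup H
      isSubgroup = record
        { ε∈  = dec-true (fixes? _) λ b → cong T (identityʳ b)
        ; ∙∈  = λ {g} {h} Hg Hh → dec-true (fixes? _) λ b →
            trans (cong T (sym (assoc b g h))) (trans (H⇒ Hh (b ∙ g)) (H⇒ Hg b))
        ; ⁻¹∈ = λ {g} Hg → dec-true (fixes? _) λ b →
            trans (sym (H⇒ Hg (b ∙ (g ⁻¹)))) (cong T (//-rightDividesˡ g b))
        }
      open IsSubgroup isSubgroup

      common : Fin n → ℕ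
      common h = sum (λ y → ⟦ X y ⟧ * ⟦ X (y ∙ h) ⟧)

      cover : ∀ p q r → ⟦ p ⟧ * ⟦ q ⟧ ≤ ⟦ p ∧ not r ⟧ + ⟦ q ∧ r ⟧
      cover true  true  true  = s≤s z≤n
      cover true  true  false = s≤s z≤n
      cover true  false r     = z≤n
      cover false q     r     = z≤n

      cover′ : ∀ p q r → ⟦ p ⟧ * ⟦ q ⟧ ≤ ⟦ p ∧ r ⟧ + ⟦ q ∧ not r ⟧
      cover′ true  true  true  = s≤s z≤n
      cover′ true  true  false = s≤s z≤n
      cover′ true  false r     = z≤n
      cover′ false q     r     = z≤n

      swap : ∀ y h b → y ∙ (b ∙ h) ≡ (y ∙ h) ∙ b
      swap y h b = trans (cong (y ∙_) (comm b h)) (sym (assoc y h b))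

      -- One point is read in two ways: y ∙ (b ∙ h) = (y ∙ h) ∙ b is, if outside `A`, a miss of y at
      -- b ∙ h and, if inside `A`, a hit of y ∙ h at b.
      common≤₁ : ∀ h b → common h ≤ miss X (b ∙ h) + hit X b
      common≤₁ h b = ℕ.≤-trans
        (sum-mono λ y → ℕ.≤-trans (cover (X y) (X (y ∙ h)) (A (y ∙ (b ∙ h))))
          (ℕ.≤-reflexive (cong (λ z → ⟦ X y ∧ not (A (y ∙ (b ∙ h))) ⟧ + ⟦ X (y ∙ h) ∧ A z ⟧) (swap y h b))))
        (ℕ.≤-reflexive (trans
          (∑-distrib-+ (λ y → ⟦ X y ∧ not (A (y ∙ (b ∙ h))) ⟧) (λ y → ⟦ X (y ∙ h) ∧ A ((y ∙ h) ∙ b) ⟧))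
          (cong (miss X (b ∙ h) +_) (sum-translateʳ (λ x → ⟦ X x ∧ A (x ∙ b) ⟧) h))))

      common≤₂ : ∀ h b → common h ≤ hit X (b ∙ h) + miss X b
      common≤₂ h b = ℕ.≤-trans
        (sum-mono λ y → ℕ.≤-trans (cover′ (X y) (X (y ∙ h)) (A (y ∙ (b ∙ h))))
          (ℕ.≤-reflexive (cong (λ z → ⟦ X y ∧ A (y ∙ (b ∙ h)) ⟧ + ⟦ X (y ∙ h) ∧ not (A z) ⟧) (swap y h b))))
        (ℕ.≤-reflexive (trans
          (∑-distrib-+ (λ y → ⟦ X y ∧ A (y ∙ (b ∙ h)) ⟧) (λ y → ⟦ X (y ∙ h) ∧ not (A ((y ∙ h) ∙ b)) ⟧))
          (cong (hit X (b ∙ h) +_) (sum-translateʳ (λ x → ⟦ X x ∧ not (A (x ∙ b)) ⟧) h))))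

      private
        s = count X

      -- If h moves T, then A sees most of X and little of its translate by h at some b, or vice versa.
      common-small : ∀ h → H h ≡ false → M * common h ≤ s + s
      common-small h Hh with Fin.¬∀⟶∃¬ _ _ (λ b → T (b ∙ h) Bool.≟ T b) (fromDoes¬ (fixes? h) Hh)
      ... | b , neq with T (b ∙ h) in e₁ | T b in e₂
      ...   | true  | true  = contradiction refl neq
      ...   | false | false = contradiction refl neq
      ...   | true  | false = ℕ.≤-trans (ℕ.*-monoʳ-≤ M (common≤₁ h b))
        (ℕ.≤-trans (ℕ.≤-reflexive (ℕ.*-distribˡ-+ M (miss X (b ∙ h)) (hit X b)))
          (ℕ.+-mono-≤ (T-true (b ∙ h) e₁) (T-false b e₂)))
      ...   | false | true  = ℕ.≤-trans (ℕ.*-monoʳ-≤ M (common≤₂ h b))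
        (ℕ.≤-trans (ℕ.≤-reflexive (ℕ.*-distribˡ-+ M (hit X (b ∙ h)) (miss X b)))
          (ℕ.+-mono-≤ (T-false (b ∙ h) e₁) (T-true b e₂)))

      sum-common : sum common ≡ s * s
      sum-common = begin
        sum common
          ≡⟨ ∑-comm (λ h y → ⟦ X y ⟧ * ⟦ X (y ∙ h) ⟧) ⟩
        sum (λ y → sum (λ h → ⟦ X y ⟧ * ⟦ X (y ∙ h) ⟧))
          ≡⟨ sum-cong-≗ (λ y → trans (sym (*-distribˡ-sum ⟦ X y ⟧ (λ h → ⟦ X (y ∙ h) ⟧)))
               (cong (⟦ X y ⟧ *_) (sum-translateˡ (⟦_⟧ ∘ X) y))) ⟩
        sum (λ y → ⟦ X y ⟧ * s)
          ≡⟨ sym (*-distribʳ-sum s (⟦_⟧ ∘ X)) ⟩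
        s * s ∎
        where open ≡-Reasoning

      -- This is the size of the intersection of `X` with the coset y ∙ H.
      inCoset : Fin n → ℕ
      inCoset y = sum (λ h → ⟦ H h ⟧ * ⟦ X (y ∙ h) ⟧)

      inCoset≤ : ∀ y → inCoset y ≤ count H
      inCoset≤ y = sum-mono λ h → ℕ.≤-trans (ℕ.*-monoʳ-≤ ⟦ H h ⟧ (⟦⟧≤1 (X (y ∙ h))))
        (ℕ.≤-reflexive (ℕ.*-identityʳ ⟦ H h ⟧))

      split : ∀ b x → x ≡ ⟦ b ⟧ * x + ⟦ not b ⟧ * x
      split true  x = sym (trans (ℕ.+-identityʳ _) (ℕ.+-identityʳ x))
      split false x = sym (ℕ.+-identityʳ x)

      inside outside : ℕ
      inside  = sum (λ h → ⟦ H h ⟧ * common h)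
      outside = sum (λ h → ⟦ not (H h) ⟧ * common h)

      inside+outside : s * s ≡ inside + outside
      inside+outside = trans (sym sum-common)
        (trans (sum-cong-≗ λ h → split (H h) (common h))
               (∑-distrib-+ (λ h → ⟦ H h ⟧ * common h) (λ h → ⟦ not (H h) ⟧ * common h)))

      inside≡ : inside ≡ sum (λ y → ⟦ X y ⟧ * inCoset y)
      inside≡ = begin
        inside
          ≡⟨ sum-cong-≗ (λ h → *-distribˡ-sum ⟦ H h ⟧ (λ y → ⟦ X y ⟧ * ⟦ X (y ∙ h) ⟧)) ⟩
        sum (λ h → sum (λ y → ⟦ H h ⟧ * (⟦ X y ⟧ * ⟦ X (y ∙ h) ⟧)))
          ≡⟨ ∑-comm (λ h y → ⟦ H h ⟧ * (⟦ X y ⟧ * ⟦ X (y ∙ h) ⟧)) ⟩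
        sum (λ y → sum (λ h → ⟦ H h ⟧ * (⟦ X y ⟧ * ⟦ X (y ∙ h) ⟧)))
          ≡⟨ sum-cong-≗ (λ y → trans
               (sum-cong-≗ λ h → exch ⟦ H h ⟧ ⟦ X y ⟧ ⟦ X (y ∙ h) ⟧)
               (sym (*-distribˡ-sum ⟦ X y ⟧ (λ h → ⟦ H h ⟧ * ⟦ X (y ∙ h) ⟧)))) ⟩
        sum (λ y → ⟦ X y ⟧ * inCoset y) ∎
        where
        open ≡-Reasoning
        exch : ∀ a b c → a * (b * c) ≡ b * (a * c)
        exch = solve-∀

      outside-small : M * outside ≤ n * (s + s)
      outside-small = begin
        M * outside
          ≡⟨ *-distribˡ-sum M (λ h → ⟦ not (H h) ⟧ * common h) ⟩
        sum (λ h → M * (⟦ not (H h) ⟧ * common h))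
          ≤⟨ sum-mono bound ⟩
        sum {n} (λ _ → s + s)
          ≡⟨ sum-const n (s + s) ⟩
        n * (s + s) ∎
        where
        open ℕ.≤-Reasoning
        bound : ∀ h → M * (⟦ not (H h) ⟧ * common h) ≤ s + s
        bound h with H h in Hh
        ... | true  = ℕ.≤-trans (ℕ.≤-reflexive (ℕ.*-zeroʳ M)) z≤n
        ... | false = subst (λ x → M * x ≤ s + s) (sym (ℕ.+-identityʳ (common h))) (common-small h Hh)

      module Large (c : ℕ) (0<s : 0 < s) (0<c : 0 < c) (dense : n ≤ c * s) (4c≤M : 4 * c ≤ M) where

        -- Here the factor 4 of Q = 4m is spent: M ≥ 4c and n ≤ cs turn the bound 2ns/M for the
        -- pairs with difference outside `H` into s²/2.
        2outside≤ : 2 * outside ≤ s * s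
        2outside≤ = ℕ.*-cancelˡ-≤ (2 * c) ⦃ ℕ.>-nonZero (ℕ.<-≤-trans 0<c (ℕ.m≤m+n c (c + 0))) ⦄ (begin
          2 * c * (2 * outside) ≡⟨ e₁ c outside ⟩
          4 * c * outside       ≤⟨ ℕ.*-monoˡ-≤ outside 4c≤M ⟩
          M * outside           ≤⟨ outside-small ⟩
          n * (s + s)           ≤⟨ ℕ.*-monoˡ-≤ (s + s) dense ⟩
          c * s * (s + s)       ≡⟨ e₂ c s ⟩
          2 * c * (s * s)       ∎)
          where
          open ℕ.≤-Reasoning
          e₁ : ∀ c o → 2 * c * (2 * o) ≡ 4 * c * o
          e₁ = solve-∀
          e₂ : ∀ c s → c * s * (s + s) ≡ 2 * c * (s * s)
          e₂ = solve-∀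

        ≤2inside : s * s ≤ 2 * inside
        ≤2inside = ℕ.+-cancelʳ-≤ (s * s) (s * s) (2 * inside) (begin
          s * s + s * s              ≡⟨ cong₂ _+_ inside+outside inside+outside ⟩
          inside + outside + (inside + outside) ≡⟨ e inside outside ⟩
          2 * inside + 2 * outside   ≤⟨ ℕ.+-monoʳ-≤ (2 * inside) 2outside≤ ⟩
          2 * inside + s * s         ∎)
          where
          open ℕ.≤-Reasoning
          e : ∀ i o → i + o + (i + o) ≡ 2 * i + 2 * o
          e = solve-∀

        -- Otherwise 2 * inCoset y + 1 ≤ s for every y, and summing over y in `X` gives 2 * inside +
        -- s ≤ s * s, against `≤2inside` and s > 0.
        heavyCoset : ∃[ y ] s ≤ 2 * inCoset y
        heavyCoset with Fin.any? (λ y → s ℕ.≤? 2 * inCoset y)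
        ... | yes h = h
        ... | no ¬h = contradiction (begin-strict
          s * s + 0        <⟨ ℕ.+-monoʳ-< (s * s) 0<s ⟩
          s * s + s        ≤⟨ ℕ.+-monoˡ-≤ s ≤2inside ⟩
          2 * inside + s   ≡⟨ cong (λ x → 2 * x + s) inside≡ ⟩
          2 * sum (λ y → ⟦ X y ⟧ * inCoset y) + s
            ≡⟨ cong (_+ s) (*-distribˡ-sum 2 (λ y → ⟦ X y ⟧ * inCoset y)) ⟩
          sum (λ y → 2 * (⟦ X y ⟧ * inCoset y)) + s
            ≡⟨ sym (∑-distrib-+ (λ y → 2 * (⟦ X y ⟧ * inCoset y)) (⟦_⟧ ∘ X)) ⟩
          sum (λ y → 2 * (⟦ X y ⟧ * inCoset y) + ⟦ X y ⟧)
            ≡⟨ sum-cong-≗ (λ y → e ⟦ X y ⟧ (inCoset y)) ⟩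
          sum (λ y → ⟦ X y ⟧ * suc (2 * inCoset y))
            ≤⟨ sum-mono (λ y → ℕ.*-monoʳ-≤ ⟦ X y ⟧ (ℕ.≰⇒> λ le → ¬h (y , le))) ⟩
          sum (λ y → ⟦ X y ⟧ * s)
            ≡⟨ sym (*-distribʳ-sum s (⟦_⟧ ∘ X)) ⟩
          s * s            ≡⟨ sym (ℕ.+-identityʳ (s * s)) ⟩
          s * s + 0        ∎) (ℕ.<-irrefl refl)
          where
          open ℕ.≤-Reasoning
          e : ∀ a b → 2 * (a * b) + a ≡ a * suc (2 * b)
          e = solve-∀

        x₀ : Fin n
        x₀ = proj₁ heavyCoset

        s≤2w : s ≤ 2 * inCoset x₀
        s≤2w = proj₂ heavyCoset

        0<w : 0 < inCoset x₀
        0<w = ℕ.n≢0⇒n>0 λ w≡0 →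
          ℕ.<-irrefl refl (ℕ.<-≤-trans 0<s (subst (λ w → s ≤ 2 * w) w≡0 s≤2w))

        index : n ≤ 2 * c * count H
        index = begin
          n                       ≤⟨ dense ⟩
          c * s                   ≤⟨ ℕ.*-monoʳ-≤ c s≤2w ⟩
          c * (2 * inCoset x₀)    ≤⟨ ℕ.*-monoʳ-≤ c (ℕ.*-monoʳ-≤ 2 (inCoset≤ x₀)) ⟩
          c * (2 * count H)       ≡⟨ e c (count H) ⟩
          2 * c * count H         ∎
          where
          open ℕ.≤-Reasoning
          e : ∀ c h → c * (2 * h) ≡ 2 * c * h
          e = solve-∀

        -- The bound for b ∙ h is averaged over h ∈ H; only the part of X in x₀ ∙ H is kept.
        coset-bound : ∀ (S : Fin n → Bool) g b → x₀ ∙ b ≡ g →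
          (∀ h → H h ≡ true → M * count (λ x → X x ∧ S (x ∙ (b ∙ h))) ≤ s) →
          M * count (λ h → H h ∧ S (g ∙ h)) ≤ 2 * count H
        coset-bound S g b x₀b≡g bound =
          ℕ.*-cancelˡ-≤ w ⦃ ℕ.>-nonZero 0<w ⦄ (begin
            w * (M * D)           ≡⟨ e w M D ⟩
            M * (w * D)           ≤⟨ ℕ.*-monoʳ-≤ M wD≤ ⟩
            M * sum (λ h → ⟦ H h ⟧ * count (λ x → X x ∧ S (x ∙ (b ∙ h))))
              ≡⟨ *-distribˡ-sum M (λ h → ⟦ H h ⟧ * count (λ x → X x ∧ S (x ∙ (b ∙ h)))) ⟩
            sum (λ h → M * (⟦ H h ⟧ * count (λ x → X x ∧ S (x ∙ (b ∙ h)))))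
              ≤⟨ sum-mono (λ h → ℕ.≤-trans (ℕ.≤-reflexive (e M ⟦ H h ⟧ _)) (⟦⟧-guard (H h) (bound h))) ⟩
            sum (λ h → ⟦ H h ⟧ * s) ≡⟨ sym (*-distribʳ-sum s (⟦_⟧ ∘ H)) ⟩
            count H * s           ≤⟨ ℕ.*-monoʳ-≤ (count H) s≤2w ⟩
            count H * (2 * w)     ≡⟨ e′ (count H) w ⟩
            w * (2 * count H)     ∎)
          where
          open ℕ.≤-Reasoning
          w = inCoset x₀
          D = count (λ h → H h ∧ S (g ∙ h))
          e : ∀ a b c → a * (b * c) ≡ b * (a * c)
          e = solve-∀
          e′ : ∀ a b → a * (2 * b) ≡ b * (2 * a)
          e′ = solve-∀

          pair : Fin n → Fin n → ℕ
          pair h x = ⟦ H h ⟧ * ⟦ S (g ∙ (x ∙ h)) ⟧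

          inner : ∀ x → H x ≡ true → sum (λ h → pair h x) ≡ D
          inner x Hx = trans
            (sum-cong-≗ λ h → trans
              (cong₂ (λ p q → ⟦ p ⟧ * ⟦ S (g ∙ q) ⟧) (sym (translate h x Hx)) (comm x h))
              (sym (⟦⟧-∧ (H (h ∙ x)) (S (g ∙ (h ∙ x))))))
            (sum-translateʳ (λ h → ⟦ H h ∧ S (g ∙ h) ⟧) x)

          reindex : ∀ h → sum (λ x → ⟦ X (x₀ ∙ x) ⟧ * pair h x) ≡
                          ⟦ H h ⟧ * count (λ x → X x ∧ S (x ∙ (b ∙ h)))
          reindex h = trans
            (trans (sum-cong-≗ λ x → trans (e ⟦ X (x₀ ∙ x) ⟧ ⟦ H h ⟧ _)
                (cong (⟦ H h ⟧ *_) (trans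
                  (cong (λ z → ⟦ X (x₀ ∙ x) ⟧ * ⟦ S z ⟧)
                    (trans (cong (_∙ (x ∙ h)) (sym x₀b≡g)) (interchange x₀ b x h)))
                  (sym (⟦⟧-∧ (X (x₀ ∙ x)) (S ((x₀ ∙ x) ∙ (b ∙ h))))))))
              (sym (*-distribˡ-sum ⟦ H h ⟧ (λ x → ⟦ X (x₀ ∙ x) ∧ S ((x₀ ∙ x) ∙ (b ∙ h)) ⟧))))
            (cong (⟦ H h ⟧ *_) (sum-translateˡ (λ x → ⟦ X x ∧ S (x ∙ (b ∙ h)) ⟧) x₀))

          -- The product counts pairs x , h in `H` with x₀ ∙ x in `X` and g ∙ (x ∙ h) in `S`,
          -- because translation by x preserves `H`. Forgetting that x lies in `H` only adds pairs,
          -- and g ∙ (x ∙ h) = (x₀ ∙ x) ∙ (b ∙ h).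
          wD≤ : w * D ≤ sum (λ h → ⟦ H h ⟧ * count (λ x → X x ∧ S (x ∙ (b ∙ h))))
          wD≤ = begin
            w * D
              ≡⟨ *-distribʳ-sum D (λ x → ⟦ H x ⟧ * ⟦ X (x₀ ∙ x) ⟧) ⟩
            sum (λ x → ⟦ H x ⟧ * ⟦ X (x₀ ∙ x) ⟧ * D)
              ≤⟨ sum-mono (λ x → ℕ.≤-trans (ℕ.≤-reflexive (ℕ.*-assoc ⟦ H x ⟧ ⟦ X (x₀ ∙ x) ⟧ D))
                   (ℕ.≤-trans (⟦⟧-guard (H x) λ Hx → ℕ.≤-reflexive
                     (cong (⟦ X (x₀ ∙ x) ⟧ *_) (sym (inner x Hx))))
                   (ℕ.≤-trans (ℕ.*-monoˡ-≤ _ (⟦⟧≤1 (H x))) (ℕ.≤-reflexive (ℕ.*-identityˡ _))))) ⟩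
            sum (λ x → ⟦ X (x₀ ∙ x) ⟧ * sum (λ h → pair h x))
              ≡⟨ sum-cong-≗ (λ x → *-distribˡ-sum ⟦ X (x₀ ∙ x) ⟧ (λ h → pair h x)) ⟩
            sum (λ x → sum (λ h → ⟦ X (x₀ ∙ x) ⟧ * pair h x))
              ≡⟨ ∑-comm (λ x h → ⟦ X (x₀ ∙ x) ⟧ * pair h x) ⟩
            sum (λ h → sum (λ x → ⟦ X (x₀ ∙ x) ⟧ * pair h x))
              ≡⟨ sum-cong-≗ reindex ⟩
            sum (λ h → ⟦ H h ⟧ * count (λ x → X x ∧ S (x ∙ (b ∙ h)))) ∎

        -- `T` is constant on b ∙ H since `H` stabilises it, so a single value of `T` supplies the
        -- bound at every b ∙ h. The choice b = g ∙ x₀⁻¹ carries the coset x₀ ∙ H to g ∙ H.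
        dichotomy : ∀ g → M * count (λ h → H h ∧ A (g ∙ h)) ≤ 2 * count H
                        ⊎ M * count (λ h → H h ∧ not (A (g ∙ h))) ≤ 2 * count H
        dichotomy g with T (g ∙ (x₀ ⁻¹)) in Tb
        ... | true  = inj₂ (coset-bound (not ∘ A) g (g ∙ (x₀ ⁻¹))
          (trans (comm x₀ _) (//-rightDividesˡ x₀ g)) λ h Hh → T-true _ (trans (H⇒ Hh _) Tb))
        ... | false = inj₁ (coset-bound A g (g ∙ (x₀ ⁻¹))
          (trans (comm x₀ _) (//-rightDividesˡ x₀ g)) λ h Hh → T-false _ (trans (H⇒ Hh _) Tb))

    record RegularSubgroup (A : Fin n → Bool) (m I : ℕ) : Set where
      field
        H          : Fin n → Bool
        isSubgroup : IsSubgroup H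
        index      : n ≤ I * count H
        dichotomy  : ∀ g → m * count (λ h → H h ∧ A (g ∙ h)) ≤ count H
                         ⊎ m * count (λ h → H h ∧ not (A (g ∙ h))) ≤ count H

    wholeGroup : ∀ (A : Fin n → Bool) → RegularSubgroup A 2 1
    wholeGroup A = record
      { H          = λ _ → true
      ; isSubgroup = record { ε∈ = refl ; ∙∈ = λ _ _ → refl ; ⁻¹∈ = λ _ → refl }
      ; index      = ℕ.≤-reflexive (trans (sym count-true) (sym (ℕ.*-identityˡ _)))
      ; dichotomy  = λ g → smallerHalf (count (λ h → A (g ∙ h))) (count (λ h → not (A (g ∙ h))))
          (trans (count-not (λ h → A (g ∙ h))) (sym count-true)) }
      where
      count-true : count {n} (λ _ → true) ≡ n
      count-true = trans (sum-const n 1) (ℕ.*-identityʳ n)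

    regularSubgroup : ∀ (A : Fin n → Bool) k →
      ¬ (Σ[ a ∈ (Fin k → Fin n) ] Σ[ b ∈ (Fin k → Fin n) ] ∀ i j →
          (i Fin.≤ j → A (a i ∙ b j) ≡ true) × (¬ (i Fin.≤ j) → A (a i ∙ b j) ≡ false)) →
      ∀ m → 0 < m →
      RegularSubgroup A m (2 * (4 * m) ^ exponent (ladderHeight k) 0)
    regularSubgroup A k stable m 0<m
      with uniformSet (4 * m) n 0<n (ladderHeight k) 0 (λ _ → true) {λ _ → ⊤} (λ _ _ → tt)
             (ℕ.≤-reflexive (sym (trans (ℕ.+-identityʳ _) (trans (sum-const n 1) (ℕ.*-identityʳ n)))))
      where
      open Density (λ x b → A (x ∙ b))
      0<n : 0 < n
      0<n = ℕ.≤-<-trans z≤n (Fin.toℕ<n ε)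
    ... | inj₂ t = contradiction (Ladders.orderProperty (λ x b → A (x ∙ b)) {k = k} t) stable
    ... | inj₁ u = record
      { H          = H
      ; isSubgroup = isSubgroup
      ; index      = ℕ.≤-trans index (ℕ.*-monoˡ-≤ (count H)
                       (ℕ.*-monoʳ-≤ 2 (ℕ.^-monoʳ-≤ (4 * m) ⦃ ℕ.>-nonZero 0<Q ⦄ e≤E)))
      ; dichotomy  = Sum.map reduce reduce ∘ dichotomy
      }
      where
      open Density.UniformSet u
      Q = 4 * m
      c = Q ^ e
      0<Q : 0 < Q
      0<Q = ℕ.<-≤-trans 0<m (ℕ.m≤m+n m _)
      0<c : 0 < c
      0<c = ℕ.m^n>0 Q ⦃ ℕ.>-nonZero 0<Q ⦄ e
      0<n : 0 < n
      0<n = ℕ.≤-<-trans z≤n (Fin.toℕ<n ε)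
      0<s : 0 < count X
      0<s = ℕ.n≢0⇒n>0 λ s≡0 → ℕ.<-irrefl refl (ℕ.<-≤-trans 0<n
        (subst (n ≤_) (trans (cong (c *_) s≡0) (ℕ.*-zeroʳ c)) dense))
      open Stabiliser A X (Q ^ suc e) uniform
      open Large c 0<s 0<c dense (ℕ.*-monoˡ-≤ c (ℕ.≤-trans (ℕ.≤-reflexive (sym (ℕ.*-identityʳ 4)))
        (ℕ.*-monoʳ-≤ 4 0<m)))
      -- The factor 2 lost in passing from `X` to half of it in a coset is covered by the 4 in Q =
      -- 4m.
      reduce : ∀ {x y} → Q * c * x ≤ 2 * y → m * x ≤ y
      reduce {x} {y} h = ℕ.*-cancelˡ-≤ 2 (begin
        2 * (m * x)     ≡⟨ sym (ℕ.*-assoc 2 m x) ⟩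
        2 * m * x       ≤⟨ ℕ.*-monoˡ-≤ x (ℕ.*-monoˡ-≤ m (s≤s (s≤s (z≤n {2})))) ⟩
        Q * x           ≡⟨ cong (_* x) (sym (ℕ.*-identityʳ Q)) ⟩
        Q * 1 * x       ≤⟨ ℕ.*-monoˡ-≤ x (ℕ.*-monoʳ-≤ Q 0<c) ⟩
        Q * c * x       ≤⟨ h ⟩
        2 * y           ∎)
        where open ℕ.≤-Reasoning

  least : ∀ {p} {P : ℕ → Set p} → (∀ m → Dec (P m)) → ∀ k → P k →
          ∃[ m ] P m × (∀ {j} → j < m → ¬ P j)
  least P? k Pk with P? 0
  ... | yes P0 = 0 , P0 , λ ()
  least P? zero    Pk | no ¬P0 = contradiction Pk ¬P0
  least P? (suc k) Pk | no ¬P0 with least (P? ∘ suc) k Pk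
  ... | m , Pm , min = suc m , Pm , λ { {zero} _ → ¬P0 ; {suc j} (s≤s j<m) → min j<m }

  -- Congruences between natural numbers.

  module Modular (N : ℕ) where

    infix 4 _≋_
    -- Multiples of N are allowed on both sides, which makes congruence symmetric without
    -- subtraction.
    record _≋_ (a b : ℕ) : Set where
      constructor shift
      field
        u v : ℕ
        eq  : a + u * N ≡ b + v * N

    ≋-refl : ∀ {a} → a ≋ a
    ≋-refl = shift 0 0 refl

    ≋-reflexive : ∀ {a b} → a ≡ b → a ≋ b
    ≋-reflexive refl = ≋-refl

    ≋-sym : ∀ {a b} → a ≋ b → b ≋ a
    ≋-sym (shift u v e) = shift v u (sym e)

    ≋-trans : ∀ {a b c} → a ≋ b → b ≋ c → a ≋ c
    ≋-trans {a} {b} {c} (shift u v e) (shift u′ v′ e′) = shift (u + u′) (v + v′) (begin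
      a + (u + u′) * N     ≡⟨ l a u u′ N ⟩
      a + u * N + u′ * N   ≡⟨ cong (_+ u′ * N) e ⟩
      b + v * N + u′ * N   ≡⟨ m b v u′ N ⟩
      b + u′ * N + v * N   ≡⟨ cong (_+ v * N) e′ ⟩
      c + v′ * N + v * N   ≡⟨ r c v v′ N ⟩
      c + (v + v′) * N     ∎)
      where
      open ≡-Reasoning
      l : ∀ a u v N → a + (u + v) * N ≡ a + u * N + v * N
      l = solve-∀
      m : ∀ b v u N → b + v * N + u * N ≡ b + u * N + v * N
      m = solve-∀
      r : ∀ c v u N → c + u * N + v * N ≡ c + (v + u) * N
      r = solve-∀

    ≋-+ : ∀ {a b c d} → a ≋ b → c ≋ d → a + c ≋ b + d
    ≋-+ {a} {b} {c} {d} (shift u v e) (shift u′ v′ e′) = shift (u + u′) (v + v′)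
      (trans (l a c u u′ N) (trans (cong₂ _+_ e e′) (sym (l b d v v′ N))))
      where
      l : ∀ a c u v N → a + c + (u + v) * N ≡ (a + u * N) + (c + v * N)
      l = solve-∀

    ≋-cancelʳ : ∀ {a b} c → a + c ≋ b + c → a ≋ b
    ≋-cancelʳ {a} {b} c (shift u v e) = shift u v (ℕ.+-cancelʳ-≡ c _ _
      (trans (l a c (u * N)) (trans e (sym (l b c (v * N))))))
      where
      l : ∀ a c x → a + x + c ≡ a + c + x
      l = solve-∀

    ∣⇒≋0 : ∀ {a} → N ∣ a → a ≋ 0
    ∣⇒≋0 {a} (divides q e) = shift 0 q (trans (ℕ.+-identityʳ a) e)

    ≋0⇒∣ : ∀ {a} → a ≋ 0 → N ∣ a
    ≋0⇒∣ {a} (shift u v e) = ∣.∣m+n∣m⇒∣n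
      (divides v (trans (ℕ.+-comm (u * N) a) e)) (divides u refl)

    ≋⇒%≡ : ∀ {a b} .⦃ _ : ℕ.NonZero N ⦄ → a ≋ b → a % N ≡ b % N
    ≋⇒%≡ {a} {b} (shift u v e) = trans (sym (ℕ.[m+kn]%n≡m%n a u N))
      (trans (cong (_% N) e) (ℕ.[m+kn]%n≡m%n b v N))

    ≋-% : ∀ a .⦃ _ : ℕ.NonZero N ⦄ → a % N ≋ a
    ≋-% a = shift (a / N) 0 (trans (sym (ℕ.m≡m%n+[m/n]*n a N)) (sym (ℕ.+-identityʳ a)))

  -- Extension of homomorphisms and separation from a subgroup.

  module Duality {n : ℕ} {_∙_ : Fin n → Fin n → Fin n} {ε : Fin n} {_⁻¹ : Fin n → Fin n}
    (isAbelianGroup : IsAbelianGroup _≡_ _∙_ ε _⁻¹) where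

    open FinGroup isAbelianGroup
    open MonoidMult (AbelianGroup.commutativeMonoid abelianGroup)
      renaming (_×_ to infixr 21 _·_; ×-homo-+ to ·-homo-+; ×-assocˡ to ·-assocˡ)
      using (×-distrib-+)
    private
      module G = MonoidSum (AbelianGroup.commutativeMonoid abelianGroup)
    open GroupProperties (AbelianGroup.group abelianGroup)
      using (identityʳ-unique; inverseʳ-unique; ⁻¹-anti-homo-//)

    private
      0<n : 0 < n
      0<n = ℕ.≤-<-trans z≤n (Fin.toℕ<n ε)

    -- Translating the sum of all elements by g changes it by n · g.
    n·g≡ε : ∀ g → n · g ≡ ε
    n·g≡ε g = identityʳ-unique (G.sum id) (n · g) (begin
      G.sum id ∙ n · g                   ≡⟨ cong (G.sum id ∙_) (sym (G.sum-replicate n)) ⟩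
      G.sum id ∙ G.sum {n} (λ _ → g)     ≡⟨ sym (G.∑-distrib-+ id (λ _ → g)) ⟩
      G.sum (λ x → x ∙ g)                ≡⟨ sym (G.sum-permute id (permutation (_∙ g) (_∙ (g ⁻¹))
                                             (//-rightDividesˡ g) (//-rightDividesʳ g))) ⟩
      G.sum id                           ∎)
      where open ≡-Reasoning

    ·-closed : ∀ {D : Fin n → Bool} → D ε ≡ true → (∀ {g h} → D g ≡ true → D h ≡ true → D (g ∙ h) ≡ true) →
               ∀ m {g} → D g ≡ true → D (m · g) ≡ true
    ·-closed     ε∈ ∙∈ zero    Dg = ε∈
    ·-closed {D} ε∈ ∙∈ (suc m) Dg = ∙∈ Dg (·-closed {D} ε∈ ∙∈ m Dg)

    -- Since n · g = ε, the multiple (n - 1) · g is the inverse of g.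
    submonoid⇒subgroup : ∀ {D : Fin n → Bool} → D ε ≡ true →
      (∀ {g h} → D g ≡ true → D h ≡ true → D (g ∙ h) ≡ true) → IsSubgroup D
    submonoid⇒subgroup {D} ε∈ ∙∈ = record
      { ε∈ = ε∈ ; ∙∈ = λ {g} {h} → ∙∈ {g} {h}
      ; ⁻¹∈ = λ {g} Dg → subst (λ x → D x ≡ true)
          (inverseʳ-unique g (ℕ.pred n · g)
            (trans (cong (_· g) (ℕ.suc-pred n ⦃ ℕ.>-nonZero 0<n ⦄)) (n·g≡ε g)))
          (·-closed {D} ε∈ (λ {g} {h} → ∙∈ {g} {h}) (ℕ.pred n) Dg)
      }

    -- Because n kills every element, extending a homomorphism needs only a modulus divisible by n.
    -- The free factor `K` makes N suitable for the construction of e^(2πi/N).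
    module Extension (K : ℕ) (0<K : 0 < K) where
      N = n * K
      open Modular N

      record PartialHom : Set where
        field
          D          : Fin n → Bool
          isSubgroup : IsSubgroup D
          φ          : Fin n → ℕ
          homo       : ∀ {g h} → D g ≡ true → D h ≡ true → φ (g ∙ h) ≋ φ g + φ h

        open IsSubgroup isSubgroup public

        φε≋0 : φ ε ≋ 0
        φε≋0 = ≋-sym (≋-cancelʳ (φ ε)
          (≋-trans (≋-reflexive (cong φ (sym (identityˡ ε)))) (homo ε∈ ε∈)))

        homo-· : ∀ m {g} → D g ≡ true → φ (m · g) ≋ m * φ g
        homo-· zero    Dg = φε≋0
        homo-· (suc m) Dg = ≋-trans (homo Dg (·-closed {D} ε∈ ∙∈ m Dg)) (≋-+ ≋-refl (homo-· m Dg))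

        -- The order of z modulo D is suc p.
        record Order (z : Fin n) (p : ℕ) : Set where
          field
            m·z∈    : D (suc p · z) ≡ true
            minimal : ∀ {j} → j < suc p → D (j · z) ≡ true → j ≡ 0

          -- Cancelling puts w · z into `D`. With g = ε this yields that the order divides n; with
          -- general g, that the exponent bringing g into `D` is unique below the order.
          remainder : ∀ g t w → D (g ∙ t · z) ≡ true → D (g ∙ (w + t) · z) ≡ true →
                      w < suc p → w ≡ 0
          remainder g t w D₁ D₂ w<m = minimal w<m (∙-cancelʳ∈ D₁ (subst (λ x → D x ≡ true) (begin
            g ∙ (w + t) · z          ≡⟨ cong (g ∙_) (·-homo-+ z w t) ⟩
            g ∙ (w · z ∙ t · z)      ≡⟨ sym (assoc g (w · z) (t · z)) ⟩
            (g ∙ w · z) ∙ t · z      ≡⟨ cong (_∙ t · z) (comm g (w · z)) ⟩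
            (w · z ∙ g) ∙ t · z      ≡⟨ assoc (w · z) g (t · z) ⟩
            w · z ∙ (g ∙ t · z)      ∎) D₂))
            where open ≡-Reasoning

          order∣n : suc p ∣ n
          order∣n = ∣.m%n≡0⇒n∣m n (suc p) (remainder ε (n / suc p * suc p) (n % suc p)
            (subst (λ x → D x ≡ true) (trans (·-assocˡ z (n / suc p) (suc p)) (sym (identityˡ _)))
              (·-closed {D} ε∈ ∙∈ (n / suc p) m·z∈))
            (subst (λ x → D x ≡ true) (sym (trans (identityˡ _)
              (trans (cong (_· z) (sym (ℕ.m≡m%n+[m/n]*n n (suc p)))) (n·g≡ε z)))) ε∈)
            (ℕ.m%n<n n (suc p)))

        order : ∀ z → ∃[ p ] Order z p
        order z with least (λ p → D (suc p · z) Bool.≟ true) (ℕ.pred n)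
          (trans (cong D (trans (cong (_· z) (ℕ.suc-pred n ⦃ ℕ.>-nonZero 0<n ⦄)) (n·g≡ε z))) ε∈)
        ... | p , m·z∈ , min = p , record
          { m·z∈ = m·z∈
          ; minimal = λ { {zero} _ _ → refl ; {suc j} (s≤s j<p) Dj → contradiction Dj (min j<p) } }

      open PartialHom

      record _⊑_ (P P′ : PartialHom) : Set where
        field
          D⊆   : ∀ {g} → D P g ≡ true → D P′ g ≡ true
          φ≋   : ∀ {g} → D P g ≡ true → φ P′ g ≋ φ P g
      open _⊑_

      ⊑-trans : ∀ {P Q R} → P ⊑ Q → Q ⊑ R → P ⊑ R
      ⊑-trans P⊑Q Q⊑R = record
        { D⊆ = D⊆ Q⊑R ∘ D⊆ P⊑Q
        ; φ≋ = λ Dg → ≋-trans (φ≋ Q⊑R (D⊆ P⊑Q Dg)) (φ≋ P⊑Q Dg) }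

      -- The extension sends z to - b.
      module Adjoin (P : PartialHom) (z : Fin n) {p} (o : Order P z p)
        (b : ℕ) (compatible : suc p * b + φ P (suc p · z) ≋ 0) where
        open Order o
        private
          module P = PartialHom P
          m = suc p

        -- An element of the enlarged subgroup is one that some multiple of z brings back into `D`.
        -- As z goes to - b, its value is φ (g ∙ t · z) + t * b, with no subtraction.
        inside? : ∀ g → Dec (∃[ t ] P.D (g ∙ Fin.toℕ {m} t · z) ≡ true)
        inside? g = Fin.any? (λ t → P.D (g ∙ Fin.toℕ t · z) Bool.≟ true)

        D′ : Fin n → Bool
        D′ g = does (inside? g)

        value : ∀ {g} → Dec (∃[ t ] P.D (g ∙ Fin.toℕ {m} t · z) ≡ true) → ℕ
        value {g} (yes (t , _)) = P.φ (g ∙ Fin.toℕ t · z) + Fin.toℕ t * b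
        value     (no _)        = 0

        φ′ : Fin n → ℕ
        φ′ g = value (inside? g)

        D′-intro : ∀ {g} t → t < m → P.D (g ∙ t · z) ≡ true → D′ g ≡ true
        D′-intro {g} t t<m d = dec-true (inside? g) (Fin.fromℕ< t<m ,
          trans (cong (λ s → P.D (g ∙ s · z)) (Fin.toℕ-fromℕ< t<m)) d)

        unique : ∀ g {t u} → t < m → u < m → P.D (g ∙ t · z) ≡ true → P.D (g ∙ u · z) ≡ true → t ≡ u
        unique g {t} {u} t<m u<m Dt Du with ℕ.≤-total t u
        ... | inj₁ t≤u = ℕ.≤-antisym t≤u (ℕ.m∸n≡0⇒m≤n (remainder g t (u ∸ t) Dt
          (subst (λ s → P.D (g ∙ s · z) ≡ true) (sym (ℕ.m∸n+n≡m t≤u)) Du)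
          (ℕ.≤-<-trans (ℕ.m∸n≤m u t) u<m)))
        ... | inj₂ u≤t = ℕ.≤-antisym (ℕ.m∸n≡0⇒m≤n (remainder g u (t ∸ u) Du
          (subst (λ s → P.D (g ∙ s · z) ≡ true) (sym (ℕ.m∸n+n≡m u≤t)) Dt)
          (ℕ.≤-<-trans (ℕ.m∸n≤m t u) t<m))) u≤t

        φ′-value : ∀ {g} t → t < m → P.D (g ∙ t · z) ≡ true → φ′ g ≡ P.φ (g ∙ t · z) + t * b
        φ′-value {g} t t<m Dt with inside? g
        ... | yes (u , Du) = cong (λ s → P.φ (g ∙ s · z) + s * b) (unique g (Fin.toℕ<n u) t<m Du Dt)
        ... | no ¬D = contradiction (Fin.fromℕ< t<m ,
          trans (cong (λ s → P.D (g ∙ s · z)) (Fin.toℕ-fromℕ< t<m)) Dt) ¬D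

        D′-elim : ∀ {g} → D′ g ≡ true → ∃[ t ] t < m × P.D (g ∙ t · z) ≡ true
        D′-elim {g} d = let (t , Dt) = fromDoes (inside? g) d in Fin.toℕ t , Fin.toℕ<n t , Dt

        regroup : ∀ g h t u → (g ∙ t · z) ∙ (h ∙ u · z) ≡ (g ∙ h) ∙ (t + u) · z
        regroup g h t u = trans (interchange g (t · z) h (u · z))
          (cong ((g ∙ h) ∙_) (sym (·-homo-+ z t u)))

        -- The exponent t + u of a product is reduced modulo the order of z.
        product : ∀ {g h} → D′ g ≡ true → D′ h ≡ true →
                  D′ (g ∙ h) ≡ true × φ′ (g ∙ h) ≋ φ′ g + φ′ h
        product {g} {h} dg dh = go (D′-elim dg) (D′-elim dh)
          where
          go : ∃[ t ] t < m × P.D (g ∙ t · z) ≡ true → ∃[ u ] u < m × P.D (h ∙ u · z) ≡ true →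
               D′ (g ∙ h) ≡ true × φ′ (g ∙ h) ≋ φ′ g + φ′ h
          go (t , t<m , Dt) (u , u<m , Du) = case (t + u ℕ.<? m)
            where
            Dtu : P.D ((g ∙ h) ∙ (t + u) · z) ≡ true
            Dtu = subst (λ x → P.D x ≡ true) (regroup g h t u) (P.∙∈ Dt Du)

            total : φ′ g + φ′ h ≋ P.φ ((g ∙ h) ∙ (t + u) · z) + (t + u) * b
            total = ≋-trans (≋-reflexive (cong₂ _+_ (φ′-value t t<m Dt) (φ′-value u u<m Du)))
              (≋-trans (≋-reflexive (e (P.φ (g ∙ t · z)) (P.φ (h ∙ u · z)) t u b))
              (≋-+ (≋-sym (≋-trans (≋-reflexive (cong P.φ (sym (regroup g h t u)))) (P.homo Dt Du)))
                   ≋-refl))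
              where
              e : ∀ x y t u b → (x + t * b) + (y + u * b) ≡ (x + y) + (t + u) * b
              e = solve-∀

            case : Dec (t + u < m) → D′ (g ∙ h) ≡ true × φ′ (g ∙ h) ≋ φ′ g + φ′ h
            case (yes lt) = D′-intro (t + u) lt Dtu ,
              ≋-trans (≋-reflexive (φ′-value (t + u) lt Dtu)) (≋-sym total)
            case (no ≮) = D′-intro v v<m Dv ,
              ≋-trans (≋-reflexive (φ′-value v v<m Dv)) (≋-sym (≋-trans total (≋-trans
                (≋-reflexive (cong₂ _+_ (cong P.φ (sym gh≡)) (cong (_* b) tu≡)))
                (≋-trans (≋-+ (P.homo Dv m·z∈) ≋-refl)
                (≋-trans (≋-reflexive (e (P.φ ((g ∙ h) ∙ v · z)) (P.φ (m · z)) v m b))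
                (≋-trans (≋-+ ≋-refl compatible) (≋-reflexive (ℕ.+-identityʳ _))))))))
              where
              v = t + u ∸ m
              tu≡ : t + u ≡ v + m
              tu≡ = sym (ℕ.m∸n+n≡m (ℕ.≮⇒≥ ≮))
              v<m : v < m
              v<m = ℕ.+-cancelʳ-< m v m (subst (_< m + m) tu≡ (ℕ.+-mono-< t<m u<m))
              gh≡ : ((g ∙ h) ∙ v · z) ∙ m · z ≡ (g ∙ h) ∙ (t + u) · z
              gh≡ = trans (assoc _ _ _) (cong ((g ∙ h) ∙_)
                (trans (sym (·-homo-+ z v m)) (cong (_· z) (sym tu≡))))
              Dv : P.D ((g ∙ h) ∙ v · z) ≡ true
              Dv = P.∙-cancelʳ∈ m·z∈ (subst (λ x → P.D x ≡ true) (sym gh≡) Dtu)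
              e : ∀ x y v m b → (x + y) + (v + m) * b ≡ (x + v * b) + (m * b + y)
              e = solve-∀

        D′-⊇ : ∀ {g} → P.D g ≡ true → D′ g ≡ true
        D′-⊇ {g} Dg = D′-intro 0 (s≤s z≤n) (trans (cong P.D (identityʳ g)) Dg)

        extended : PartialHom
        extended = record
          { D = D′ ; φ = φ′
          ; isSubgroup = submonoid⇒subgroup (D′-⊇ P.ε∈) (λ dg dh → proj₁ (product dg dh))
          ; homo = λ dg dh → proj₂ (product dg dh)
          }

        extends : P ⊑ extended
        extends = record
          { D⊆ = D′-⊇
          ; φ≋ = λ {g} Dg → ≋-reflexive (trans
              (φ′-value 0 (s≤s z≤n) (trans (cong P.D (identityʳ g)) Dg))
              (trans (ℕ.+-identityʳ _) (cong P.φ (identityʳ g))))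
          }

        z∈ : D′ z ≡ true
        z∈ = D′-intro p ℕ.≤-refl m·z∈

      -- Let m be the order of z modulo `D`, n = q * m and f = φ (m · z). Then q * f ≋ φ (n · z) ≋
      -- 0, and N is a multiple of q * m, so f = r * m for some r. The witness (N - 1) * r plays the
      -- part of - r.
      compatible-exists : ∀ P z {p} → Order P z p → ∃[ b ] suc p * b + φ P (suc p · z) ≋ 0
      compatible-exists P z {p} o = divisor (suc p) (φ P (suc p · z)) (Order.order∣n o) λ q n≡qm →
        ≋-trans (≋-sym (P.homo-· q (Order.m·z∈ o))) (≋-trans
          (≋-reflexive (cong P.φ (trans (·-assocˡ z q (suc p)) (trans (cong (_· z) (sym n≡qm)) (n·g≡ε z)))))
          P.φε≋0)
        where
        module P = PartialHom P

        divisor : ∀ m f → m ∣ n → (∀ q → n ≡ q * m → q * f ≋ 0) → ∃[ b ] m * b + f ≋ 0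
        divisor m f (divides q n≡qm) qf≋0 with m∣f
          where
          0<q : 0 < q
          0<q = ℕ.n≢0⇒n>0 λ q≡0 → ℕ.<-irrefl (sym (trans n≡qm (cong (_* m) q≡0))) 0<n
          m∣f : m ∣ f
          m∣f = ∣.*-cancelˡ-∣ q ⦃ ℕ.>-nonZero 0<q ⦄
            (∣.∣-trans (divides K (trans (cong (_* K) n≡qm) (ℕ.*-comm _ K))) (≋0⇒∣ (qf≋0 q n≡qm)))
        ... | divides r f≡rm = ℕ.pred N * r , ∣⇒≋0 (divides (m * r)
          (trans (cong (m * (ℕ.pred N * r) +_) f≡rm) (trans (multiple m (ℕ.pred N) r)
            (cong (m * r *_) (ℕ.suc-pred N ⦃ ℕ.m*n≢0 n K ⦃ ℕ.>-nonZero 0<n ⦄ ⦃ ℕ.>-nonZero 0<K ⦄ ⦄)))))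
          where
          multiple : ∀ m k r → m * (k * r) + r * m ≡ m * r * suc k
          multiple = solve-∀

      extendTo : ∀ P z → Σ[ P′ ∈ PartialHom ] P ⊑ P′ × D P′ z ≡ true
      extendTo P z =
        let (p , o) = order P z ; (b , c) = compatible-exists P z o
        in Adjoin.extended P z o b c , Adjoin.extends P z o b c , Adjoin.z∈ P z o b c

      extendToAll : ∀ P zs → Σ[ P′ ∈ PartialHom ] P ⊑ P′ × All (λ z → D P′ z ≡ true) zs
      extendToAll P [] = P , record { D⊆ = id ; φ≋ = λ _ → ≋-refl } , []
      extendToAll P (z ∷ zs) =
        let (P₁ , P⊑P₁ , z∈)   = extendTo P z
            (P₂ , P₁⊑P₂ , zs∈) = extendToAll P₁ zs
        in P₂ , ⊑-trans P⊑P₁ P₁⊑P₂ , D⊆ P₁⊑P₂ z∈ ∷ zs∈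

      record Hom (H : Fin n → Bool) : Set where
        field
          φ    : Fin n → ℕ
          homo : ∀ g h → φ (g ∙ h) ≋ φ g + φ h
          kills : ∀ {h} → H h ≡ true → φ h ≋ 0

      -- An angle between a quarter and a half turn has distance at least √2 from 1, comfortably
      -- above the width 1.
      half : ∀ m → 2 ≤ m → 2 * ℕ.⌊ m /2⌋ ≤ m × m ≤ 4 * ℕ.⌊ m /2⌋
      half 2 _ = s≤s (s≤s z≤n) , s≤s (s≤s z≤n)
      half 3 _ = s≤s (s≤s z≤n) , s≤s (s≤s (s≤s z≤n))
      half 0 ()
      half 1 (s≤s ())
      half (suc (suc m@(suc (suc _)))) _ with half m (s≤s (s≤s z≤n))
      ... | l , u =
        ℕ.≤-trans (ℕ.≤-reflexive (ℕ.*-suc 2 ℕ.⌊ m /2⌋)) (s≤s (s≤s l)) ,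
        ℕ.≤-trans (s≤s (s≤s (ℕ.≤-trans u (ℕ.m≤n+m _ 2)))) (ℕ.≤-reflexive (sym (ℕ.*-suc 4 ℕ.⌊ m /2⌋)))

      -- x is sent to ⌊m/2⌋/m of a full turn, where m is the order of x modulo H.
      separate : ∀ {H} → IsSubgroup H → ∀ x → H x ≡ false →
        Σ[ χ ∈ Hom H ] ∃[ a ] Hom.φ χ x ≋ a × N ≤ 4 * a × 2 * a ≤ N
      -- Adjoining x⁻¹ instead of x undoes the sign in `Adjoin`: x⁻¹ goes to - a and x to a.
      separate {H} isSub x Hx = go (order P₀ (x ⁻¹))
        where
        P₀ : PartialHom
        P₀ = record { D = H ; isSubgroup = isSub ; φ = λ _ → 0 ; homo = λ _ _ → ≋-refl }
        module H = IsSubgroup isSub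

        Hx⁻¹ : ¬ (H (x ⁻¹) ≡ true)
        Hx⁻¹ h = contradiction (trans (sym Hx)
          (H.∙-cancelʳ∈ h (trans (cong H (inverseʳ x)) H.ε∈))) λ ()

        Goal = Σ[ χ ∈ Hom H ] ∃[ a ] Hom.φ χ x ≋ a × N ≤ 4 * a × 2 * a ≤ N

        go : ∃[ p ] Order P₀ (x ⁻¹) p → Goal
        go (zero , o) = contradiction
          (subst (λ y → H y ≡ true) (identityʳ (x ⁻¹)) (Order.m·z∈ o)) Hx⁻¹
        go (suc p , o) = go′ (Order.order∣n o)
          where
          m = suc (suc p)
          go′ : m ∣ n → Goal
          go′ (divides q n≡qm) = record
            { φ = φ P₂ ; homo = λ g h → homo P₂ (all g) (all h)
            ; kills = λ Hh → ≋-trans (φ≋ P₁⊑P₂ (D⊆ P₀⊑P₁ Hh)) (φ≋ P₀⊑P₁ Hh)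
            } , a
            , ≋-trans (φ≋ P₁⊑P₂ x∈) (≋-reflexive (trans (φ′-value 1 (s≤s (s≤s z≤n)) Dx) (ℕ.*-identityˡ a)))
            , (begin
              N                      ≡⟨ N≡ ⟩
              q * K * m              ≤⟨ ℕ.*-monoʳ-≤ (q * K) (proj₂ (half m (s≤s (s≤s z≤n)))) ⟩
              q * K * (4 * ℕ.⌊ m /2⌋) ≡⟨ e₂ (q * K) 4 ℕ.⌊ m /2⌋ ⟩
              4 * a                  ∎)
            , (begin
              2 * a                  ≡⟨ sym (e₂ (q * K) 2 ℕ.⌊ m /2⌋) ⟩
              q * K * (2 * ℕ.⌊ m /2⌋) ≤⟨ ℕ.*-monoʳ-≤ (q * K) (proj₁ (half m (s≤s (s≤s z≤n)))) ⟩
              q * K * m              ≡⟨ sym N≡ ⟩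
              N                      ∎)
            where
            open ℕ.≤-Reasoning
            e₁ : ∀ q m K → q * m * K ≡ q * K * m
            e₁ = solve-∀
            e₂ : ∀ c k h → c * (k * h) ≡ k * (c * h)
            e₂ = solve-∀
            e₃ : ∀ m c h → m * (c * h) + 0 ≡ h * (c * m)
            e₃ = solve-∀
            -- This is ⌊m/2⌋ * (N / m), so m * a is a multiple of N, which is what m · x⁻¹ ∈ H
            -- requires.
            a = q * K * ℕ.⌊ m /2⌋
            N≡ : N ≡ q * K * m
            N≡ = trans (cong (_* K) n≡qm) (e₁ q m K)
            compatible : m * a + 0 ≋ 0
            compatible = ∣⇒≋0 (divides ℕ.⌊ m /2⌋
              (trans (e₃ m (q * K) ℕ.⌊ m /2⌋) (cong (ℕ.⌊ m /2⌋ *_) (sym N≡))))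
            open Adjoin P₀ (x ⁻¹) o a compatible
              renaming (extended to P₁; extends to P₀⊑P₁)
            Dx : H (x ∙ 1 · (x ⁻¹)) ≡ true
            Dx = trans (cong H (trans (cong (x ∙_) (identityʳ (x ⁻¹))) (inverseʳ x))) H.ε∈
            x∈ : D P₁ x ≡ true
            x∈ = D′-intro 1 (s≤s (s≤s z≤n)) Dx
            total = extendToAll P₁ (allFin n)
            P₂ = proj₁ total
            P₁⊑P₂ = proj₁ (proj₂ total)
            all : ∀ g → D P₂ g ≡ true
            all g = All.lookup (proj₂ (proj₂ total)) (∈-allFin g)

    -- Coset representatives and the index.

    module Cosets (H : Fin n → Bool) (isSubgroup : IsSubgroup H) where
      open IsSubgroup isSubgroup

      infix 4 _~_
      _~_ : Fin n → Fin n → Set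
      x ~ y = H (x ∙ (y ⁻¹)) ≡ true

      ~-trans : ∀ {x y z} → x ~ y → y ~ z → x ~ z
      ~-trans {x} {y} {z} xy yz = subst (λ w → H w ≡ true)
        (trans (sym (assoc (x ∙ (y ⁻¹)) y (z ⁻¹))) (cong (_∙ (z ⁻¹)) (//-rightDividesˡ y x)))
        (∙∈ xy yz)

      cosets : DecSetoid 0ℓ 0ℓ
      cosets = record
        { Carrier = Fin n ; _≈_ = _~_
        ; isDecEquivalence = record
          { isEquivalence = record
            { refl  = λ {x} → trans (cong H (inverseʳ x)) ε∈
            ; sym   = λ {x} {y} xy → subst (λ w → H w ≡ true) (⁻¹-anti-homo-// x y) (⁻¹∈ xy)
            ; trans = ~-trans }
          ; _≟_ = λ x y → H (x ∙ (y ⁻¹)) Bool.≟ true } }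
      open DecSetoid cosets using () renaming (setoid to cosetSetoid; sym to ~-sym; _≟_ to _~?_)

      representatives : List (Fin n)
      representatives = deduplicate _~?_ (allFin n)

      distinct : AllPairs (λ x y → ¬ (x ~ y)) representatives
      distinct = Unique.deduplicate-! cosets (allFin n)

      represented : ∀ x → Any.Any (x ~_) representatives
      represented x = SetoidMembership.∈-deduplicate⁺ cosetSetoid _~?_
        (λ p q → ~-trans q (~-sym p))
        (Any.map (λ { refl → DecSetoid.refl cosets }) (∈-allFin x))

      covering : List (Fin n) → Fin n → ℕ
      covering []       x = 0
      covering (r ∷ rs) x = ⟦ H (x ∙ (r ⁻¹)) ⟧ + covering rs x

      sum-covering : ∀ rs → sum (covering rs) ≡ length rs * count H
      sum-covering []       = trans (sum-const n 0) (ℕ.*-zeroʳ n)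
      sum-covering (r ∷ rs) = trans (∑-distrib-+ (λ x → ⟦ H (x ∙ (r ⁻¹)) ⟧) (covering rs))
        (cong₂ _+_ (sum-translateʳ (⟦_⟧ ∘ H) (r ⁻¹)) (sum-covering rs))

      covering≡0 : ∀ {x rs} → All (λ r → ¬ (x ~ r)) rs → covering rs x ≡ 0
      covering≡0 [] = refl
      covering≡0 {x} {r ∷ rs} (x≁r ∷ x≁rs) =
        cong₂ _+_ (cong ⟦_⟧ (Bool.¬-not x≁r)) (covering≡0 x≁rs)

      covering≤1 : ∀ {rs} → AllPairs (λ x y → ¬ (x ~ y)) rs → ∀ x → covering rs x ≤ 1
      covering≤1 []        x = z≤n
      covering≤1 {r ∷ rs} (r≁rs ∷ d) x with H (x ∙ (r ⁻¹)) in eq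
      ... | true  = s≤s (ℕ.≤-reflexive (covering≡0
        (All.map (λ r≁s x~s → r≁s (~-trans (~-sym {x} {r} eq) x~s)) r≁rs)))
      ... | false = covering≤1 d x

      -- The cosets of the representatives are disjoint translates of `H`: the function counting the
      -- cosets through x is at most 1 and sums to the left side.
      index-bound : length representatives * count H ≤ n
      index-bound = ℕ.≤-trans (ℕ.≤-reflexive (sym (sum-covering representatives)))
        (ℕ.≤-trans (sum-mono (covering≤1 distinct))
          (ℕ.≤-reflexive (trans (sum-const n 1) (ℕ.*-identityʳ n))))

-- Inequalities between rational numbers.

module UnitCircle where
  open import Data.Nat using (_%_)
  open import Data.Nat.Tactic.RingSolver using (solve-∀)
  open import Data.Rational using (_+_; _*_; _-_; -_; _≤_; _<_; ∣_∣; 1/_)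
  open import Defs using (ℝ; mkℝ; ℂ; _+i_; _≃ᶜ_; _*ᶜ_; _-ᶜ_; 1ℂ; 1ℝ; modulus;
    fromℕ; fromℕ-suc; fromℕ-*; fromℕ-mono; step; 0<step; step-small; ½-split;
    0<*; 0<½*; p≤∣p∣; near⇒≤; ≤⇒near; 0≤-mono-*; square-cancel-≤;
    sqrtApprox; sqrtApprox-upper; rootBelow-lower; rootBelow-nonneg)
  open FiniteGroups using (module Modular)
  open +-*-Solver

  ≤-by : ∀ {a b} r → 0ℚ ≤ r → a + r ≡ b → a ≤ b
  ≤-by {a} r 0≤r refl = subst (_≤ a + r) (ℚ.+-identityʳ a) (ℚ.+-monoʳ-≤ a 0≤r)

  0≤- : ∀ {a b} → a ≤ b → 0ℚ ≤ b - a
  0≤- {a} {b} h = subst (_≤ b - a) (ℚ.+-inverseʳ a) (ℚ.+-monoˡ-≤ (- a) h)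

  0≤* : ∀ {a b} → 0ℚ ≤ a → 0ℚ ≤ b → 0ℚ ≤ a * b
  0≤* {a} {b} 0≤a 0≤b = subst (_≤ a * b) (ℚ.*-zeroˡ b)
    (ℚ.*-monoʳ-≤-nonNeg b ⦃ ℚ.nonNegative 0≤b ⦄ 0≤a)

  0≤+ : ∀ {a b} → 0ℚ ≤ a → 0ℚ ≤ b → 0ℚ ≤ a + b
  0≤+ = ℚ.+-mono-≤

  0≤sq : ∀ a → 0ℚ ≤ a * a
  0≤sq a with ℚ.≤-total 0ℚ a
  ... | inj₁ 0≤a = 0≤* 0≤a 0≤a
  ... | inj₂ a≤0 = subst (0ℚ ≤_) (solve 1 (λ a → (:- a) :* (:- a) := a :* a) refl a)
                     (0≤* (ℚ.neg-antimono-≤ a≤0) (ℚ.neg-antimono-≤ a≤0))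

  *-monoˡ : ∀ {a b} c → 0ℚ ≤ c → a ≤ b → c * a ≤ c * b
  *-monoˡ c 0≤c = ℚ.*-monoˡ-≤-nonNeg c ⦃ ℚ.nonNegative 0≤c ⦄

  *-monoʳ : ∀ {a b} c → 0ℚ ≤ c → a ≤ b → a * c ≤ b * c
  *-monoʳ c 0≤c = ℚ.*-monoʳ-≤-nonNeg c ⦃ ℚ.nonNegative 0≤c ⦄

  0≤1 : 0ℚ ≤ 1ℚ
  0≤1 = ℚ.<⇒≤ (ℚ.positive⁻¹ 1ℚ)

  ≤1-*≤ : ∀ {a b} → 0ℚ ≤ a → b ≤ 1ℚ → a * b ≤ a
  ≤1-*≤ {a} 0≤a b≤1 = subst (a * _ ≤_) (ℚ.*-identityʳ a) (*-monoˡ a 0≤a b≤1)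

  abs-≤ : ∀ {x b} → x ≤ b → - b ≤ x → ∣ x ∣ ≤ b
  abs-≤ {x} {b} h₁ h₂ with ℚ.∣p∣≡p∨∣p∣≡-p x
  ... | inj₁ e = subst (_≤ b) (sym e) h₁
  ... | inj₂ e = subst₂ _≤_ (sym e) (solve 1 (λ b → :- (:- b) := b) refl b) (ℚ.neg-antimono-≤ h₂)

  sum-close : ∀ {a a′ b b′ p q} → ∣ a - a′ ∣ ≤ p → ∣ b - b′ ∣ ≤ q → ∣ (a + b) - (a′ + b′) ∣ ≤ p + q
  sum-close {a} {a′} {b} {b′} hp hq = subst (λ x → ∣ x ∣ ≤ _)
    (solve 4 (λ a a′ b b′ → (a :- a′) :+ (b :- b′) := (a :+ b) :- (a′ :+ b′)) refl a a′ b b′)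
    (ℚ.≤-trans (ℚ.∣p+q∣≤∣p∣+∣q∣ (a - a′) (b - b′)) (ℚ.+-mono-≤ hp hq))

  neg-close : ∀ {a a′ p} → ∣ a - a′ ∣ ≤ p → ∣ (- a) - (- a′) ∣ ≤ p
  neg-close {a} {a′} h = subst (_≤ _) (trans (sym (ℚ.∣-p∣≡∣p∣ (a - a′)))
    (cong ∣_∣ (solve 2 (λ a a′ → :- (a :- a′) := (:- a) :- (:- a′)) refl a a′))) h

  product-close : ∀ {a a′ b b′ p q} → ∣ b ∣ ≤ 1ℚ → ∣ a′ ∣ ≤ 1ℚ →
    ∣ a - a′ ∣ ≤ p → ∣ b - b′ ∣ ≤ q → ∣ a * b - a′ * b′ ∣ ≤ p + q
  product-close {a} {a′} {b} {b′} {p} {q} hb ha′ hp hq = subst (λ x → ∣ x ∣ ≤ p + q)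
    (solve 4 (λ a a′ b b′ → (a :- a′) :* b :+ a′ :* (b :- b′) := a :* b :- a′ :* b′) refl a a′ b b′)
    (ℚ.≤-trans (ℚ.∣p+q∣≤∣p∣+∣q∣ ((a - a′) * b) (a′ * (b - b′)))
      (ℚ.+-mono-≤
        (subst₂ _≤_ (sym (ℚ.∣p*q∣≡∣p∣*∣q∣ (a - a′) b)) (ℚ.*-identityʳ p)
          (0≤-mono-* (ℚ.0≤∣p∣ (a - a′)) 0≤1 hp hb))
        (subst₂ _≤_ (sym (ℚ.∣p*q∣≡∣p∣*∣q∣ a′ (b - b′))) (ℚ.*-identityˡ q)
          (0≤-mono-* (ℚ.0≤∣p∣ a′) (ℚ.≤-trans (ℚ.0≤∣p∣ (b - b′)) hq) ha′ hq))))

  -- Powers of rational points of the circle and their dependence on the parameter.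

  module Powers (c s : ℚ) where
    re im : ℕ → ℚ
    re zero    = 1ℚ
    re (suc j) = c * re j - s * im j
    im zero    = 0ℚ
    im (suc j) = c * im j + s * re j

    re-+ : ∀ j k → re (j ℕ.+ k) ≡ re j * re k - im j * im k
    im-+ : ∀ j k → im (j ℕ.+ k) ≡ re j * im k + im j * re k
    re-+ zero    k = solve 2 (λ x y → x := con 1ℚ :* x :- con 0ℚ :* y) refl (re k) (im k)
    re-+ (suc j) k = trans (cong₂ (λ x y → c * x - s * y) (re-+ j k) (im-+ j k))
      (solve 6 (λ c s a b x y → c :* (a :* x :- b :* y) :- s :* (a :* y :+ b :* x)
                             := (c :* a :- s :* b) :* x :- (c :* b :+ s :* a) :* y)
        refl c s (re j) (im j) (re k) (im k))
    im-+ zero    k = solve 2 (λ x y → y := con 1ℚ :* y :+ con 0ℚ :* x) refl (re k) (im k)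
    im-+ (suc j) k = trans (cong₂ (λ x y → c * y + s * x) (re-+ j k) (im-+ j k))
      (solve 6 (λ c s a b x y → c :* (a :* y :+ b :* x) :+ s :* (a :* x :- b :* y)
                             := (c :* a :- s :* b) :* y :+ (c :* b :+ s :* a) :* x)
        refl c s (re j) (im j) (re k) (im k))

    module Unit (unit : c * c + s * s ≡ 1ℚ) where
      norm : ∀ j → re j * re j + im j * im j ≡ 1ℚ
      norm zero    = refl
      norm (suc j) = trans
        (solve 4 (λ c s a b → (c :* a :- s :* b) :* (c :* a :- s :* b)
                           :+ (c :* b :+ s :* a) :* (c :* b :+ s :* a)
                           := (c :* c :+ s :* s) :* (a :* a :+ b :* b)) refl c s (re j) (im j))
        (cong₂ _*_ unit (norm j))

      -- Multiplication by z is undone by multiplication by its conjugate.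
      im-pred : ∀ j → im j ≡ c * im (suc j) - s * re (suc j)
      im-pred j = sym (trans
        (solve 4 (λ c s a b → c :* (c :* b :+ s :* a) :- s :* (c :* a :- s :* b)
                           := (c :* c :+ s :* s) :* b) refl c s (re j) (im j))
        (trans (cong (_* im j) unit) (ℚ.*-identityˡ (im j))))

  ∣fst∣≤1 : ∀ {x y} → x * x + y * y ≡ 1ℚ → ∣ x ∣ ≤ 1ℚ
  ∣fst∣≤1 {x} {y} e = abs-≤ (square-cancel-≤ (ℚ.positive⁻¹ 1ℚ) sq)
    (subst (- 1ℚ ≤_) (solve 1 (λ x → :- (:- x) := x) refl x) (ℚ.neg-antimono-≤
      (square-cancel-≤ (ℚ.positive⁻¹ 1ℚ)
        (subst (_≤ 1ℚ * 1ℚ) (solve 1 (λ x → x :* x := (:- x) :* (:- x)) refl x) sq))))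
    where
    sq : x * x ≤ 1ℚ * 1ℚ
    sq = ≤-by (y * y) (0≤sq y) e

  ∣snd∣≤1 : ∀ {x y} → x * x + y * y ≡ 1ℚ → ∣ y ∣ ≤ 1ℚ
  ∣snd∣≤1 {x} {y} e = ∣fst∣≤1 {y} {x} (trans (ℚ.+-comm (y * y) (x * x)) e)

  0<1+t² : ∀ t → 0ℚ < 1ℚ + t * t
  0<1+t² t = ℚ.+-mono-<-≤ (ℚ.positive⁻¹ 1ℚ) (0≤sq t)

  -- The rational parametrisation ((1 - t²) / (1 + t²) , 2t / (1 + t²)) of the circle.
  module Point (t : ℚ) where
    private instance
      nz : ℚ.NonZero (1ℚ + t * t)
      nz = ℚ.>-nonZero (0<1+t² t)

    w : ℚ
    w = 1/ (1ℚ + t * t)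

    -- Since (1 - t²) / (1 + t²) = 2w - 1, both coordinates are polynomials in t and w, and `w-inv`
    -- is the only relation that the solver has to be given.
    c s : ℚ
    c = (w + w) - 1ℚ
    s = (t + t) * w

    w-inv : w * (1ℚ + t * t) ≡ 1ℚ
    w-inv = ℚ.*-inverseˡ (1ℚ + t * t)

    0<w : 0ℚ < w
    0<w = ℚ.positive⁻¹ w ⦃ ℚ.1/pos⇒pos (1ℚ + t * t) ⦃ ℚ.positive (0<1+t² t) ⦄ ⦄

    0≤w : 0ℚ ≤ w
    0≤w = ℚ.<⇒≤ 0<w

    1-w : w + t * t * w ≡ 1ℚ
    1-w = trans (solve 2 (λ w t → w :+ t :* t :* w := w :* (con 1ℚ :+ t :* t)) refl w t) w-inv

    w≤1 : w ≤ 1ℚ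
    w≤1 = ≤-by (t * t * w) (0≤* (0≤sq t) 0≤w) 1-w

    unit : c * c + s * s ≡ 1ℚ
    unit = trans
      (solve 2 (λ w t → ((w :+ w) :- con 1ℚ) :* ((w :+ w) :- con 1ℚ) :+ ((t :+ t) :* w) :* ((t :+ t) :* w)
         := con 1ℚ :+ (w :+ w :+ w :+ w) :* (w :* (con 1ℚ :+ t :* t) :- con 1ℚ)) refl w t)
      (trans (cong (λ x → 1ℚ + (w + w + w + w) * (x - 1ℚ)) w-inv)
        (solve 1 (λ w → con 1ℚ :+ (w :+ w :+ w :+ w) :* (con 1ℚ :- con 1ℚ) := con 1ℚ) refl w))

    open Powers c s public
    open Unit unit public

    ∣re∣≤1 : ∀ j → ∣ re j ∣ ≤ 1ℚ
    ∣re∣≤1 j = ∣fst∣≤1 {re j} {im j} (norm j)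

    ∣im∣≤1 : ∀ j → ∣ im j ∣ ≤ 1ℚ
    ∣im∣≤1 j = ∣snd∣≤1 {re j} {im j} (norm j)

    re≤1 : ∀ j → re j ≤ 1ℚ
    re≤1 j = ℚ.≤-trans (p≤∣p∣ (re j)) (∣re∣≤1 j)

    im≤1 : ∀ j → im j ≤ 1ℚ
    im≤1 j = ℚ.≤-trans (p≤∣p∣ (im j)) (∣im∣≤1 j)

    ∣c∣≤1 : ∣ c ∣ ≤ 1ℚ
    ∣c∣≤1 = ∣fst∣≤1 {c} {s} unit

    ∣s∣≤1 : ∣ s ∣ ≤ 1ℚ
    ∣s∣≤1 = ∣snd∣≤1 {c} {s} unit

    ∣w∣≤1 : ∣ w ∣ ≤ 1ℚ
    ∣w∣≤1 = subst (_≤ 1ℚ) (sym (ℚ.0≤p⇒∣p∣≡p 0≤w)) w≤1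

    module Bounded (0≤t : 0ℚ ≤ t) (t≤1 : t ≤ 1ℚ) where
      1≤w+w : 1ℚ ≤ w + w
      1≤w+w = ≤-by ((1ℚ - t * t) * w)
        (0≤* (0≤- (ℚ.≤-trans (≤1-*≤ 0≤t t≤1) t≤1)) 0≤w)
        (trans (cong (_+ (1ℚ - t * t) * w) (sym 1-w))
          (solve 2 (λ w t → (w :+ t :* t :* w) :+ (con 1ℚ :- t :* t) :* w := w :+ w) refl w t))

      0≤c : 0ℚ ≤ c
      0≤c = 0≤- 1≤w+w

      0≤s : 0ℚ ≤ s
      0≤s = 0≤* (0≤+ 0≤t 0≤t) 0≤w

      t≤s : t ≤ s
      t≤s = subst₂ _≤_ (ℚ.*-identityʳ t)
        (solve 2 (λ t w → t :* (w :+ w) := (t :+ t) :* w) refl t w) (*-monoˡ t 0≤t 1≤w+w)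

      s≤2t : s ≤ t + t
      s≤2t = ≤1-*≤ (0≤+ 0≤t 0≤t) w≤1

      1-2t≤c : 1ℚ ≤ c + (t + t)
      1-2t≤c = ≤-by (e + e) (0≤+ 0≤e 0≤e) (trans (cong (λ x → x + (e + e)) (sym 1-w)) (trans
          (solve 2 (λ w t → (w :+ t :* t :* w) :+ ((t :- t :* t :* w) :+ (t :- t :* t :* w))
               := ((w :+ w) :- (w :+ t :* t :* w)) :+ (t :+ t)) refl w t)
          (cong (λ x → ((w + w) - x) + (t + t)) 1-w)))
        where
        e = t - t * t * w
        0≤e : 0ℚ ≤ e
        0≤e = 0≤- (ℚ.≤-trans (≤1-*≤ (0≤sq t) w≤1) (≤1-*≤ 0≤t t≤1))

      ∣t∣≤1 : ∣ t ∣ ≤ 1ℚ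
      ∣t∣≤1 = subst (_≤ 1ℚ) (sym (ℚ.0≤p⇒∣p∣≡p 0≤t)) t≤1

  six : ℚ → ℚ
  six δ = ((δ + δ) + δ) + ((δ + δ) + δ)

  -- Each coordinate of z^(j+1) is a sum of two products of factors of absolute value at most 1; a
  -- product contributes 6 for c or s and `lipschitz j` for the power. The exponential growth is
  -- harmless, as j stays below a fixed bound while t converges.
  lipschitz : ℕ → ℚ
  lipschitz zero    = 0ℚ
  lipschitz (suc j) = (six 1ℚ + lipschitz j) + (six 1ℚ + lipschitz j)

  0≤six1 : 0ℚ ≤ six 1ℚ
  0≤six1 = ℚ.<⇒≤ (ℚ.positive⁻¹ (six 1ℚ))

  0≤lipschitz : ∀ j → 0ℚ ≤ lipschitz j
  0≤lipschitz zero    = ℚ.≤-refl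
  0≤lipschitz (suc j) = 0≤+ h h
    where
    h : 0ℚ ≤ six 1ℚ + lipschitz j
    h = 0≤+ 0≤six1 (0≤lipschitz j)

  lipschitz-mono-suc : ∀ j → lipschitz j ≤ lipschitz (suc j)
  lipschitz-mono-suc j = ≤-by ((six 1ℚ + six 1ℚ) + lipschitz j)
    (0≤+ (0≤+ 0≤six1 0≤six1) (0≤lipschitz j))
    (solve 2 (λ x y → y :+ ((x :+ x) :+ y) := (x :+ y) :+ (x :+ y)) refl (six 1ℚ) (lipschitz j))

  lipschitz-mono : ∀ {j k} → j ℕ.≤ k → lipschitz j ≤ lipschitz k
  lipschitz-mono {j} j≤k = go (ℕ.≤⇒≤′ j≤k)
    where
    go : ∀ {k} → j ℕ.≤′ k → lipschitz j ≤ lipschitz k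
    go         ℕ.≤′-refl      = ℚ.≤-refl
    go {suc k} (ℕ.≤′-step le) = ℚ.≤-trans (go le) (lipschitz-mono-suc k)

  module Continuity {t u : ℚ} (0≤t : 0ℚ ≤ t) (t≤1 : t ≤ 1ℚ) (0≤u : 0ℚ ≤ u) (u≤1 : u ≤ 1ℚ) where
    private
      module T = Point t
      module U = Point u
      module UB = U.Bounded 0≤u u≤1
      δ = ∣ t - u ∣
      0≤δ : 0ℚ ≤ δ
      0≤δ = ℚ.0≤∣p∣ (t - u)

    w-diff : T.w - U.w ≡ (T.w * U.w) * ((u - t) * (u + t))
    w-diff = begin
      T.w - U.w
        ≡⟨ cong₂ _-_ (sym (ℚ.*-identityʳ T.w)) (sym (ℚ.*-identityʳ U.w)) ⟩
      T.w * 1ℚ - U.w * 1ℚ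
        ≡⟨ cong₂ (λ x y → T.w * x - U.w * y) (sym U.w-inv) (sym T.w-inv) ⟩
      T.w * (U.w * (1ℚ + u * u)) - U.w * (T.w * (1ℚ + t * t))
        ≡⟨ solve 4 (λ a b t u → a :* (b :* (con 1ℚ :+ u :* u)) :- b :* (a :* (con 1ℚ :+ t :* t))
             := (a :* b) :* ((u :- t) :* (u :+ t))) refl T.w U.w t u ⟩
      (T.w * U.w) * ((u - t) * (u + t)) ∎
      where
      open ≡-Reasoning

    w-close : ∣ T.w - U.w ∣ ≤ δ + δ
    w-close = subst₂ _≤_
      (sym (trans (cong ∣_∣ w-diff) (trans (ℚ.∣p*q∣≡∣p∣*∣q∣ (T.w * U.w) ((u - t) * (u + t)))
        (cong₂ _*_ (ℚ.0≤p⇒∣p∣≡p (0≤* T.0≤w U.0≤w)) (trans (ℚ.∣p*q∣≡∣p∣*∣q∣ (u - t) (u + t))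
          (cong₂ _*_ (trans (sym (ℚ.∣-p∣≡∣p∣ (u - t)))
              (cong ∣_∣ (solve 2 (λ u t → :- (u :- t) := t :- u) refl u t)))
            (ℚ.0≤p⇒∣p∣≡p (0≤+ 0≤u 0≤t))))))))
      (solve 1 (λ d → con 1ℚ :* (d :* (con 1ℚ :+ con 1ℚ)) := d :+ d) refl δ)
      (0≤-mono-* (0≤* T.0≤w U.0≤w) (0≤* 0≤δ (0≤+ 0≤1 0≤1))
        (ℚ.≤-trans (≤1-*≤ T.0≤w U.w≤1) T.w≤1)
        (*-monoˡ δ 0≤δ (ℚ.+-mono-≤ u≤1 t≤1)))

    tw-close : ∣ t * T.w - u * U.w ∣ ≤ δ + (δ + δ)
    tw-close = product-close {t} {u} {T.w} {U.w} T.∣w∣≤1 UB.∣t∣≤1 ℚ.≤-refl w-close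

    c-close : ∣ T.c - U.c ∣ ≤ six δ
    c-close = subst (λ x → ∣ x ∣ ≤ six δ)
      (solve 2 (λ a b → (a :+ a) :- (b :+ b) := ((a :+ a) :- con 1ℚ) :- ((b :+ b) :- con 1ℚ)) refl T.w U.w)
      (ℚ.≤-trans (sum-close {T.w} {U.w} {T.w} {U.w} w-close w-close)
        (≤-by (δ + δ) (0≤+ 0≤δ 0≤δ)
          (solve 1 (λ d → ((d :+ d) :+ (d :+ d)) :+ (d :+ d) := ((d :+ d) :+ d) :+ ((d :+ d) :+ d)) refl δ)))

    s-close : ∣ T.s - U.s ∣ ≤ six δ
    s-close = subst₂ (λ x y → ∣ x ∣ ≤ y)
      (solve 4 (λ a b t u → (t :* a :+ t :* a) :- (u :* b :+ u :* b) := (t :+ t) :* a :- (u :+ u) :* b)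
        refl T.w U.w t u)
      (solve 1 (λ d → (d :+ (d :+ d)) :+ (d :+ (d :+ d)) := ((d :+ d) :+ d) :+ ((d :+ d) :+ d)) refl δ)
      (sum-close {t * T.w} {u * U.w} {t * T.w} {u * U.w} tw-close tw-close)

    re-close : ∀ j → ∣ T.re j - U.re j ∣ ≤ lipschitz j * δ
    im-close : ∀ j → ∣ T.im j - U.im j ∣ ≤ lipschitz j * δ
    private
      combine : ∀ j → (six δ + lipschitz j * δ) + (six δ + lipschitz j * δ) ≡ lipschitz (suc j) * δ
      combine j = solve 2 (λ d l →
        let x = ((d :+ d) :+ d) :+ ((d :+ d) :+ d)
            y = ((con 1ℚ :+ con 1ℚ) :+ con 1ℚ) :+ ((con 1ℚ :+ con 1ℚ) :+ con 1ℚ)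
        in (x :+ l :* d) :+ (x :+ l :* d) := ((y :+ l) :+ (y :+ l)) :* d) refl δ (lipschitz j)
    re-close zero    = subst (λ x → ∣ x ∣ ≤ 0ℚ * δ) (sym (ℚ.+-inverseʳ 1ℚ))
      (ℚ.≤-reflexive (sym (ℚ.*-zeroˡ δ)))
    re-close (suc j) = subst (λ x → ∣ T.re (suc j) - U.re (suc j) ∣ ≤ x) (combine j) (sum-close
      {T.c * T.re j} {U.c * U.re j} { - (T.s * T.im j)} { - (U.s * U.im j)}
      (product-close {T.c} {U.c} {T.re j} {U.re j} (T.∣re∣≤1 j) U.∣c∣≤1 c-close (re-close j))
      (neg-close {T.s * T.im j} {U.s * U.im j}
        (product-close {T.s} {U.s} {T.im j} {U.im j} (T.∣im∣≤1 j) U.∣s∣≤1 s-close (im-close j))))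
    im-close zero    = subst (λ x → ∣ x ∣ ≤ 0ℚ * δ) (sym (ℚ.+-inverseʳ 0ℚ))
      (ℚ.≤-reflexive (sym (ℚ.*-zeroˡ δ)))
    im-close (suc j) = subst (λ x → ∣ T.im (suc j) - U.im (suc j) ∣ ≤ x) (combine j) (sum-close
      {T.c * T.im j} {U.c * U.im j} {T.s * T.re j} {U.s * U.re j}
      (product-close {T.c} {U.c} {T.im j} {U.im j} (T.∣im∣≤1 j) U.∣c∣≤1 c-close (im-close j))
      (product-close {T.s} {U.s} {T.re j} {U.re j} (T.∣re∣≤1 j) U.∣s∣≤1 s-close (re-close j)))

  step-inverse : ∀ k → step k * fromℕ (suc k) ≡ 1ℚ
  step-inverse k = ℚ.*-inverseˡ (fromℕ (suc k))

  ≤step : ∀ {d} k → d * fromℕ (suc k) ≤ 1ℚ → d ≤ step k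
  ≤step {d} k h = subst₂ _≤_
    (trans (ℚ.*-assoc d (fromℕ (suc k)) (step k))
      (trans (cong (d *_) (trans (ℚ.*-comm (fromℕ (suc k)) (step k)) (step-inverse k))) (ℚ.*-identityʳ d)))
    (ℚ.*-identityˡ (step k))
    (*-monoʳ (step k) (ℚ.<⇒≤ (0<step k)) h)

  scaleDown : ∀ K e → 0ℚ ≤ K → 0ℚ < e → ∃[ d ] 0ℚ < d × K * d ≤ e
  scaleDown K e 0≤K 0<e = e * i , 0<* 0<e 0<i , ≤-by (e * i)
      (ℚ.<⇒≤ (0<* 0<e 0<i)) (trans
        (solve 3 (λ K e i → K :* (e :* i) :+ e :* i := e :* (i :* (K :+ con 1ℚ))) refl K e i)
        (trans (cong (e *_) (ℚ.*-inverseˡ (K + 1ℚ))) (ℚ.*-identityʳ e)))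
    where
    0<K+1 : 0ℚ < K + 1ℚ
    0<K+1 = ℚ.+-mono-≤-< 0≤K (ℚ.positive⁻¹ 1ℚ)
    instance
      pos = ℚ.positive 0<K+1
      nz  = ℚ.pos⇒nonZero (K + 1ℚ)
    i = 1/ (K + 1ℚ)
    0<i : 0ℚ < i
    0<i = ℚ.positive⁻¹ i ⦃ ℚ.1/pos⇒pos (K + 1ℚ) ⦄

  -- The parameter tan (π / 2ℓ) is located by bisection: it is the largest t for which the
  -- powers z , … , z^ℓ of the corresponding point z all lie in the closed upper half plane.
  module Bisection (ℓ : ℕ) (3≤ℓ : 3 ℕ.≤ ℓ) where

    abstract
      -- The value 1/(4ℓ+1) makes ℓ steps of size 4t₀ stay within 1. It serves both as the lower end
      -- of the bisection and as a bound, the same at every stage, that keeps the powers strictly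
      -- between 0 and ℓ away from the real axis.
      t₀ : ℚ
      t₀ = step (4 ℕ.* ℓ)

      0<t₀ : 0ℚ < t₀
      0<t₀ = 0<step (4 ℕ.* ℓ)

      4ℓt₀≤1 : ∀ {m} → m ℕ.≤ suc (4 ℕ.* ℓ) → t₀ * fromℕ m ≤ 1ℚ
      4ℓt₀≤1 {m} m≤ = subst (step (4 ℕ.* ℓ) * fromℕ m ≤_) (step-inverse (4 ℕ.* ℓ))
        (*-monoˡ (step (4 ℕ.* ℓ)) (ℚ.<⇒≤ (0<step (4 ℕ.* ℓ))) (fromℕ-mono m≤))

    d₀ : ℚ
    d₀ = (t₀ + t₀) + (t₀ + t₀)

    0≤t₀ : 0ℚ ≤ t₀
    0≤t₀ = ℚ.<⇒≤ 0<t₀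

    t₀≤1 : t₀ ≤ 1ℚ
    t₀≤1 = subst (_≤ 1ℚ) (ℚ.*-identityʳ t₀) (4ℓt₀≤1 {1} (s≤s z≤n))

    ℓd₀≤1 : ∀ {j} → j ℕ.≤ ℓ → fromℕ j * d₀ ≤ 1ℚ
    ℓd₀≤1 {j} j≤ℓ = subst (_≤ 1ℚ)
      (trans (cong (t₀ *_) (fromℕ-* 4 j))
        (solve 2 (λ t j → t :* (con (fromℕ 4) :* j) := j :* ((t :+ t) :+ (t :+ t))) refl t₀ (fromℕ j)))
      (4ℓt₀≤1 (ℕ.≤-trans (ℕ.*-monoʳ-≤ 4 j≤ℓ) (ℕ.n≤1+n _)))

    module Start where
      open Point t₀
      open Bounded 0≤t₀ t₀≤1

      -- As 1 - c and s are at most 2t₀, multiplication by z lowers the real part by at most d₀ =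
      -- 4t₀. So it stays nonnegative up to ℓ, and then c * im j + s * re j is nonnegative too.
      start : ∀ j → j ℕ.≤ ℓ → 1ℚ ≤ re j + fromℕ j * d₀ × 0ℚ ≤ im j
      start zero    _    = ℚ.≤-reflexive (sym (trans (cong (1ℚ +_) (ℚ.*-zeroˡ d₀)) (ℚ.+-identityʳ 1ℚ))) , ℚ.≤-refl
      start (suc j) j<ℓ = ≤-by ((re j + fromℕ j * d₀ - 1ℚ) + ((1-c * (1ℚ - re j)) + (s * (1ℚ - im j)
            + ((t₀ + t₀ - s) + (c + (t₀ + t₀) - 1ℚ)))))
          (0≤+ (0≤- (proj₁ IH)) (0≤+ (0≤* 0≤1-c (0≤- (re≤1 j))) (0≤+ (0≤* 0≤s (0≤- (im≤1 j)))
            (0≤+ (0≤- s≤2t) (0≤- 1-2t≤c)))))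
          (trans (solve 6 (λ c s t a b n →
              con 1ℚ :+ ((a :+ n :* ((t :+ t) :+ (t :+ t)) :- con 1ℚ)
                :+ (((con 1ℚ :- c) :* (con 1ℚ :- a)) :+ (s :* (con 1ℚ :- b)
                :+ ((t :+ t :- s) :+ (c :+ (t :+ t) :- con 1ℚ)))))
              := (c :* a :- s :* b) :+ (n :+ con 1ℚ) :* ((t :+ t) :+ (t :+ t)))
              refl c s t₀ (re j) (im j) (fromℕ j))
            (cong (λ n → (c * re j - s * im j) + n * d₀) (sym (fromℕ-suc j))))
        , 0≤+ (0≤* 0≤c (proj₂ IH)) (0≤* 0≤s 0≤re)
        where
        IH = start j (ℕ.<⇒≤ j<ℓ)
        1-c = 1ℚ - c
        0≤1-c : 0ℚ ≤ 1-c
        0≤1-c = 0≤- (ℚ.≤-trans (p≤∣p∣ c) ∣c∣≤1)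
        0≤re : 0ℚ ≤ re j
        0≤re = subst (0ℚ ≤_)
          (solve 2 (λ a x → (con 1ℚ :- x) :+ (a :+ x :- con 1ℚ) := a) refl (re j) (fromℕ j * d₀))
          (0≤+ (0≤- (ℓd₀≤1 (ℕ.<⇒≤ j<ℓ))) (0≤- (proj₁ IH)))

    -- Finite conditions on rationals, so every midpoint can be classified. Which power crosses is
    -- left open here; `im-upper` shows that near the limit it is z^ℓ.
    Upper Crossing : ℚ → Set
    Upper t    = ∀ j → j ℕ.≤ ℓ → 0ℚ ≤ Point.im t j
    Crossing t = ∃[ j ] j ℕ.≤ ℓ × Point.im t j < 0ℚ

    crossing? : ∀ t j → Dec (Point.im t j < 0ℚ)
    crossing? t j = Point.im t j ℚ.<? 0ℚ

    upper? : ∀ t → Upper t ⊎ Crossing t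
    upper? t = decide (ℕ.anyUpTo? (crossing? t) (suc ℓ))
      where
      decide : Dec (∃[ j ] j ℕ.< suc ℓ × Point.im t j < 0ℚ) → Upper t ⊎ Crossing t
      decide (yes (j , s≤s j≤ℓ , h)) = inj₂ (j , j≤ℓ , h)
      decide (no ¬h) = inj₁ λ j j≤ℓ → ℚ.≮⇒≥ λ h → ¬h (j , s≤s j≤ℓ , h)

    record Bracket (k : ℕ) : Set where
      field
        lo hi : ℚ
        t₀≤lo : t₀ ≤ lo
        lo≤hi : lo ≤ hi
        hi≤1  : hi ≤ 1ℚ
        -- The width is at most 1/(k+1), weaker than 2^(-k) but equal to `step k`; halving preserves
        -- it because k + 2 ≤ 2 (k + 1).
        short : (hi - lo) * fromℕ (suc k) ≤ 1ℚ
        below : Upper lo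
        above : Crossing hi

      hi≤lo+ : hi ≤ lo + step k
      hi≤lo+ = subst (_≤ lo + step k) (solve 2 (λ h l → l :+ (h :- l) := h) refl hi lo)
        (ℚ.+-monoʳ-≤ lo (≤step k short))
    open Bracket

    0≤½ : 0ℚ ≤ ½
    0≤½ = ℚ.<⇒≤ (ℚ.positive⁻¹ ½)

    halved : ∀ {d} k → 0ℚ ≤ d → d * fromℕ (suc k) ≤ 1ℚ → (d * ½) * fromℕ (suc (suc k)) ≤ 1ℚ
    halved {d} k 0≤d h = ℚ.≤-trans (*-monoˡ (d * ½) (0≤* 0≤d 0≤½)
        (fromℕ-mono (s≤s (ℕ.≤-trans (ℕ.≤-reflexive (ℕ.+-comm 1 k)) (ℕ.+-monoʳ-≤ k (s≤s z≤n))))))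
      (subst (_≤ 1ℚ) (sym (trans (cong (d * ½ *_) (fromℕ-* 2 (suc k)))
        (solve 2 (λ d n → (d :* con ½) :* (con (fromℕ 2) :* n) := d :* n) refl d (fromℕ (suc k))))) h)

    next : ∀ {k} (b : Bracket k) → Σ[ b′ ∈ Bracket (suc k) ] lo b ≤ lo b′ × hi b′ ≤ hi b
    next {k} b = go (upper? mid)
      where
      h = hi b - lo b
      mid = lo b + h * ½
      0≤h : 0ℚ ≤ h
      0≤h = 0≤- (lo≤hi b)
      lo≤mid : lo b ≤ mid
      lo≤mid = ≤-by (h * ½) (0≤* 0≤h 0≤½) refl
      mid+ : mid + h * ½ ≡ hi b
      mid+ = trans (ℚ.+-assoc (lo b) (h * ½) (h * ½)) (trans (cong (lo b +_) (½-split h))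
        (solve 2 (λ h l → l :+ (h :- l) := h) refl (hi b) (lo b)))
      mid≤hi : mid ≤ hi b
      mid≤hi = ≤-by (h * ½) (0≤* 0≤h 0≤½) mid+
      go : Upper mid ⊎ Crossing mid → Σ[ b′ ∈ Bracket (suc k) ] lo b ≤ lo b′ × hi b′ ≤ hi b
      go (inj₁ u) = record
        { lo = mid ; hi = hi b ; t₀≤lo = ℚ.≤-trans (t₀≤lo b) lo≤mid ; lo≤hi = mid≤hi
        ; hi≤1 = hi≤1 b ; below = u ; above = above b
        ; short = subst (λ x → x * fromℕ (suc (suc k)) ≤ 1ℚ)
            (trans (solve 2 (λ m x → x := (m :+ x) :- m) refl mid (h * ½)) (cong (_- mid) mid+))
            (halved k 0≤h (short b)) }
        , lo≤mid , ℚ.≤-refl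
      go (inj₂ c) = record
        { lo = lo b ; hi = mid ; t₀≤lo = t₀≤lo b ; lo≤hi = lo≤mid
        ; hi≤1 = ℚ.≤-trans mid≤hi (hi≤1 b) ; below = below b ; above = c
        ; short = subst (λ x → x * fromℕ (suc (suc k)) ≤ 1ℚ)
            (solve 2 (λ l x → x := (l :+ x) :- l) refl (lo b) (h * ½))
            (halved k 0≤h (short b)) }
        , ℚ.≤-refl , mid≤hi

    bracket : ∀ k → Bracket k
    bracket zero = record
      { lo = t₀ ; hi = 1ℚ ; t₀≤lo = ℚ.≤-refl ; lo≤hi = t₀≤1 ; hi≤1 = ℚ.≤-refl
      ; short = subst (_≤ 1ℚ) (sym (ℚ.*-identityʳ (1ℚ - t₀)))
          (≤-by t₀ 0≤t₀ (solve 1 (λ t → (con 1ℚ :- t) :+ t := con 1ℚ) refl t₀))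
      ; below = λ j j≤ℓ → proj₂ (Start.start j j≤ℓ)
      -- The parameter 1 is the point i, and i³ = -i lies below the axis; hence the condition 3 ≤ ℓ.
      ; above = 3 , 3≤ℓ , toWitness {a? = Point.im 1ℚ 3 ℚ.<? 0ℚ} _ }
    bracket (suc k) = proj₁ (next (bracket k))

    t : ℕ → ℚ
    t k = lo (bracket k)

    nested : ∀ {k m} → k ℕ.≤ m → t k ≤ t m × hi (bracket m) ≤ hi (bracket k)
    nested {k} k≤m = go (ℕ.≤⇒≤′ k≤m)
      where
      go : ∀ {m} → k ℕ.≤′ m → t k ≤ t m × hi (bracket m) ≤ hi (bracket k)
      go         ℕ.≤′-refl      = ℚ.≤-refl , ℚ.≤-refl
      go {suc m} (ℕ.≤′-step le) =
        let (l , h) = go le ; (l′ , h′) = proj₂ (next (bracket m))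
        in ℚ.≤-trans l l′ , ℚ.≤-trans h′ h

    t-cauchy : ∀ {k m n} → k ℕ.≤ m → k ℕ.≤ n → ∣ t m - t n ∣ ≤ step k
    t-cauchy {k} k≤m k≤n = ≤⇒near (close k≤m k≤n) (close k≤n k≤m)
      where
      close : ∀ {m n} → k ℕ.≤ m → k ℕ.≤ n → t m ≤ t n + step k
      close {m} {n} k≤m k≤n = ℚ.≤-trans (lo≤hi (bracket m)) (ℚ.≤-trans (proj₂ (nested k≤m))
        (ℚ.≤-trans (hi≤lo+ (bracket k)) (ℚ.+-monoˡ-≤ (step k) (proj₁ (nested k≤n)))))

    0≤t : ∀ k → 0ℚ ≤ t k
    0≤t k = ℚ.≤-trans 0≤t₀ (t₀≤lo (bracket k))

    t≤1 : ∀ k → t k ≤ 1ℚ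
    t≤1 k = ℚ.≤-trans (lo≤hi (bracket k)) (hi≤1 (bracket k))

    re im : ℕ → ℕ → ℚ
    re k = Point.re (t k)
    im k = Point.im (t k)

    0≤im : ∀ k j → j ℕ.≤ ℓ → 0ℚ ≤ im k j
    0≤im k = below (bracket k)

    private
      module At (k : ℕ) where
        open Point (t k) using (c; s; norm; im-pred; unit) public
        open Point.Bounded (t k) (0≤t k) (t≤1 k) public

      t₀≤s : ∀ k → t₀ ≤ At.s k
      t₀≤s k = ℚ.≤-trans (t₀≤lo (bracket k)) (At.t≤s k)

    -- As z^(j-1) and z^(j+1) lie in the upper half plane, 0 ≤ (ic - rs)(ic + rs) = i² - s².
    im-lower : ∀ k j → 0 ℕ.< j → j ℕ.< ℓ → t₀ ≤ im k j
    im-lower k (suc j) _ j<ℓ = ℚ.≤-trans (t₀≤s k) (ℚ.≮⇒≥ λ i<s →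
        ℚ.<-irrefl refl (ℚ.<-≤-trans (ℚ.≤-<-trans
          (*-monoˡ i (0≤im k (suc j) (ℕ.<⇒≤ j<ℓ)) (ℚ.<⇒≤ i<s))
          (ℚ.*-monoˡ-<-pos s ⦃ ℚ.positive (ℚ.<-≤-trans 0<t₀ (t₀≤s k)) ⦄ i<s)) s²≤i²))
      where
      open At k
      i = im k (suc j)
      r = re k (suc j)
      s²≤i² : s * s ≤ i * i
      s²≤i² = ≤-by ((c * i - s * r) * (c * i + s * r))
        (0≤* (subst (0ℚ ≤_) (im-pred j) (0≤im k j (ℕ.<⇒≤ (ℕ.<⇒≤ j<ℓ)))) (0≤im k (suc (suc j)) j<ℓ))
        (trans (solve 4 (λ c s i r → s :* s :+ (c :* i :- s :* r) :* (c :* i :+ s :* r)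
             := s :* s :* (con 1ℚ :- (r :* r :+ i :* i)) :+ (c :* c :+ s :* s) :* (i :* i)) refl c s i r)
          (trans (cong₂ (λ x y → s * s * (1ℚ - x) + y * (i * i)) (norm (suc j)) unit)
            (solve 2 (λ s i → s :* s :* (con 1ℚ :- con 1ℚ) :+ con 1ℚ :* (i :* i) := i :* i) refl s i)))

    μ : ℕ → ℚ
    μ k = lipschitz ℓ * step k

    -- Some power z^j is below the axis at `hi`, so by continuity its imaginary part at `lo` is at
    -- most μ. For 0 < j < ℓ that part is at least t₀ > μ, which leaves only j = ℓ.
    im-upper : ∀ k → μ k < t₀ → im k ℓ ≤ μ k
    im-upper k μ<t₀ = go (above (bracket k))
      where
      b = bracket k
      go : Crossing (hi b) → im k ℓ ≤ μ k
      go (zero  , _   , im<0) = contradiction im<0 (ℚ.<-irrefl refl)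
      go (suc j , j≤ℓ , im<0) = go′ (ℕ.m≤n⇒m<n∨m≡n j≤ℓ)
        where
        close : im k (suc j) ≤ μ k
        close = ℚ.≤-trans (near⇒≤ (Continuity.im-close (0≤t k) (t≤1 k)
                  (ℚ.≤-trans (0≤t k) (lo≤hi b)) (hi≤1 b) (suc j)))
          (subst (Point.im (hi b) (suc j) + lipschitz (suc j) * ∣ t k - hi b ∣ ≤_) (ℚ.+-identityˡ (μ k)) (ℚ.+-mono-≤ (ℚ.<⇒≤ im<0)
            (0≤-mono-* (0≤lipschitz (suc j)) (ℚ.<⇒≤ (0<step k)) (lipschitz-mono j≤ℓ)
              (≤⇒near {t k} {hi b} (ℚ.≤-trans (lo≤hi b) (≤-by (step k) (ℚ.<⇒≤ (0<step k)) refl)) (hi≤lo+ b)))))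
        go′ : suc j ℕ.< ℓ ⊎ suc j ≡ ℓ → im k ℓ ≤ μ k
        go′ (inj₂ j≡ℓ) = subst (λ m → im k m ≤ μ k) j≡ℓ close
        go′ (inj₁ j<ℓ) = contradiction
          (ℚ.<-≤-trans μ<t₀ (ℚ.≤-trans (im-lower k (suc j) (s≤s z≤n) j<ℓ) close)) (ℚ.<-irrefl refl)

    -- Write z^ℓ = r + i·y. As z^(ℓ-1) is in the upper half plane, s * r ≤ c * y ≤ μ ≤ s/2, so r ≤
    -- 1/2 and z^ℓ is not near 1. Then (1 + r)(1 - r) = y² ≤ μ with 1 - r ≥ 1/2 places it near -1.
    re-upper : ∀ k → μ k ≤ t₀ * ½ → re k ℓ ≤ - 1ℚ + (μ k + μ k)
    re-upper k μ≤ = go ℓ refl 3≤ℓ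
      where
      open At k
      go : ∀ j → ℓ ≡ j → 3 ℕ.≤ j → re k ℓ ≤ - 1ℚ + (μ k + μ k)
      go (suc j) ℓ≡ _ = ≤-by (e + e) (0≤+ 0≤e 0≤e)
          (solve 2 (λ r m → r :+ ((m :- (con 1ℚ :+ r) :* con ½) :+ (m :- (con 1ℚ :+ r) :* con ½))
                         := :- con 1ℚ :+ (m :+ m)) refl r (μ k))
        where
        r = re k ℓ
        i = im k ℓ
        i≤μ : i ≤ μ k
        i≤μ = im-upper k (ℚ.≤-<-trans μ≤ (subst (t₀ * ½ <_) (½-split t₀)
          (subst (_< t₀ * ½ + t₀ * ½) (ℚ.+-identityʳ (t₀ * ½))
            (ℚ.+-monoʳ-< (t₀ * ½) (0<½* 0<t₀)))))
        sr≤ci : s * r ≤ c * i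
        sr≤ci = ≤-by (c * i - s * r)
          (subst (λ m → 0ℚ ≤ c * im k m - s * re k m) (sym ℓ≡)
            (subst (0ℚ ≤_) (im-pred j) (0≤im k j (ℕ.≤-trans (ℕ.n≤1+n j) (ℕ.≤-reflexive (sym ℓ≡))))))
          (solve 2 (λ x y → x :+ (y :- x) := y) refl (s * r) (c * i))
        0≤i : 0ℚ ≤ i
        0≤i = 0≤im k ℓ ℕ.≤-refl
        ci≤i : c * i ≤ i
        ci≤i = subst (_≤ i) (ℚ.*-comm i c) (≤1-*≤ 0≤i (ℚ.≤-trans (p≤∣p∣ c) (Point.∣c∣≤1 (t k))))
        r≤½ : r ≤ ½
        r≤½ = ℚ.≮⇒≥ λ ½<r → ℚ.<-irrefl refl (ℚ.<-≤-trans
          (ℚ.*-monoʳ-<-pos s ⦃ ℚ.positive (ℚ.<-≤-trans 0<t₀ (t₀≤s k)) ⦄ ½<r)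
          (ℚ.≤-trans sr≤ci (ℚ.≤-trans ci≤i (ℚ.≤-trans i≤μ (ℚ.≤-trans μ≤
            (*-monoʳ ½ 0≤½ (t₀≤s k)))))))
        0≤1+r : 0ℚ ≤ 1ℚ + r
        0≤1+r = subst (0ℚ ≤_) (solve 1 (λ r → con 1ℚ :- (:- r) := con 1ℚ :+ r) refl r)
          (0≤- { - r} (ℚ.≤-trans (p≤∣p∣ (- r)) (subst (_≤ 1ℚ) (sym (ℚ.∣-p∣≡∣p∣ r)) (Point.∣re∣≤1 (t k) ℓ))))
        e = μ k - (1ℚ + r) * ½
        0≤e : 0ℚ ≤ e
        0≤e = 0≤- (ℚ.≤-trans
          (*-monoˡ (1ℚ + r) 0≤1+r
            (≤-by (½ - r) (0≤- r≤½) (solve 1 (λ r → con ½ :+ (con ½ :- r) := con 1ℚ :- r) refl r)))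
          (ℚ.≤-trans (ℚ.≤-reflexive (trans
            (solve 2 (λ r i → (con 1ℚ :+ r) :* (con 1ℚ :- r) := (con 1ℚ :- (r :* r :+ i :* i)) :+ i :* i) refl r i)
            (trans (cong (λ x → (1ℚ - x) + i * i) (norm ℓ)) (ℚ.+-identityˡ (i * i)))))
          (ℚ.≤-trans (≤1-*≤ 0≤i (Point.im≤1 (t k) ℓ)) i≤μ)))

  -- Limits of rational sequences and the roots of unity.

  Eventually : (ℕ → Set) → Set
  Eventually P = ∃[ N ] (∀ n → N ℕ.≤ n → P n)

  ev-map : ∀ {P Q : ℕ → Set} → (∀ n → P n → Q n) → Eventually P → Eventually Q
  ev-map f (N , h) = N , λ n n≥N → f n (h n n≥N)

  ev-× : ∀ {P Q : ℕ → Set} → Eventually P → Eventually Q → Eventually (λ n → P n × Q n)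
  ev-× (M , f) (N , g) = M ℕ.⊔ N , λ n n≥ →
    f n (ℕ.m⊔n≤o⇒m≤o M N n≥) , g n (ℕ.m⊔n≤o⇒n≤o M N n≥)

  ev-⊥ : ∀ {P : ℕ → Set} → Eventually P → (∀ n → ¬ P n) → ∀ {a} {A : Set a} → A
  ev-⊥ (N , h) ¬P = contradiction (h N ℕ.≤-refl) (¬P N)

  infix 4 _∼_
  record _∼_ (f g : ℕ → ℚ) : Set where
    constructor limit
    field
      closeTo : ∀ e → 0ℚ < e → Eventually (λ n → ∣ f n - g n ∣ ≤ e)
  open _∼_

  ≗⇒∼ : ∀ {f g} → (∀ n → f n ≡ g n) → f ∼ g
  ≗⇒∼ {f} {g} h = limit λ e 0<e → 0 , λ n _ → subst (λ x → ∣ x ∣ ≤ e)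
    (sym (trans (cong (_- g n) (h n)) (ℚ.+-inverseʳ (g n)))) (ℚ.<⇒≤ 0<e)

  ∼-sym : ∀ {f g} → f ∼ g → g ∼ f
  ∼-sym {f} {g} h = limit λ e 0<e → ev-map (λ n → subst (_≤ e) (swap n)) (closeTo h e 0<e)
    where
    swap : ∀ n → ∣ f n - g n ∣ ≡ ∣ g n - f n ∣
    swap n = trans (sym (ℚ.∣-p∣≡∣p∣ (f n - g n)))
      (cong ∣_∣ (solve 2 (λ x y → :- (x :- y) := y :- x) refl (f n) (g n)))

  ∼-trans : ∀ {f g h} → f ∼ g → g ∼ h → f ∼ h
  ∼-trans {f} {g} {h} fg gh = limit λ e 0<e → ev-map
    (λ n (p , q) → subst₂ (λ x y → ∣ x ∣ ≤ y)
      (solve 3 (λ a b c → (a :+ b) :- (b :+ c) := a :- c) refl (f n) (g n) (h n)) (½-split e)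
      (sum-close {f n} {g n} {g n} {h n} p q))
    (ev-× (closeTo fg (e * ½) (0<½* 0<e)) (closeTo gh (e * ½) (0<½* 0<e)))

  ∼-+ : ∀ {f f′ g g′} → f ∼ f′ → g ∼ g′ → (λ n → f n + g n) ∼ (λ n → f′ n + g′ n)
  ∼-+ {f} {f′} {g} {g′} p q = limit λ e 0<e → ev-map
    (λ n (x , y) → subst (∣ (f n + g n) - (f′ n + g′ n) ∣ ≤_) (½-split e)
      (sum-close {f n} {f′ n} {g n} {g′ n} x y))
    (ev-× (closeTo p (e * ½) (0<½* 0<e)) (closeTo q (e * ½) (0<½* 0<e)))

  ∼-neg : ∀ {f g} → f ∼ g → (λ n → - f n) ∼ (λ n → - g n)
  ∼-neg {f} {g} h = limit λ e 0<e → ev-map (λ n → neg-close {f n} {g n}) (closeTo h e 0<e)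

  ∼-* : ∀ {f f′ g g′} → (∀ n → ∣ g n ∣ ≤ 1ℚ) → (∀ n → ∣ f′ n ∣ ≤ 1ℚ) →
        f ∼ f′ → g ∼ g′ → (λ n → f n * g n) ∼ (λ n → f′ n * g′ n)
  ∼-* {f} {f′} {g} {g′} bg bf′ p q = limit λ e 0<e → ev-map
    (λ n (x , y) → subst (∣ f n * g n - f′ n * g′ n ∣ ≤_) (½-split e)
      (product-close {f n} {f′ n} {g n} {g′ n} (bg n) (bf′ n) x y))
    (ev-× (closeTo p (e * ½) (0<½* 0<e)) (closeTo q (e * ½) (0<½* 0<e)))

  0<sqrtApprox+step : ∀ n q → 0ℚ < sqrtApprox n q + step n
  0<sqrtApprox+step n q = ℚ.+-mono-≤-<
    (rootBelow-nonneg q (step n) (ℤ.∣ ℚ.numerator q ∣ ℕ.* suc n) (ℚ.<⇒≤ (0<step n))) (0<step n)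

  sqrtApprox≤1 : ∀ n {q} → q ≤ 1ℚ → sqrtApprox n q ≤ 1ℚ
  sqrtApprox≤1 n {q} q≤1 with rootBelow-lower q (step n) (ℤ.∣ ℚ.numerator q ∣ ℕ.* suc n)
  ... | inj₁ e = subst (_≤ 1ℚ) (sym e) 0≤1
  ... | inj₂ h = square-cancel-≤ (ℚ.positive⁻¹ 1ℚ) (ℚ.≤-trans h q≤1)

  ¼ ⅛ e₀ : ℚ
  ¼  = ½ * ½
  ⅛  = ¼ * ½
  e₀ = ⅛ * ¼

  module RootOfUnity (ℓ N : ℕ) (3≤ℓ : 3 ℕ.≤ ℓ) (N≡ : N ≡ ℓ ℕ.+ ℓ) where
    open Bisection ℓ 3≤ℓ
    open Modular N

    ∣re∣≤1 : ∀ a n → ∣ re n a ∣ ≤ 1ℚ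
    ∣re∣≤1 a n = Point.∣re∣≤1 (t n) a

    ∣im∣≤1 : ∀ a n → ∣ im n a ∣ ≤ 1ℚ
    ∣im∣≤1 a n = Point.∣im∣≤1 (t n) a

    power : ∀ (f : ℚ → ℚ) K → 0ℚ ≤ K → (∀ m n → ∣ f (t m) - f (t n) ∣ ≤ K * ∣ t m - t n ∣) → ℝ
    power f K 0≤K lip = mkℝ (λ k → f (t k)) λ e 0<e →
      let (d , 0<d , Kd≤e) = scaleDown K e 0≤K 0<e
          (M , s) = step-small d 0<d
      in M , λ m n m≥ n≥ → ℚ.≤-trans (lip m n) (ℚ.≤-trans
        (*-monoˡ K 0≤K (ℚ.≤-trans (t-cauchy m≥ n≥) (s M ℕ.≤-refl))) Kd≤e)

    -- E a is e^(2πia/N).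
    E : ℕ → ℂ
    E a = power (λ x → Point.re x a) (lipschitz a) (0≤lipschitz a)
            (λ m n → Continuity.re-close (0≤t m) (t≤1 m) (0≤t n) (t≤1 n) a)
       +i power (λ x → Point.im x a) (lipschitz a) (0≤lipschitz a)
            (λ m n → Continuity.im-close (0≤t m) (t≤1 m) (0≤t n) (t≤1 n) a)

    infix 4 _≈ᴱ_
    record _≈ᴱ_ (a b : ℕ) : Set where
      constructor _,ᴱ_
      field
        re-∼ : (λ n → re n a) ∼ (λ n → re n b)
        im-∼ : (λ n → im n a) ∼ (λ n → im n b)
    open _≈ᴱ_

    ≃ᶜ⇒≈ᴱ : ∀ {a b} → E a ≃ᶜ E b → a ≈ᴱ b
    ≃ᶜ⇒≈ᴱ (r , i) = limit r ,ᴱ limit i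

    E-trans : ∀ {a b c} → a ≈ᴱ b → b ≈ᴱ c → a ≈ᴱ c
    E-trans (p ,ᴱ q) (p′ ,ᴱ q′) = ∼-trans p p′ ,ᴱ ∼-trans q q′

    E-sym : ∀ {a b} → a ≈ᴱ b → b ≈ᴱ a
    E-sym (p ,ᴱ q) = ∼-sym p ,ᴱ ∼-sym q

    E-reflexive : ∀ {a b} → a ≡ b → a ≈ᴱ b
    E-reflexive {a} refl = ≗⇒∼ (λ _ → refl) ,ᴱ ≗⇒∼ (λ _ → refl)

    re-homo : ∀ a b → (λ n → re n (a ℕ.+ b)) ∼ (λ n → re n a * re n b + - (im n a * im n b))
    re-homo a b = ≗⇒∼ (λ n → Point.re-+ (t n) a b)

    im-homo : ∀ a b → (λ n → im n (a ℕ.+ b)) ∼ (λ n → re n a * im n b + im n a * re n b)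
    im-homo a b = ≗⇒∼ (λ n → Point.im-+ (t n) a b)

    E-+ : ∀ {a a′ b b′} → a ≈ᴱ a′ → b ≈ᴱ b′ → (a ℕ.+ b) ≈ᴱ (a′ ℕ.+ b′)
    E-+ {a} {a′} {b} {b′} (ra ,ᴱ ia) (rb ,ᴱ ib) =
      ∼-trans (re-homo a b) (∼-trans
        (∼-+ (∼-* (∣re∣≤1 b) (∣re∣≤1 a′) ra rb) (∼-neg (∼-* (∣im∣≤1 b) (∣im∣≤1 a′) ia ib)))
        (∼-sym (re-homo a′ b′))) ,ᴱ
      ∼-trans (im-homo a b) (∼-trans
        (∼-+ (∼-* (∣im∣≤1 b) (∣re∣≤1 a′) ra ib) (∼-* (∣re∣≤1 b) (∣im∣≤1 a′) ia rb))
        (∼-sym (im-homo a′ b′)))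

    μ-small : ∀ e → 0ℚ < e → Eventually (λ n → μ n ≤ e)
    μ-small e 0<e =
      let (d , 0<d , Kd≤e) = scaleDown (lipschitz ℓ) e (0≤lipschitz ℓ) 0<e
      in ev-map (λ n h → ℚ.≤-trans (*-monoˡ (lipschitz ℓ) (0≤lipschitz ℓ) h) Kd≤e) (step-small d 0<d)

    half<t₀ : t₀ * ½ < t₀
    half<t₀ = subst₂ _<_ (ℚ.+-identityʳ (t₀ * ½)) (½-split t₀)
      (ℚ.+-monoʳ-< (t₀ * ½) (0<½* 0<t₀))

    half-turn : ∀ e → 0ℚ < e → Eventually (λ n → im n ℓ ≤ e × re n ℓ ≤ - 1ℚ + e)
    half-turn e 0<e = ev-map
      (λ n (p , q) → ℚ.≤-trans (im-upper n (ℚ.≤-<-trans p half<t₀)) (ℚ.≤-trans q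
          (subst (e * ½ ≤_) (½-split e) (≤-by (e * ½) (ℚ.<⇒≤ (0<½* 0<e)) refl))) ,
        ℚ.≤-trans (re-upper n p) (ℚ.+-monoʳ-≤ (- 1ℚ)
          (subst (μ n + μ n ≤_) (½-split e) (ℚ.+-mono-≤ q q))))
      (ev-× (μ-small (t₀ * ½) (0<½* 0<t₀)) (μ-small (e * ½) (0<½* 0<e)))

    -1≤re : ∀ n a → - 1ℚ ≤ re n a
    -1≤re n a = subst (- 1ℚ ≤_) (solve 1 (λ x → :- (:- x) := x) refl (re n a))
      (ℚ.neg-antimono-≤ (ℚ.≤-trans (p≤∣p∣ (- re n a)) (subst (_≤ 1ℚ) (sym (ℚ.∣-p∣≡∣p∣ (re n a))) (∣re∣≤1 a n))))

    re-half : (λ n → re n ℓ) ∼ (λ _ → - 1ℚ)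
    re-half = limit λ e 0<e → ev-map (λ n (_ , h) → ≤⇒near h
      (ℚ.≤-trans (-1≤re n ℓ) (≤-by e (ℚ.<⇒≤ 0<e) refl))) (half-turn e 0<e)

    im-half : (λ n → im n ℓ) ∼ (λ _ → 0ℚ)
    im-half = limit λ e 0<e → ev-map (λ n (h , _) → ≤⇒near (subst (im n ℓ ≤_) (sym (ℚ.+-identityˡ e)) h)
      (0≤+ (0≤im n ℓ ℕ.≤-refl) (ℚ.<⇒≤ 0<e))) (half-turn e 0<e)

    E-N : N ≈ᴱ 0
    E-N = E-trans (E-reflexive N≡)
      ( ∼-trans (re-homo ℓ ℓ) (∼-trans
          (∼-+ (∼-* (∣re∣≤1 ℓ) bound re-half re-half) (∼-neg (∼-* (∣im∣≤1 ℓ) bound₀ im-half im-half)))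
          (≗⇒∼ λ _ → refl))
      ,ᴱ ∼-trans (im-homo ℓ ℓ) (∼-trans
          (∼-+ (∼-* (∣im∣≤1 ℓ) bound re-half im-half) (∼-* (∣re∣≤1 ℓ) bound₀ im-half re-half))
          (≗⇒∼ λ _ → refl)))
      where
      bound : ∀ (n : ℕ) → ∣ - 1ℚ ∣ ≤ 1ℚ
      bound _ = ℚ.≤-refl
      bound₀ : ∀ (n : ℕ) → ∣ 0ℚ ∣ ≤ 1ℚ
      bound₀ _ = 0≤1

    E-*N : ∀ u → u ℕ.* N ≈ᴱ 0
    E-*N zero    = E-reflexive refl
    E-*N (suc u) = E-+ E-N (E-*N u)

    E-shift : ∀ a u → a ℕ.+ u ℕ.* N ≈ᴱ a
    E-shift a u = E-trans (E-+ (E-reflexive refl) (E-*N u)) (E-reflexive (ℕ.+-identityʳ a))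

    E-cong : ∀ {a b} → a ≋ b → a ≈ᴱ b
    E-cong {a} {b} (shift u v eq) =
      E-trans (E-trans (E-sym (E-shift a u)) (E-reflexive eq)) (E-shift b v)

    E-respects : ∀ {a b} → a ≋ b → E a ≃ᶜ E b
    E-respects h = closeTo (re-∼ (E-cong h)) , closeTo (im-∼ (E-cong h))

    E-homo : ∀ {a b c} → c ≋ a ℕ.+ b → E c ≃ᶜ (E a *ᶜ E b)
    E-homo {a} {b} h = closeTo (∼-trans (re-∼ (E-cong h)) (re-homo a b)) ,
                       closeTo (∼-trans (im-∼ (E-cong h)) (im-homo a b))

    0<ℓ : 0 ℕ.< ℓ
    0<ℓ = ℕ.<-≤-trans (s≤s z≤n) 3≤ℓ

    0<N : 0 ℕ.< N
    0<N = subst (0 ℕ.<_) (sym N≡) (ℕ.<-≤-trans 0<ℓ (ℕ.m≤m+n ℓ ℓ))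

    -- Adding (N - 1) * a to both exponents cancels a modulo N.
    E-difference : ∀ d a → a ≈ᴱ d ℕ.+ a → d ≈ᴱ 0
    E-difference d a h = E-trans
        (E-cong {d} {d ℕ.+ a ℕ.+ c} (shift a 0 (trans (eq d a) (sym (ℕ.+-identityʳ _)))))
      (E-trans (E-sym (E-+ h (E-reflexive {c} refl)))
        (E-cong {a ℕ.+ c} {0} (shift 0 a (trans (ℕ.+-identityʳ _) (sym (eq 0 a))))))
      where
      c = ℕ.pred N ℕ.* a
      eq : ∀ d a → d ℕ.+ a ℕ.* N ≡ d ℕ.+ a ℕ.+ ℕ.pred N ℕ.* a
      eq d a = trans (cong (λ M → d ℕ.+ a ℕ.* M) (sym (ℕ.suc-pred N ⦃ ℕ.>-nonZero 0<N ⦄)))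
        (ring d a (ℕ.pred N))
        where
        ring : ∀ d a p → d ℕ.+ a ℕ.* suc p ≡ d ℕ.+ a ℕ.+ p ℕ.* a
        ring = solve-∀

    -- Strictly before the half turn the imaginary part stays above t₀; at the half turn the value
    -- is -1. Larger exponents reduce to these by d ↦ N - d.
    E-nontrivial≤ : ∀ d → 0 ℕ.< d → d ℕ.≤ ℓ → ¬ (d ≈ᴱ 0)
    E-nontrivial≤ d 0<d d≤ℓ (r ,ᴱ i) with ℕ.m≤n⇒m<n∨m≡n d≤ℓ
    ... | inj₁ d<ℓ = ev-⊥ (closeTo i (t₀ * ½) (0<½* 0<t₀)) λ n h →
      ℚ.<-irrefl refl (ℚ.<-≤-trans half<t₀ (ℚ.≤-trans (im-lower n d 0<d d<ℓ)
        (subst (im n d ≤_) (ℚ.+-identityˡ (t₀ * ½)) (near⇒≤ {im n d} {0ℚ} h))))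
    ... | inj₂ refl = ev-⊥ (closeTo (∼-trans (∼-sym re-half) r) 1ℚ (ℚ.positive⁻¹ 1ℚ)) λ n →
      toWitnessFalse {a? = ∣ - 1ℚ - 1ℚ ∣ ℚ.≤? 1ℚ} _

    E-nontrivial : ∀ d → 0 ℕ.< d → d ℕ.< N → ¬ (d ≈ᴱ 0)
    E-nontrivial d 0<d d<N h with d ℕ.≤? ℓ
    ... | yes d≤ℓ = E-nontrivial≤ d 0<d d≤ℓ h
    ... | no d≰ℓ = E-nontrivial≤ (N ℕ.∸ d) (ℕ.m<n⇒0<n∸m d<N)
      (ℕ.≤-trans (ℕ.∸-mono (ℕ.≤-reflexive N≡) (ℕ.<⇒≤ (ℕ.≰⇒> d≰ℓ))) (ℕ.≤-reflexive (ℕ.m+n∸n≡m ℓ ℓ)))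
      (E-difference (N ℕ.∸ d) d
        (E-trans h (E-trans (E-sym E-N) (E-reflexive (sym (ℕ.m∸n+n≡m (ℕ.<⇒≤ d<N)))))))

    E-injective< : ∀ {a b} → a ℕ.< b → b ℕ.< N → ¬ (a ≈ᴱ b)
    E-injective< {a} {b} a<b b<N h = E-nontrivial (b ℕ.∸ a) (ℕ.m<n⇒0<n∸m a<b)
      (ℕ.≤-<-trans (ℕ.m∸n≤m b a) b<N)
      (E-difference (b ℕ.∸ a) a (E-trans h (E-reflexive (sym (ℕ.m∸n+n≡m (ℕ.<⇒≤ a<b))))))

    E-injective : ∀ {a b} → E a ≃ᶜ E b → a ≋ b
    E-injective {a} {b} same = decide (ℕ.<-cmp (a % N) (b % N))
      where
      instance
        N≢0 : ℕ.NonZero N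
        N≢0 = ℕ.>-nonZero 0<N
      reduced : a % N ≈ᴱ b % N
      reduced = E-trans (E-cong (≋-% a)) (E-trans (≃ᶜ⇒≈ᴱ same) (E-sym (E-cong (≋-% b))))
      decide : Tri (a % N ℕ.< b % N) (a % N ≡ b % N) (b % N ℕ.< a % N) → a ≋ b
      decide (tri≈ _ a≡b _) = ≋-trans (≋-sym (≋-% a)) (≋-trans (≋-reflexive a≡b) (≋-% b))
      decide (tri< a<b _ _) = contradiction reduced (E-injective< a<b (ℕ.m%n<n b N))
      decide (tri> _ _ b<a) = contradiction (E-sym reduced) (E-injective< b<a (ℕ.m%n<n a N))

    E-unit : ∀ a → modulus (E a) D.≃ 1ℝ
    E-unit a e 0<e = ev-map (λ n h → subst (λ q → ∣ sqrtApprox n q - 1ℚ ∣ ≤ e) (sym (Point.norm (t n) a))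
      (≤⇒near (ℚ.≤-trans (sqrtApprox≤1 n ℚ.≤-refl) (≤-by e (ℚ.<⇒≤ 0<e) refl))
        (ℚ.≤-trans (square-cancel-≤ (0<sqrtApprox+step n 1ℚ) (sqrtApprox-upper n 1ℚ)) (ℚ.+-monoʳ-≤ (sqrtApprox n 1ℚ) h)))) (step-small e 0<e)

    chord : ℕ → ℕ → ℚ
    chord n a = (re n a + - 1ℚ) * (re n a + - 1ℚ) + (im n a + - 0ℚ) * (im n a + - 0ℚ)

    chord≡ : ∀ n a → chord n a ≡ (1ℚ + 1ℚ) - (re n a + re n a)
    chord≡ n a = trans
      (solve 2 (λ r i → (r :+ :- con 1ℚ) :* (r :+ :- con 1ℚ) :+ (i :+ :- con 0ℚ) :* (i :+ :- con 0ℚ)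
        := (r :* r :+ i :* i) :+ (con 1ℚ :- (r :+ r))) refl (re n a) (im n a))
      (trans (cong (_+ (1ℚ - (re n a + re n a))) (Point.norm (t n) a))
        (solve 1 (λ r → con 1ℚ :+ (con 1ℚ :- (r :+ r)) := (con 1ℚ :+ con 1ℚ) :- (r :+ r)) refl (re n a)))

    E-near : ∀ {b} → b ≋ 0 → modulus (E b -ᶜ 1ℂ) D.≤ 1ℝ
    E-near {b} b≋0 e 0<e = ev-map
      (λ n h → ℚ.≤-trans
        (sqrtApprox≤1 n {chord n b} (subst (_≤ 1ℚ) (sym (chord≡ n b)) (small n (near⇒≤ {1ℚ} {re n b} h))))
        (≤-by e (ℚ.<⇒≤ 0<e) refl))
      (closeTo (∼-sym (re-∼ (E-cong b≋0))) ½ (ℚ.positive⁻¹ ½))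
      where
      small : ∀ n → 1ℚ ≤ re n b + ½ → (1ℚ + 1ℚ) - (re n b + re n b) ≤ 1ℚ
      small n h = ≤-by (x + x) (0≤+ (0≤- h) (0≤- h))
        (solve 1 (λ r → ((con 1ℚ :+ con 1ℚ) :- (r :+ r)) :+ ((r :+ con ½ :- con 1ℚ) :+ (r :+ con ½ :- con 1ℚ))
          := con 1ℚ) refl (re n b))
        where
        x : ℚ
        x = re n b + ½ - 1ℚ

    -- For ℓ/2 ≤ a < ℓ the point z^2a lies in the lower half plane while z^a lies in the upper one.
    re-quarter : ∀ a → N ℕ.≤ 4 ℕ.* a → 2 ℕ.* a ℕ.≤ N → Eventually (λ n → re n a ≤ ¼)
    re-quarter a N≤4a 2a≤N with ℕ.m≤n⇒m<n∨m≡n a≤ℓ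
      where
      a≤ℓ : a ℕ.≤ ℓ
      a≤ℓ = ℕ.*-cancelˡ-≤ 2 (ℕ.≤-trans 2a≤N (ℕ.≤-reflexive (trans N≡ (cong (ℓ ℕ.+_) (sym (ℕ.+-identityʳ ℓ))))))
    ... | inj₂ refl = ev-map (λ n (_ , h) → ℚ.≤-trans h (ℚ.≤-trans (ℚ.≤-reflexive (ℚ.+-inverseˡ 1ℚ))
            (ℚ.<⇒≤ (ℚ.positive⁻¹ ¼)))) (half-turn 1ℚ (ℚ.positive⁻¹ 1ℚ))
    ... | inj₁ a<ℓ = ev-map quarter (ev-× (half-turn (t₀ * ¼) (0<* 0<t₀ (ℚ.positive⁻¹ ¼)))
                                          (half-turn 1ℚ (ℚ.positive⁻¹ 1ℚ)))
      where
      d = a ℕ.+ a ℕ.∸ ℓ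
      ℓ≤2a : ℓ ℕ.≤ a ℕ.+ a
      ℓ≤2a = ℕ.*-cancelˡ-≤ 2 (ℕ.≤-trans (ℕ.≤-reflexive (trans (cong (ℓ ℕ.+_) (ℕ.+-identityʳ ℓ)) (sym N≡)))
        (ℕ.≤-trans N≤4a (ℕ.≤-reflexive (ring a))))
        where
        ring : ∀ a → 4 ℕ.* a ≡ 2 ℕ.* (a ℕ.+ a)
        ring = solve-∀
      0<a : 0 ℕ.< a
      0<a = ℕ.n≢0⇒n>0 λ { refl → ℕ.<-irrefl refl (ℕ.<-≤-trans 0<ℓ ℓ≤2a) }
      2a≡ : ℓ ℕ.+ d ≡ a ℕ.+ a
      2a≡ = ℕ.m+[n∸m]≡n ℓ≤2a
      d≤ℓ : d ℕ.≤ ℓ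
      d≤ℓ = ℕ.≤-trans (ℕ.∸-monoˡ-≤ ℓ (ℕ.+-mono-≤ (ℕ.<⇒≤ a<ℓ) (ℕ.<⇒≤ a<ℓ))) (ℕ.≤-reflexive (ℕ.m+n∸n≡m ℓ ℓ))

      quarter : ∀ n → (im n ℓ ≤ t₀ * ¼ × re n ℓ ≤ - 1ℚ + t₀ * ¼) × (im n ℓ ≤ 1ℚ × re n ℓ ≤ - 1ℚ + 1ℚ) →
                re n a ≤ ¼
      -- A real part above 1/4 would make the imaginary part 2 * re * im of z^(2a) at least t₀/2.
      -- But 2a = ℓ + d, where re n ℓ ≤ 0 and im n ℓ ≤ t₀/4, so it is at most t₀/4.
      quarter n ((im≤ , _) , (_ , re≤0)) = ℚ.≮⇒≥ λ ¼<r → ℚ.<-irrefl refl (ℚ.<-≤-trans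
        (subst (_< t₀ * ¼ + t₀ * ¼) (ℚ.+-identityʳ (t₀ * ¼))
          (ℚ.+-monoʳ-< (t₀ * ¼) (0<* 0<t₀ (ℚ.positive⁻¹ ¼))))
        (ℚ.≤-trans (ℚ.+-mono-≤ (big ¼<r) (big ¼<r)) (ℚ.≤-trans (ℚ.≤-reflexive
          (trans (solve 2 (λ i r → i :* r :+ i :* r := r :* i :+ i :* r) refl (im n a) (re n a))
            (sym (Point.im-+ (t n) a a)))) small)))
        where
        big : ¼ < re n a → t₀ * ¼ ≤ im n a * re n a
        big ¼<r = 0≤-mono-* 0≤t₀ (ℚ.≤-trans (ℚ.<⇒≤ (ℚ.positive⁻¹ ¼)) (ℚ.<⇒≤ ¼<r))
          (im-lower n a 0<a a<ℓ) (ℚ.<⇒≤ ¼<r)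
        small : im n (a ℕ.+ a) ≤ t₀ * ¼
        small = ℚ.≤-trans (ℚ.≤-reflexive (trans (cong (im n) (sym 2a≡)) (Point.im-+ (t n) ℓ d)))
          (ℚ.≤-trans (ℚ.+-mono-≤
            (ℚ.≤-trans (*-monoʳ (im n d) (0≤im n d d≤ℓ) re≤0) (ℚ.≤-reflexive (ℚ.*-zeroˡ (im n d))))
            (≤1-*≤ (0≤im n ℓ ℕ.≤-refl) (Point.re≤1 (t n) d)))
          (ℚ.≤-trans (ℚ.≤-reflexive (ℚ.+-identityˡ (im n ℓ))) im≤))

    E-far : ∀ {a b} → b ≋ a → N ℕ.≤ 4 ℕ.* a → 2 ℕ.* a ℕ.≤ N → ¬ (modulus (E b -ᶜ 1ℂ) D.≤ 1ℝ)
    E-far {a} {b} b≋a N≤4a 2a≤N near = ev-⊥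
      (ev-× (ev-× (re-quarter a N≤4a 2a≤N) (closeTo (re-∼ (E-cong b≋a)) ⅛ (ℚ.positive⁻¹ ⅛)))
            (ev-× (near e₀ (ℚ.positive⁻¹ e₀)) (step-small e₀ (ℚ.positive⁻¹ e₀))))
      λ n ((r≤ , close) , (m≤ , s≤)) → too-short n
        (ℚ.≤-trans (near⇒≤ close) (ℚ.+-monoˡ-≤ ⅛ r≤)) (ℚ.+-mono-≤ m≤ s≤)
      where
      -- The squared chord is at least 2 - 2 * 3/8 = 5/4, while (1 + 1/16)² = 289/256 is smaller.
      -- One e₀ = 1/32 is the tolerance in the comparison of reals, the other the error of the
      -- approximate root.
      too-short : ∀ n → re n b ≤ ¼ + ⅛ → sqrtApprox n (chord n b) + step n ≤ (1ℚ + e₀) + e₀ → ⊥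
      too-short n r≤ y≤ = toWitnessFalse
        {a? = (1ℚ + 1ℚ) - ((¼ + ⅛) + (¼ + ⅛)) ℚ.≤? ((1ℚ + e₀) + e₀) * ((1ℚ + e₀) + e₀)} _
        (ℚ.≤-trans (ℚ.+-monoʳ-≤ (1ℚ + 1ℚ) (ℚ.neg-antimono-≤ (ℚ.+-mono-≤ r≤ r≤)))
        (ℚ.≤-trans (ℚ.≤-reflexive (sym (chord≡ n b)))
        (ℚ.≤-trans (sqrtApprox-upper n (chord n b))
          (0≤-mono-* 0≤y (ℚ.≤-trans 0≤y y≤) y≤ y≤))))
        where
        0≤y : 0ℚ ≤ sqrtApprox n (chord n b) + step n
        0≤y = ℚ.<⇒≤ (0<sqrtApprox+step n (chord n b))

  -- E a stands for e^(2πia/N); only these properties of the roots of unity are used.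
  record RootsOfUnity (N : ℕ) : Set where
    open Modular N
    field
      E           : ℕ → ℂ
      E-respects  : ∀ {a b} → a ≋ b → E a ≃ᶜ E b
      E-trivial   : ∀ {a} → a ≋ 0 → E a ≃ᶜ 1ℂ
      E-homo      : ∀ {a b c} → c ≋ a ℕ.+ b → E c ≃ᶜ (E a *ᶜ E b)
      E-injective : ∀ {a b} → E a ≃ᶜ E b → a ≋ b
      E-unit      : ∀ a → modulus (E a) D.≃ 1ℝ
      E-near      : ∀ {a} → a ≋ 0 → modulus (E a -ᶜ 1ℂ) D.≤ 1ℝ
      E-far       : ∀ {a b} → b ≋ a → N ℕ.≤ 4 ℕ.* a → 2 ℕ.* a ℕ.≤ N → ¬ (modulus (E b -ᶜ 1ℂ) D.≤ 1ℝ)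

  rootsOfUnity : ∀ n → 0 ℕ.< n → RootsOfUnity (n ℕ.* 6)
  rootsOfUnity n 0<n = record
    { E           = E
    ; E-respects  = λ {a} {b} → E-respects {a} {b}
    ; E-trivial   = λ {a} → E-respects {a} {0}
    ; E-homo      = λ {a} {b} {c} → E-homo {a} {b} {c}
    ; E-injective = λ {a} {b} → E-injective {a} {b}
    ; E-unit      = E-unit
    ; E-near      = λ {a} → E-near {a}
    ; E-far       = λ {a} {b} → E-far {a} {b}
    }
    where
    double : ∀ n → n ℕ.* 6 ≡ n ℕ.* 3 ℕ.+ n ℕ.* 3
    double = solve-∀
    open RootOfUnity (n ℕ.* 3) (n ℕ.* 6) (ℕ.*-monoˡ-≤ 3 0<n) (double n)

-- From subgroups to Bohr sets.

module BohrSets where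
  open import Data.Nat using (_*_; _≤_; _<_; _%_)
  open import Defs using (FiniteAbelianGroup; Subset; Character; BohrSet; Stable; card;
    _∩_; _∖_; _-ˢ_; InBohr; _≈ᵡ_; 1ℝ; 1ℂ; _≃ᶜ_; _-ᶜ_; modulus)
  open FiniteGroups
  open UnitCircle using (RootsOfUnity; rootsOfUnity; 0≤+; 0≤1; ≤-by)

  length-filter-tabulate : ∀ {a p} {A : Set a} {P : Pred A p} (P? : Decidable P) {n} (f : Fin n → A) →
    length (filter P? (tabulate f)) ≡ count (λ i → does (P? (f i)))
  length-filter-tabulate P? {zero}  f = refl
  length-filter-tabulate P? {suc n} f with does (P? (f zero))
  ... | true  = cong suc (length-filter-tabulate P? (f ∘ suc))
  ... | false = length-filter-tabulate P? (f ∘ suc)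

  module Transport {c ℓ} (G : FiniteAbelianGroup c ℓ) where
    private
      module AG = FiniteAbelianGroup G
    open AG using (_≈_; _∙_; ε; _⁻¹; enumeration) renaming (order to n)
    open Inverse enumeration using (to; from; to-cong; from-cong; strictlyInverseˡ; strictlyInverseʳ)

    private
      from-to : ∀ x → from (to x) ≈ x
      from-to = strictlyInverseʳ

      to-from : ∀ i → to (from i) ≡ i
      to-from = strictlyInverseˡ

    infixl 20 _⊕_
    _⊕_ : Fin n → Fin n → Fin n
    i ⊕ j = to (from i ∙ from j)

    ⊖_ : Fin n → Fin n
    ⊖ i = to (from i ⁻¹)

    to-∙ : ∀ x y → to (x ∙ y) ≡ to x ⊕ to y
    to-∙ x y = to-cong (AG.sym (AG.∙-cong (from-to x) (from-to y)))

    isAbelianGroup′ : IsAbelianGroup _≡_ _⊕_ (to ε) ⊖_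
    isAbelianGroup′ = record
      { isGroup = record
        { isMonoid = record
          { isSemigroup = record
            { isMagma = record { isEquivalence = isEquivalence ; ∙-cong = cong₂ _⊕_ }
            ; assoc = λ i j k → to-cong (AG.trans (AG.∙-congʳ (from-to _))
                (AG.trans (AG.assoc _ _ _) (AG.∙-congˡ (AG.sym (from-to _))))) }
          ; identity = (λ i → trans (to-cong (AG.trans (AG.∙-congʳ (from-to _)) (AG.identityˡ _))) (to-from i))
                     , (λ i → trans (to-cong (AG.trans (AG.∙-congˡ (from-to _)) (AG.identityʳ _))) (to-from i)) }
        ; inverse = (λ i → to-cong (AG.trans (AG.∙-congʳ (from-to _)) (AG.inverseˡ _)))
                  , (λ i → to-cong (AG.trans (AG.∙-congˡ (from-to _)) (AG.inverseʳ _)))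
        ; ⁻¹-cong = cong ⊖_ }
      ; comm = λ i j → to-cong (AG.comm _ _) }

    card≡count : ∀ {p} (S : Subset G p) → card S ≡ count (λ i → does (Subset.member? S (from i)))
    card≡count S = trans (cong (length ∘ filter (Subset.member? S)) (map-tabulate id from))
      (length-filter-tabulate (Subset.member? S) from)

    module _ {p} (A : Subset G p) where
      open Subset A

      A′ : Fin n → Bool
      A′ i = does (member? (from i))

      A′-∙ : ∀ x y → does (member? (x ∙ y)) ≡ A′ (to x ⊕ to y)
      A′-∙ x y = does-⇔ (mk⇔ (respects (AG.trans (AG.sym (from-to _)) (from-cong (to-∙ x y))))
                             (respects (AG.trans (from-cong (sym (to-∙ x y))) (from-to _))))
                   (member? (x ∙ y)) (member? (from (to x ⊕ to y)))

      stable′ : ∀ k → Stable k A →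
        ¬ (Σ[ a ∈ (Fin k → Fin n) ] Σ[ b ∈ (Fin k → Fin n) ] ∀ i j →
            (i Fin.≤ j → A′ (a i ⊕ b j) ≡ true) × (¬ (i Fin.≤ j) → A′ (a i ⊕ b j) ≡ false))
      stable′ k stable (a , b , h) = stable (from ∘ a , from ∘ b , λ i j → mk⇔
        (λ m → decidable-stable (i Fin.≤? j) λ ≰ →
          fromDoes¬ (member? (from (a i ⊕ b j))) (proj₂ (h i j) ≰) (respects (AG.sym (from-to _)) m))
        (λ le → respects (from-to _) (fromDoes (member? (from (a i ⊕ b j))) (proj₁ (h i j) le))))

    open FinGroup isAbelianGroup′ using (IsSubgroup; RegularSubgroup; //-rightDividesˡ)
    open Duality isAbelianGroup′ using (module Extension; module Cosets)

    private
      0<n : 0 < n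
      0<n = ℕ.≤-<-trans z≤n (Fin.toℕ<n (to ε))

    -- The factor 6 makes N even with N / 2 = 3n at least 3, as the bisection requires.
    open Extension 6 (s≤s z≤n) using (N; Hom; separate)
    open Modular N

    private instance
      N≢0 : ℕ.NonZero N
      N≢0 = ℕ.m*n≢0 n 6 ⦃ ℕ.>-nonZero 0<n ⦄

    module Annihilator (roots : RootsOfUnity N) (H : Fin n → Bool) (isSubgroup : IsSubgroup H) where
      open RootsOfUnity roots
      open Hom
      open Cosets H isSubgroup
      open IsSubgroup isSubgroup

      character : Hom H → Character G
      character χ = record
        { ⟦_⟧ = λ x → E (φ χ (to x))
        ; isMonoidHomomorphism = record
          { isMagmaHomomorphism = record
            { isRelHomomorphism = record { cong = λ x≈y → E-respects (≋-reflexive (cong (φ χ) (to-cong x≈y))) }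
            ; homo = λ x y → E-homo (≋-trans (≋-reflexive (cong (φ χ) (to-∙ x y))) (homo χ (to x) (to y))) }
          ; ε-homo = E-trivial (kills χ ε∈) }
        ; unit-modulus = λ x → E-unit (φ χ (to x)) }

      -- Equality of characters is a statement about reals and is not decided. Duplicates are
      -- removed among exponents modulo N instead, and `E-injective` carries distinctness over to
      -- the characters.
      homs : DecSetoid 0ℓ 0ℓ
      homs = record
        { Carrier = Hom H
        ; _≈_ = λ χ ψ → ∀ i → φ χ i % N ≡ φ ψ i % N
        ; isDecEquivalence = record
          { isEquivalence = record
            { refl = λ _ → refl ; sym = λ h → sym ∘ h ; trans = λ h h′ i → trans (h i) (h′ i) }
          ; _≟_ = λ χ ψ → Fin.all? (λ i → φ χ i % N ℕ.≟ φ ψ i % N) } }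
      open DecSetoid homs using () renaming (_≈_ to _≈ʰ_; _≟_ to _≟ʰ_)

      character-injective : ∀ χ ψ → character χ ≈ᵡ character ψ → χ ≈ʰ ψ
      character-injective χ ψ same i =
        ≋⇒%≡ (E-injective (subst (λ j → E (φ χ j) ≃ᶜ E (φ ψ j)) (to-from i) (same (from i))))

      Separates : Fin n → Hom H → Set
      Separates x χ = ∃[ a ] φ χ x ≋ a × N ≤ 4 * a × 2 * a ≤ N

      separates-resp : ∀ {x χ ψ} → χ ≈ʰ ψ → Separates x χ → Separates x ψ
      separates-resp {x} {χ} {ψ} χ≈ψ (a , eq , bounds) =
        a , ≋-trans (≋-sym (≋-% (φ ψ x))) (≋-trans (≋-reflexive (sym (χ≈ψ x)))
              (≋-trans (≋-% (φ χ x)) eq)) , bounds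

      separates-coset : ∀ {x r χ} → x ~ r → Separates r χ → Separates x χ
      separates-coset {x} {r} {χ} x~r (a , eq , bounds) =
        a , ≋-trans (≋-reflexive (cong (φ χ) (sym (//-rightDividesˡ r x))))
              (≋-trans (homo χ (x ⊕ (⊖ r)) r) (≋-+ (kills χ x~r) eq)) , bounds

      -- The coset `H` itself gets no separator. The value of `H r` is an index, so that later case
      -- splits come with the equation.
      addSeparator : ∀ r {b} → H r ≡ b → List (Hom H) → List (Hom H)
      addSeparator r {true}  _  χs = χs
      addSeparator r {false} Hr χs = proj₁ (separate isSubgroup r Hr) ∷ χs

      separators : List (Fin n) → List (Hom H)
      separators []       = []
      separators (r ∷ rs) = addSeparator r refl (separators rs)

      length-addSeparator : ∀ r {b} (Hr : H r ≡ b) χs → length (addSeparator r Hr χs) ≤ suc (length χs)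
      length-addSeparator r {true}  Hr χs = ℕ.n≤1+n (length χs)
      length-addSeparator r {false} Hr χs = ℕ.≤-refl

      length-separators : ∀ rs → length (separators rs) ≤ length rs
      length-separators []       = z≤n
      length-separators (r ∷ rs) = ℕ.≤-trans (length-addSeparator r refl (separators rs))
        (s≤s (length-separators rs))

      separated-here : ∀ {x r b} (Hr : H r ≡ b) χs → H x ≡ false → x ~ r →
                       Any (Separates x) (addSeparator r Hr χs)
      separated-here {x} {r} {true}  Hr χs Hx x~r = contradiction
        (trans (sym Hx) (trans (cong H (sym (//-rightDividesˡ r x))) (∙∈ x~r Hr))) λ ()
      separated-here {x} {r} {false} Hr χs Hx x~r =
        here (separates-coset {χ = proj₁ (separate isSubgroup r Hr)} x~r (proj₂ (separate isSubgroup r Hr)))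

      separated-there : ∀ {x r b} (Hr : H r ≡ b) {χs} → Any (Separates x) χs →
                        Any (Separates x) (addSeparator r Hr χs)
      separated-there {b = true}  Hr sep = sep
      separated-there {b = false} Hr sep = there sep

      separated : ∀ {x rs} → H x ≡ false → Any (x ~_) rs → Any (Separates x) (separators rs)
      separated {rs = r ∷ rs} Hx (here x~r)   = separated-here refl (separators rs) Hx x~r
      separated {rs = r ∷ rs} Hx (there x~rs) = separated-there refl (separated Hx x~rs)

      frequencies : List (Hom H)
      frequencies = deduplicate _≟ʰ_ (separators representatives)

      record Near (i : Fin n) (χ : Hom H) : Set where
        constructor near
        field
          distance≤1 : modulus (E (φ χ i) -ᶜ 1ℂ) D.≤ 1ℝ

      members-near : ∀ {i} → H i ≡ true → ∀ χ → Near i χ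
      members-near {i} Hi χ = near (E-near {φ χ i} (kills χ Hi))

      not-near : ∀ {i χ} → Separates i χ → ¬ Near i χ
      not-near {i} {χ} (a , eq , N≤4a , 2a≤N) (near close) = E-far {a} {φ χ i} eq N≤4a 2a≤N close

      separated-frequencies : ∀ {i} → H i ≡ false → Any (Separates i) frequencies
      separated-frequencies {i} Hi = Any.deduplicate⁺ _≟ʰ_
        (λ {χ} {ψ} ψ≈χ → separates-resp {i} {χ} {ψ} (sym ∘ ψ≈χ))
        (separated {i} {representatives} Hi (represented i))

      near-members : ∀ i → All (Near i) frequencies → H i ≡ true
      near-members i all-near = decidable-stable (H i Bool.≟ true) λ Hi →
        All.All¬⇒¬Any (All.map (λ {χ} close sep → not-near {i} {χ} sep close) all-near)
          (separated-frequencies (Bool.¬-not Hi))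

      characters : List (Character G)
      characters = map character frequencies

      distinct-characters : AllPairs (λ γ χ → ¬ (γ ≈ᵡ χ)) characters
      distinct-characters = AllPairs.map⁺ (AllPairs.map
        (λ {χ} {ψ} χ≉ψ same → χ≉ψ (character-injective χ ψ same))
        (Unique.deduplicate-! homs (separators representatives)))

      inBohr⁺ : ∀ x → H (to x) ≡ true → InBohr characters 1ℝ x
      inBohr⁺ x Hx = All.map⁺ (All.universal (λ χ → Near.distance≤1 (members-near Hx χ)) frequencies)

      inBohr⁻ : ∀ x → InBohr characters 1ℝ x → H (to x) ≡ true
      inBohr⁻ x inBohr = near-members (to x) (All.map near (All.map⁻ inBohr))

      bohrSet : BohrSet G
      bohrSet = record
        { frequencies = characters
        ; distinct    = distinct-characters
        ; width       = 1ℝ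
        ; 0≤width     = λ e 0<e → 0 , λ _ _ → 0≤+ {ℚ.1ℚ} {e} 0≤1 (ℚ.<⇒≤ 0<e)
        ; width≤1     = λ e 0<e → 0 , λ _ _ → ≤-by {ℚ.1ℚ} e (ℚ.<⇒≤ 0<e) refl
        ; subset      = record
          { member   = λ x → H (to x) ≡ true
          ; member?  = λ x → H (to x) Bool.≟ true
          ; respects = λ x≈y → trans (cong H (sym (to-cong x≈y))) }
        ; ∈-subset    = λ x → mk⇔ (inBohr⁺ x) (inBohr⁻ x) }

      rank≤ : ∀ {I} → n ≤ I * count H → BohrSet.rank bohrSet ≤ I
      rank≤ {I} n≤ = ℕ.≤-trans (ℕ.≤-reflexive (length-map character frequencies))
        (ℕ.≤-trans (length-deduplicate _≟ʰ_ (separators representatives))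
        (ℕ.≤-trans (length-separators representatives)
          (ℕ.*-cancelʳ-≤ (length representatives) I (count H) ⦃ ℕ.>-nonZero 0<H ⦄
            (ℕ.≤-trans index-bound n≤))))
        where
        0<H : 0 < count H
        0<H = ℕ.n≢0⇒n>0 λ H≡0 → ℕ.<-irrefl refl (ℕ.<-≤-trans 0<n
          (ℕ.≤-trans n≤ (ℕ.≤-reflexive (trans (cong (I *_) H≡0) (ℕ.*-zeroʳ I)))))

    record RegularBohrSet {p} (A : Subset G p) (m I : ℕ) : Set (c ⊔ ℓ ⊔ lsuc 0ℓ) where
      field
        B         : BohrSet G
        width≡1   : BohrSet.width B ≡ 1ℝ
        rank≤     : BohrSet.rank B ≤ I
        dichotomy : ∀ g → m * card ((A -ˢ g) ∩ BohrSet.subset B) ≤ card (BohrSet.subset B)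
                        ⊎ m * card (BohrSet.subset B ∖ (A -ˢ g)) ≤ card (BohrSet.subset B)

    regularBohrSet : ∀ {p} (A : Subset G p) {m I} → RegularSubgroup (A′ A) m I → RegularBohrSet A m I
    regularBohrSet A {m} R = record
      { B = bohrSet ; width≡1 = refl ; rank≤ = rank≤ index
      ; dichotomy = λ g → Sum.map
          (subst₂ (λ x y → m * x ≤ y) (sym (inter g)) (sym card-B))
          (subst₂ (λ x y → m * x ≤ y) (sym (diff g)) (sym card-B)) (dichotomy (to g)) }
      where
      open RegularSubgroup R
      open Annihilator (rootsOfUnity n 0<n) H isSubgroup
      open BohrSet bohrSet using (subset)

      does-H : ∀ i → does (H (to (from i)) Bool.≟ true) ≡ H i
      does-H i = trans (cong (λ j → does (H j Bool.≟ true)) (to-from i)) (≟true (H i))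
        where
        ≟true : ∀ b → does (b Bool.≟ true) ≡ b
        ≟true true  = refl
        ≟true false = refl

      card-B : card subset ≡ count H
      card-B = trans (card≡count subset) (sum-cong-≗ (cong ⟦_⟧ ∘ does-H))

      A-g : ∀ g i → does (Subset.member? A (from i ∙ g)) ≡ A′ A (to g ⊕ i)
      A-g g i = trans (A′-∙ A (from i) g) (cong (A′ A)
        (trans (cong (_⊕ to g) (to-from i)) (IsAbelianGroup.comm isAbelianGroup′ i (to g))))

      inter : ∀ g → card ((A -ˢ g) ∩ subset) ≡ count (λ h → H h ∧ A′ A (to g ⊕ h))
      inter g = trans (card≡count ((A -ˢ g) ∩ subset)) (sum-cong-≗ λ i → cong ⟦_⟧
        (trans (Bool.∧-comm (does (Subset.member? A (from i ∙ g))) _) (cong₂ _∧_ (does-H i) (A-g g i))))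

      diff : ∀ g → card (subset ∖ (A -ˢ g)) ≡ count (λ h → H h ∧ not (A′ A (to g ⊕ h)))
      diff g = trans (card≡count (subset ∖ (A -ˢ g))) (sum-cong-≗ λ i → cong ⟦_⟧
        (cong₂ _∧_ (does-H i) (cong not (A-g g i))))

-- Rational scales for ε.

module Scales where
  open import Data.Rational using (_+_; _*_; _-_; _≤_; _<_; ∣_∣)
  open import Defs using (ℝ; fromℕ; fromℕ-suc; fromℕ-*; fromℕ-mono; step; step-small;
    0<*; near⇒≤; 0≤-mono-*; 0ℝ; 1ℝ; inverse; cauchy; seq)
  open FiniteGroups using (least)
  open UnitCircle
  open +-*-Solver

  pow : ℚ → ℕ → ℚ
  pow x zero    = 1ℚ
  pow x (suc n) = x * pow x n

  seq-^ : ∀ x n k → seq (x D.^ n) k ≡ pow (seq x k) n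
  seq-^ x zero    k = refl
  seq-^ x (suc n) k = cong (seq x k *_) (seq-^ x n k)

  pow-+ : ∀ x m n → pow x (m ℕ.+ n) ≡ pow x m * pow x n
  pow-+ x zero    n = sym (ℚ.*-identityˡ (pow x n))
  pow-+ x (suc m) n = trans (cong (x *_) (pow-+ x m n)) (sym (ℚ.*-assoc x (pow x m) (pow x n)))

  0≤pow : ∀ {x} n → 0ℚ ≤ x → 0ℚ ≤ pow x n
  0≤pow zero    0≤x = 0≤1
  0≤pow (suc n) 0≤x = 0≤* 0≤x (0≤pow n 0≤x)

  pow≤1 : ∀ {x} n → 0ℚ ≤ x → x ≤ 1ℚ → pow x n ≤ 1ℚ
  pow≤1 zero    0≤x x≤1 = ℚ.≤-refl
  pow≤1 (suc n) 0≤x x≤1 = ℚ.≤-trans (≤1-*≤ 0≤x (pow≤1 n 0≤x x≤1)) x≤1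

  0≤fromℕ : ∀ n → 0ℚ ≤ fromℕ n
  0≤fromℕ n = fromℕ-mono z≤n

  fromℕ-^≤pow : ∀ {y} m d n → fromℕ m ≤ pow y d → fromℕ (m ℕ.^ n) ≤ pow y (n ℕ.* d)
  fromℕ-^≤pow m d zero    h = ℚ.≤-refl
  fromℕ-^≤pow {y} m d (suc n) h = subst₂ _≤_ (sym (fromℕ-* m (m ℕ.^ n))) (sym (pow-+ y d (n ℕ.* d)))
    (0≤-mono-* (0≤fromℕ m) (ℚ.≤-trans (0≤fromℕ (m ℕ.^ n)) IH) h IH)
    where
    IH : fromℕ (m ℕ.^ n) ≤ pow y (n ℕ.* d)
    IH = fromℕ-^≤pow m d n h

  archimedean : ∀ q → 0ℚ < q → ∃[ m ] 1ℚ ≤ fromℕ m * q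
  archimedean q 0<q =
    let (N , h) = step-small q 0<q
    in suc N , subst₂ _≤_ (trans (ℚ.*-comm (fromℕ (suc N)) (step N)) (step-inverse N)) refl
                 (*-monoˡ (fromℕ (suc N)) (0≤fromℕ (suc N)) (h N ℕ.≤-refl))

  pow5-inverse : ∀ {x y M} → 0ℚ ≤ y → y * x ≡ 1ℚ → M * pow x 5 ≤ 1ℚ → M ≤ pow y 5
  pow5-inverse {x} {y} {M} 0≤y yx h = subst₂ _≤_
    (trans (solve 3 (λ x y M →
        (M :* (x :* (x :* (x :* (x :* (x :* con 1ℚ)))))) :* (y :* (y :* (y :* (y :* (y :* con 1ℚ)))))
        := M :* ((y :* x) :* ((y :* x) :* ((y :* x) :* ((y :* x) :* (y :* x)))))) refl x y M)
      (trans (cong (λ p → M * (p * (p * (p * (p * p))))) yx) (ℚ.*-identityʳ M)))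
    (ℚ.*-identityˡ (pow y 5))
    (*-monoʳ (pow y 5) (0≤pow 5 0≤y) h)

  -- The number ε is only located between 7s and 9s for a rational s, and 7 * 1/14 = 1/2. So s above
  -- 1/14 forces ε ≥ 1/2, while s at most 1/14 gives ε ≤ 9/14, still bounded away from 1.
  σ : ℚ
  σ = ℤ.+ 1 ℚ./ 14

  seven nine : ℚ → ℚ
  seven s = fromℕ 7 * s
  nine  s = fromℕ 9 * s

  module Scale (ε : ℝ) (0<ε : 0ℝ D.< ε) (ε<1 : ε D.< 1ℝ) where
    private
      e₁ = proj₁ 0<ε
      0<e₁ = proj₁ (proj₂ 0<ε)

    lower : Eventually (λ n → e₁ ≤ seq ε n)
    lower = let (_ , _ , N , h) = 0<ε
            in N , λ n n≥ → subst (_≤ seq ε n) (ℚ.+-identityˡ e₁) (h n n≥)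

    positive : Eventually (λ n → 0ℚ ≤ seq ε n)
    positive = ev-map (λ n → ℚ.≤-trans (ℚ.<⇒≤ 0<e₁)) lower

    upper : Eventually (λ n → seq ε n ≤ 1ℚ)
    upper = let (e , 0<e , N , h) = ε<1
            in N , λ n n≥ → ℚ.≤-trans (≤-by e (ℚ.<⇒≤ 0<e) refl) (h n n≥)

    -- A late term a of the sequence is at least e₁, and later terms differ from it by at most e₁/8.
    -- With s = a/8 they lie within s of 8s.
    approximation : ∃[ s ] 0ℚ < s × Eventually (λ n → seven s ≤ seq ε n × seq ε n ≤ nine s)
    approximation = s , 0<* 0<a (ℚ.positive⁻¹ ⅛) , M , λ n n≥ →
        low n (near⇒≤ {a} {seq ε n} (close ℕ.≤-refl n≥)) ,
        high n (near⇒≤ {seq ε n} {a} (close n≥ ℕ.≤-refl))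
      where
      N₁ = proj₁ lower
      c = cauchy ε (e₁ * ⅛) (0<* 0<e₁ (ℚ.positive⁻¹ ⅛))
      N₂ = proj₁ c
      M = N₁ ℕ.⊔ N₂
      a = seq ε M
      e₁≤a : e₁ ≤ a
      e₁≤a = proj₂ lower M (ℕ.m⊔n≤o⇒m≤o N₁ N₂ ℕ.≤-refl)
      0<a : 0ℚ < a
      0<a = ℚ.<-≤-trans 0<e₁ e₁≤a
      s = a * ⅛
      e₁⅛≤s : e₁ * ⅛ ≤ s
      e₁⅛≤s = *-monoʳ ⅛ (ℚ.<⇒≤ (ℚ.positive⁻¹ ⅛)) e₁≤a
      close : ∀ {m n} → M ℕ.≤ m → M ℕ.≤ n → ∣ seq ε m - seq ε n ∣ ≤ e₁ * ⅛
      close {m} {n} m≥ n≥ = proj₂ c m n (ℕ.m⊔n≤o⇒n≤o N₁ N₂ m≥) (ℕ.m⊔n≤o⇒n≤o N₁ N₂ n≥)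
      low : ∀ n → a ≤ seq ε n + e₁ * ⅛ → seven s ≤ seq ε n
      low n h = ≤-by ((seq ε n + e₁ * ⅛ - a) + (s - e₁ * ⅛)) (0≤+ (0≤- h) (0≤- e₁⅛≤s))
        (solve 3 (λ a x e → con (fromℕ 7) :* (a :* con ⅛) :+ ((x :+ e :- a) :+ (a :* con ⅛ :- e)) := x)
          refl a (seq ε n) (e₁ * ⅛))
      high : ∀ n → seq ε n ≤ a + e₁ * ⅛ → seq ε n ≤ nine s
      high n h = ℚ.≤-trans h (≤-by (s - e₁ * ⅛) (0≤- e₁⅛≤s)
        (solve 2 (λ a e → (a :+ e) :+ (a :* con ⅛ :- e) := con (fromℕ 9) :* (a :* con ⅛))
          refl a (e₁ * ⅛)))

    y : ℕ → ℚ
    y = seq (inverse ε 0<ε)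

    y-inverse : Eventually (λ n → 0ℚ ≤ y n × y n * seq ε n ≡ 1ℚ)
    y-inverse = ev-map inv lower
      where
      inv : ∀ n → e₁ ≤ seq ε n → 0ℚ ≤ y n × y n * seq ε n ≡ 1ℚ
      inv n e₁≤ε =
          ℚ.<⇒≤ (ℚ.positive⁻¹ (y n) ⦃ ℚ.1/pos⇒pos (seq ε n ℚ.⊔ e₁) ⦃ ℚ.positive 0<max ⦄ ⦄)
        , trans (cong (y n *_) (sym (ℚ.p≥q⇒p⊔q≡p e₁≤ε)))
                (ℚ.*-inverseˡ (seq ε n ℚ.⊔ e₁) ⦃ ℚ.>-nonZero 0<max ⦄)
        where
        0<max : 0ℚ < seq ε n ℚ.⊔ e₁
        0<max = ℚ.<-≤-trans 0<e₁ (ℚ.p≤q⊔p (seq ε n) e₁)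

    -- The dichotomy is wanted at precision 1/m, and the rank is bounded by a power of M. In the
    -- case of large ε nothing above M = 1 is safe, as ε^(-5) may be arbitrarily close to 1.
    record Resolution : Set where
      field
        m M  : ℕ
        0<m  : 0 ℕ.< m
        1≤mε : Eventually (λ n → 1ℚ ≤ fromℕ m * seq ε n)
        M≤y⁵ : Eventually (λ n → fromℕ M ≤ pow (y n) 5)
        size : (m ≡ 2 × M ≡ 1) ⊎ (m ≡ M × 2 ℕ.≤ m)

    resolution : Resolution
    resolution = go (s ℚ.≤? σ)
      where
      s = proj₁ approximation
      0<s = proj₁ (proj₂ approximation)
      bounds = proj₂ (proj₂ approximation)
      0≤s : 0ℚ ≤ s
      0≤s = ℚ.<⇒≤ 0<s

      0≤7 : 0ℚ ≤ fromℕ 7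
      0≤7 = 0≤fromℕ 7

      0<7s : 0ℚ < seven s
      0<7s = 0<* (ℚ.positive⁻¹ (fromℕ 7)) 0<s

      invert : ∀ M → Eventually (λ n → fromℕ M * pow (seq ε n) 5 ≤ 1ℚ) →
               Eventually (λ n → fromℕ M ≤ pow (y n) 5)
      invert M h = ev-map (λ n (le , 0≤y , inv) → pow5-inverse {M = fromℕ M} 0≤y inv le) (ev-× h y-inverse)

      go : Dec (s ≤ σ) → Resolution
      go (no ≰) = record
        { m = 2 ; M = 1 ; 0<m = s≤s z≤n ; size = inj₁ (refl , refl)
        ; 1≤mε = ev-map (λ n (lo , _) → ℚ.≤-trans 1≤14s (*-monoˡ (fromℕ 2) (0≤fromℕ 2) lo)) bounds
        ; M≤y⁵ = invert 1 (ev-map (λ n (0≤ε , ε≤1) → ℚ.≤-trans (ℚ.≤-reflexive (ℚ.*-identityˡ _))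
            (pow≤1 5 0≤ε ε≤1)) (ev-× positive upper)) }
        where
        1≤14s : 1ℚ ≤ fromℕ 2 * seven s
        1≤14s = ℚ.≤-trans (toWitness {a? = 1ℚ ℚ.≤? fromℕ 2 * seven σ} _)
          (*-monoˡ (fromℕ 2) (0≤fromℕ 2) (*-monoˡ (fromℕ 7) 0≤7 (ℚ.<⇒≤ (ℚ.≰⇒> ≰))))
      go (yes s≤σ) = fine (least (λ m → 1ℚ ℚ.≤? fromℕ m * seven s)
                        (proj₁ (archimedean (seven s) 0<7s)) (proj₂ (archimedean (seven s) 0<7s)))
        where
        7s≤½ : seven s ≤ ½
        7s≤½ = ℚ.≤-trans (*-monoˡ (fromℕ 7) 0≤7 s≤σ) (toWitness {a? = seven σ ℚ.≤? ½} _)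

        Fine : ℕ → Set
        Fine m = 1ℚ ≤ fromℕ m * seven s × (∀ {j} → j ℕ.< m → ¬ (1ℚ ≤ fromℕ j * seven s))

        fine : ∃[ m ] Fine m → Resolution
        fine (zero , h , _) = contradiction (ℚ.≤-trans h (ℚ.≤-reflexive (ℚ.*-zeroˡ (seven s))))
          (toWitnessFalse {a? = 1ℚ ℚ.≤? 0ℚ} _)
        fine (suc zero , h , _) = contradiction
          (ℚ.≤-trans h (ℚ.≤-trans (ℚ.≤-reflexive (ℚ.*-identityˡ (seven s))) 7s≤½))
          (toWitnessFalse {a? = 1ℚ ℚ.≤? ½} _)
        fine (suc (suc m) , h , min) = record
          { m = suc (suc m) ; M = suc (suc m) ; 0<m = s≤s z≤n
          ; size = inj₂ (refl , s≤s (s≤s z≤n))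
          ; 1≤mε = ev-map (λ n (lo , _) → ℚ.≤-trans h (*-monoˡ k 0≤k lo)) bounds
          ; M≤y⁵ = invert (suc (suc m)) (ev-map (λ n (0≤ε , _ , hi) → small n 0≤ε hi) (ev-× positive bounds)) }
          where
          k = fromℕ (suc (suc m))
          0≤k : 0ℚ ≤ k
          0≤k = 0≤fromℕ (suc (suc m))
          -- Minimality gives (k - 1) * 7s < 1, and 7s ≤ 1/2, so 14ks = 2 (k - 1) 7s + 2 * 7s is at
          -- most 2 + 1.
          k14s≤3 : k * (fromℕ 14 * s) ≤ fromℕ 3
          k14s≤3 = ℚ.≤-trans (ℚ.≤-reflexive (trans
              (cong (_* (fromℕ 14 * s)) (fromℕ-suc (suc m)))
              (solve 2 (λ m s → (m :+ con 1ℚ) :* (con (fromℕ 14) :* s)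
                := con (fromℕ 2) :* (m :* (con (fromℕ 7) :* s)) :+ con (fromℕ 2) :* (con (fromℕ 7) :* s))
                refl (fromℕ (suc m)) s)))
            (ℚ.+-mono-≤ {fromℕ 2 * (fromℕ (suc m) * seven s)} {fromℕ 2} {fromℕ 2 * seven s} {1ℚ}
              (ℚ.≤-trans (*-monoˡ (fromℕ 2) (0≤fromℕ 2) (ℚ.<⇒≤ (ℚ.≰⇒> (min ℕ.≤-refl))))
                (ℚ.≤-reflexive (ℚ.*-identityʳ (fromℕ 2))))
              (ℚ.≤-trans (*-monoˡ (fromℕ 2) (0≤fromℕ 2) 7s≤½) (ℚ.≤-reflexive refl)))

          -- The origin of the exponent 5: kx ≤ 14ks ≤ 3, and x ≤ 9/14 gives x² ≤ 1/2, so the four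
          -- further factors x bring 3 down to 3/4.
          small : ∀ n → 0ℚ ≤ seq ε n → seq ε n ≤ nine s → k * pow (seq ε n) 5 ≤ 1ℚ
          small n 0≤x x≤9s = ℚ.≤-trans
            (ℚ.≤-reflexive (solve 2 (λ k x → k :* (x :* (x :* (x :* (x :* (x :* con 1ℚ)))))
              := (k :* x) :* ((x :* x) :* (x :* x))) refl k x))
            (ℚ.≤-trans (0≤-mono-* (0≤* 0≤k 0≤x) (0≤* 0≤½ 0≤½) kx≤3
              (0≤-mono-* (0≤sq x) 0≤½ x²≤½ x²≤½))
              (toWitness {a? = fromℕ 3 * (½ * ½) ℚ.≤? 1ℚ} _))
            where
            x = seq ε n
            0≤½ : 0ℚ ≤ ½
            0≤½ = ℚ.<⇒≤ (ℚ.positive⁻¹ ½)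
            x²≤½ : x * x ≤ ½
            x²≤½ = ℚ.≤-trans (0≤-mono-* 0≤x (ℚ.≤-trans 0≤x x≤9σ) x≤9σ x≤9σ)
              (toWitness {a? = nine σ * nine σ ℚ.≤? ½} _)
              where
              x≤9σ : x ≤ nine σ
              x≤9σ = ℚ.≤-trans x≤9s (*-monoˡ (fromℕ 9) (0≤fromℕ 9) s≤σ)
            kx≤3 : k * x ≤ fromℕ 3
            kx≤3 = ℚ.≤-trans (*-monoˡ k 0≤k (ℚ.≤-trans x≤9s
              (*-monoʳ s 0≤s (fromℕ-mono {9} {14} (ℕ.m≤m+n 9 5))))) k14s≤3

open import Defs
open FiniteGroups
open UnitCircle using (Eventually; ev-map; ev-×; ≤-by; *-monoˡ)
open BohrSets
open Scales

-- Width, rank and density bounds in terms of ε.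

eventually-≤ : ∀ {x y} → Eventually (λ n → seq x n ℚ.≤ seq y n) → x ≤ y
eventually-≤ h e 0<e = ev-map (λ n le → ℚ.≤-trans le (≤-by e (ℚ.<⇒≤ 0<e) refl)) h

proportion : ∀ ε {m a b} → Eventually (λ n → 1ℚ ℚ.≤ fromℕ m ℚ.* seq ε n) →
             Eventually (λ n → 0ℚ ℚ.≤ seq ε n) → m ℕ.* a ℕ.≤ b → ℕ→ℝ a ≤ ε * ℕ→ℝ b
proportion ε {m} {a} {b} 1≤mε 0≤ε ma≤b = eventually-≤ {ℕ→ℝ a} {ε * ℕ→ℝ b}
  (ev-map (λ n (h , 0≤x) → bound (seq ε n) h 0≤x) (ev-× 1≤mε 0≤ε))
  where
  bound : ∀ x → 1ℚ ℚ.≤ fromℕ m ℚ.* x → 0ℚ ℚ.≤ x → fromℕ a ℚ.≤ x ℚ.* fromℕ b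
  bound x h 0≤x = ℚ.≤-trans
    (subst (ℚ._≤ fromℕ a ℚ.* (fromℕ m ℚ.* x)) (ℚ.*-identityʳ (fromℕ a))
      (*-monoˡ (fromℕ a) (0≤fromℕ a) h))
    (ℚ.≤-trans (ℚ.≤-reflexive (trans (sym (ℚ.*-assoc (fromℕ a) (fromℕ m) x))
        (trans (cong (ℚ._* x) (trans (ℚ.*-comm (fromℕ a) (fromℕ m)) (sym (fromℕ-* m a))))
          (ℚ.*-comm (fromℕ (m ℕ.* a)) x))))
      (*-monoˡ x 0≤x (fromℕ-mono ma≤b)))

Approximated : ∀ {c ℓ p} (ε : ℝ) → 0ℝ < ε → ℕ → (G : FiniteAbelianGroup c ℓ) → Subset G p → Set (c ⊔ ℓ ⊔ lsuc 0ℓ)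
Approximated ε 0<ε C G A =
  Σ[ B ∈ BohrSet G ]
    ε ^ C ≤ BohrSet.width B ×
    ℕ→ℝ (BohrSet.rank B) ≤ inverse ε 0<ε ^ C ×
    ((g : FiniteAbelianGroup.Carrier G) →
       ℕ→ℝ (card ((A -ˢ g) ∩ BohrSet.subset B)) ≤ ε * ℕ→ℝ (card (BohrSet.subset B))
     ⊎ ℕ→ℝ (card (BohrSet.subset B ∖ (A -ˢ g))) ≤ ε * ℕ→ℝ (card (BohrSet.subset B)))

module _ (ε : ℝ) (0<ε : 0ℝ < ε) (ε<1 : ε < 1ℝ) where
  open Scale ε 0<ε ε<1
  open Resolution resolution

  module _ {c ℓ p} (G : FiniteAbelianGroup c ℓ) (A : Subset G p) where
    open Transport G

    approximated : ∀ {I} j → I ℕ.≤ M ℕ.^ j → RegularBohrSet A m I → Approximated ε 0<ε (j ℕ.* 5) G A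
    approximated j I≤ R = B
      , subst (ε ^ C ≤_) (sym width≡1) (eventually-≤ {ε ^ C} {1ℝ}
          (ev-map (λ n (0≤x , x≤1) → subst (ℚ._≤ 1ℚ) (sym (seq-^ ε C n)) (pow≤1 C 0≤x x≤1))
            (ev-× positive upper)))
      , eventually-≤ {ℕ→ℝ (BohrSet.rank B)} {inverse ε 0<ε ^ C} (ev-map (λ n h →
          subst (fromℕ (BohrSet.rank B) ℚ.≤_) (sym (seq-^ (inverse ε 0<ε) C n))
            (ℚ.≤-trans (fromℕ-mono (ℕ.≤-trans rank≤ I≤)) (fromℕ-^≤pow {y n} M 5 j h))) M≤y⁵)
      , λ g → Sum.map (proportion ε {m} 1≤mε positive) (proportion ε {m} 1≤mε positive) (dichotomy g)
      where
      open RegularBohrSet R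
      C = j ℕ.* 5

    stable⇒approximated : ∀ k → Stable k A →
      Approximated ε 0<ε (suc (3 ℕ.* exponent (ladderHeight k) 0) ℕ.* 5) G A
    stable⇒approximated k stable = Sum.[ coarse , fine ]′ size
      where
      open FinGroup isAbelianGroup′
      d = exponent (ladderHeight k) 0
      -- By `index≤power` the rank is at most m^j, and m ≤ ε^(-5) then gives the exponent j * 5.
      j = suc (3 ℕ.* d)

      coarse : m ≡ 2 × M ≡ 1 → Approximated ε 0<ε (j ℕ.* 5) G A
      coarse (m≡2 , M≡1) = approximated j (ℕ.≤-reflexive (sym (trans (cong (ℕ._^ j) M≡1) (ℕ.^-zeroˡ j))))
        (regularBohrSet A (subst (λ m → RegularSubgroup (A′ A) m 1) (sym m≡2) (wholeGroup (A′ A))))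

      fine : m ≡ M × 2 ℕ.≤ m → Approximated ε 0<ε (j ℕ.* 5) G A
      fine (m≡M , 2≤m) = approximated j
        (subst (λ M → 2 ℕ.* (4 ℕ.* m) ℕ.^ d ℕ.≤ M ℕ.^ j) m≡M (index≤power m d 2≤m))
        (regularBohrSet A (regularSubgroup (A′ A) k (stable′ A k stable) m 0<m))

theorem3 : ∀ {c ℓ p} (k : ℕ) → 2 ℕ.≤ k →
    Σ[ C ∈ ℕ ] 0 ℕ.< C ×
    ((ε : ℝ) (0<ε : 0ℝ < ε) → ε < 1ℝ →
    Σ[ N₀ ∈ ℕ ]
    ((G : FiniteAbelianGroup c ℓ) → N₀ ℕ.≤ FiniteAbelianGroup.order G →
    (A : Subset G p) → Stable k A →
    Σ[ B ∈ BohrSet G ]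
    ε ^ C ≤ BohrSet.width B ×
    ℕ→ℝ (BohrSet.rank B) ≤ inverse ε 0<ε ^ C ×
    ((g : FiniteAbelianGroup.Carrier G) →
    ℕ→ℝ (card ((A -ˢ g) ∩ BohrSet.subset B)) ≤ ε * ℕ→ℝ (card (BohrSet.subset B))
    ⊎ ℕ→ℝ (card (BohrSet.subset B ∖ (A -ˢ g))) ≤ ε * ℕ→ℝ (card (BohrSet.subset B)))))
theorem3 k _ =
  suc (3 ℕ.* exponent (ladderHeight k) 0) ℕ.* 5 , s≤s z≤n , λ ε 0<ε ε<1 →
  0 , λ G _ A stable → stable⇒approximated ε 0<ε ε<1 G A k stable
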